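{- For every positive integer $t$ and every positive integer $n$, every graph on $n$ vertices that contains no subdivision of $K_t$ has at most $2^{50t} n$ cliques.
   Context: Graphs are finite and simple. A clique is a set of pairwise adjacent vertices; the empty set counts as a clique. A $K_t$-subdivision in a graph $G$ is a subgraph of $G$ obtained from a copy of the complete graph $K_t$ by replacing its edges with internally vertex-disjoint paths. -}

module Defs where

open import Data.Nat using (ℕ; zero; suc)
open import Data.Bool using (Bool; T)
open import Data.Fin using (Fin; _<_)
open import Data.Fin.Properties using (all?)
open import Data.Fin.Subset using (Subset; Side; inside; outside; _∈_)
open import Data.Fin.Subset.Properties using (_∈?_)
open import Data.Fin.Properties using (_≟_)
open import Data.List using (List; []; _∷_; [_]; _++_; map; length; filter)
open import Data.List.Relation.Unary.AllPairs using (AllPairs)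
open import Data.List.Relation.Unary.Unique.Propositional using (Unique)
open import Data.List.Membership.Propositional renaming (_∈_ to _∈ₗ_)
open import Data.Vec using ([]; _∷_)
open import Data.Product using (_×_; _,_)
open import Data.Bool.Properties using (T?)
open import Relation.Binary.PropositionalEquality using (_≡_; _≢_)
open import Relation.Nullary using (¬_; Dec)
open import Relation.Nullary.Decidable using (_→-dec_; ¬?)

record Graph (n : ℕ) : Set where
  field
    adj   : Fin n → Fin n → Bool
    sym   : ∀ u v → adj u v ≡ adj v u
    irrefl : ∀ v → adj v v ≡ Data.Bool.false

  Adj : Fin n → Fin n → Set
  Adj u v = T (adj u v)

open Graph public

-- A clique: a set of pairwise adjacent vertices (the empty set is a clique).
IsClique : ∀ {n} → Graph n → Subset n → Set
IsClique G S = ∀ u v → u ∈ S → v ∈ S → u ≢ v → Adj G u v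

isClique? : ∀ {n} (G : Graph n) (S : Subset n) → Dec (IsClique G S)
isClique? G S =
  all? λ u → all? λ v →
    (u ∈? S) →-dec ((v ∈? S) →-dec (¬? (u ≟ v) →-dec T? (adj G u v)))

allSubsets : ∀ n → List (Subset n)
allSubsets zero = [ [] ]
allSubsets (suc n) = map (outside ∷_) (allSubsets n) ++ map (inside ∷_) (allSubsets n)

numCliques : ∀ {n} → Graph n → ℕ
numCliques {n} G = length (filter (isClique? G) (allSubsets n))

data Walk {n} (G : Graph n) : List (Fin n) → Set where
  single : ∀ v → Walk G (v ∷ [])
  step   : ∀ u v vs → Adj G u v → Walk G (v ∷ vs) → Walk G (u ∷ v ∷ vs)

IsPath : ∀ {n} (G : Graph n) → List (Fin n) → Set
IsPath G vs = Walk G vs × Unique vs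

record KSubdivision {n} (t : ℕ) (G : Graph n) : Set where
  field
    branch       : Fin t → Fin n
    branch-inj   : ∀ i j → branch i ≡ branch j → i ≡ j
    inner        : (i j : Fin t) → i < j → List (Fin n)
    isPath       : ∀ i j (i<j : i < j) →
                   IsPath G (branch i ∷ inner i j i<j ++ [ branch j ])
    inner-notBranch : ∀ i j (i<j : i < j) v → v ∈ₗ inner i j i<j → ∀ k → v ≢ branch k
    disjoint     : ∀ i j (i<j : i < j) i' j' (i'<j' : i' < j') v →
                   v ∈ₗ inner i j i<j → v ∈ₗ inner i' j' i'<j' →
                   (i ≡ i' × j ≡ j')

ContainsKSubdivision : ∀ {n} → ℕ → Graph n → Set
ContainsKSubdivision t G = KSubdivision t G

-- Two facts about a graph G without a subdivision of K_t are combined.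
--
-- (1) Every nonempty vertex set S contains a vertex with at most 64 t⁴ neighbours in S.  Otherwise
-- take a smallest W with many edges, choose t hubs in it together with t − 1 private neighbours of
-- each, and let X be these t² vertices.  Following Thomas and Wollan, X is linked in W: contract
-- edges outside X as long as the edge density survives.  A small separation which becomes too dense
-- on its far side is itself linked by induction, so that side can be replaced by a clique on the
-- separator.  When no contraction is possible, every edge at a vertex of low degree lies in many
-- triangles; its neighbourhood, or one side of a small cut of it, has many short connections between
-- any two vertices, and Menger's theorem carries X into it.
--
-- (2) If every vertex of a set S misses at most b vertices of S, where 4t ≤ |S|, 4b ≤ |S| and
-- 4t²b ≤ |S|², then t hubs chosen greedily in S have at most |S|/4 nonadjacent pairs, and each such
-- pair can be joined through its own common neighbour.  Hence S has a vertex v missing more than b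
-- vertices.  Every clique avoids v or lies in its neighbourhood, so raising the size bound from k to
-- k + b multiplies the maximal number of cliques by at most b + 1.  Starting from 2^(4t) cliques on 4t
-- vertices this gives at most 2^(50t − 1) cliques on 64 t⁴ vertices if t is large; for small t the bound
-- (|S| + 1)^t suffices.
--
-- By (1) the vertices can be removed one at a time, each lying in at most 2^(50t − 1) of the remaining
-- cliques.
module Submission where

open import Defs hiding (sym)
open import Data.Bool using (T)
open import Data.Bool.Properties using (T?)
open import Data.Empty using (⊥; ⊥-elim)
open import Data.Fin using (Fin; zero; suc; toℕ; combine; remQuot) renaming (_<_ to _<ᶠ_)
open import Data.Fin.Properties using (_≟_; any?; all?; suc-injective; combine-injective; remQuot-combine; combine-remQuot; toℕ-injective)
open import Data.Fin.Subset using (Subset; inside; outside) renaming (_∈_ to _∈ˢ_)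
open import Data.Fin.Subset.Properties using (anySubset?) renaming (_∈?_ to _∈ˢ?_)
open import Data.List as List using (List; []; _∷_; [_]; _++_; length; filter; allFin; tabulate; map; cartesianProduct)
open import Data.List.Membership.Propositional using (find; lose) renaming (_∈_ to _∈ₗ_)
open import Data.List.Membership.Propositional.Properties using (∈-filter⁺; ∈-filter⁻; ∈-allFin; ∈-cartesianProduct⁺; ∈-map⁺; ∈-map⁻; ∈-++⁻; ∈-++⁺ˡ; ∈-++⁺ʳ)
open import Data.List.Properties using (length-map; length-tabulate; length-++; filter-++)
open import Data.List.Relation.Unary.All as All using ([]; _∷_)
open import Data.List.Relation.Unary.All.Properties using (¬Any⇒All¬)
open import Data.List.Relation.Unary.AllPairs using ([]; _∷_)
open import Data.List.Relation.Unary.Any as Any using (here; there; index)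
open import Data.List.Relation.Unary.Any.Properties using (lookup-index)
open import Data.List.Relation.Unary.Unique.Propositional using (Unique)
open import Data.List.Relation.Unary.Unique.Propositional.Properties as Uniqueₚ using ()
open import Data.Nat as ℕ using (ℕ; zero; suc; _+_; _*_; _^_; _∸_; _≤_; _<_; z≤n; s≤s; _<?_; _≤?_; NonZero; >-nonZero; >-nonZero⁻¹)
open import Data.Nat.Induction using (<-wellFounded)
open import Data.Nat.Properties hiding (_≟_; suc-injective)
open import Data.Nat.Tactic.RingSolver using (solve-∀)
open import Data.Product using (∃; _×_; _,_; proj₁; proj₂)
open import Data.Sum using (_⊎_; inj₁; inj₂; [_,_]′)
open import Data.Unit using (⊤; tt)
open import Data.Vec as Vec using ([]; _∷_; _[_]≔_; here; there)
open import Data.Vec.Properties using (lookup∘tabulate; []≔-updates; []≔-minimal)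
open import Function using (_∘_; id; case_of_)
open import Induction.WellFounded using (Acc; acc)
open import Relation.Binary.Construct.Closure.ReflexiveTransitive using (Star; ε; _◅_; _◅◅_; reverse; _⋆) renaming (map to mapStar)
open import Relation.Binary.PropositionalEquality using (_≡_; _≢_; refl; sym; trans; cong; cong₂; subst)
open import Relation.Nullary using (¬_; Dec; yes; no; contradiction)
open import Relation.Nullary.Decidable using (_×-dec_; _⊎-dec_; _→-dec_; ¬?; map′; isYes; toWitness; fromWitness)

open import Algebra.Properties.CommutativeMonoid.Sum +-0-commutativeMonoid using (sum; sum-cong-≗; ∑-distrib-+; ∑-comm)

-- A linkage is encoded as a colouring, not as a family of paths: colour classes are disjoint by
-- nature, so a linkage lifts through a contraction or a clique replacement step by step, and simple
-- paths are extracted only at the end. The obstacle is that each reduction can create an overly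
-- dense set behind a small boundary. Smallness is measured strictly against the current number of
-- roots, so that a smallest offending set, rooted at its own boundary, is again an instance of the
-- induction. The power t⁴ comes from the at most t⁴ ordered pairs inside X, which count for the
-- density of W but not for the edges meeting the rest; the core itself needs only density of order
-- t². In the clique count b may grow like (|S|/t)² until it reaches |S|/4. The costs in the
-- exponent for successive doublings of |S| therefore decay almost geometrically and sum to O(t),
-- and the O(log t) doublings after that cost O(log t) each. With t rounded up to a power 2^τ ≤ 2t
-- these shares are 14 · 2^τ and at most 11 · 2^τ, and 25 · 2^τ ≤ 50t.

private variable
  n : ℕ

-- Indicators, finite sums and vertex sets

ι : {A : Set} → Dec A → ℕ
ι (yes _) = 1
ι (no _)  = 0

ι-mono : {A B : Set} → (a? : Dec A) (b? : Dec B) → (A → B) → ι a? ≤ ι b?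
ι-mono (yes a) (yes b) f = ≤-refl
ι-mono (yes a) (no ¬b) f = contradiction (f a) ¬b
ι-mono (no ¬a) b?      f = z≤n

ι-yes : {A : Set} → (a? : Dec A) → A → ι a? ≡ 1
ι-yes (yes _) a = refl
ι-yes (no ¬a) a = contradiction a ¬a

ι-no : {A : Set} → (a? : Dec A) → ¬ A → ι a? ≡ 0
ι-no (yes a) ¬a = contradiction a ¬a
ι-no (no _)  ¬a = refl

ι≤1 : {A : Set} → (a? : Dec A) → ι a? ≤ 1
ι≤1 (yes _) = ≤-refl
ι≤1 (no _)  = z≤n

ι-pos : {A : Set} → (a? : Dec A) → 0 < ι a? → A
ι-pos (yes a) _ = a

ι-⊎ : {A B C : Set} → (a? : Dec A) (b? : Dec B) (c? : Dec C) → (A → B ⊎ C) → ι a? ≤ ι b? + ι c?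
ι-⊎ (no _)  b?      c?      f = z≤n
ι-⊎ (yes a) (yes b) c?      f = s≤s z≤n
ι-⊎ (yes a) (no ¬b) (yes c) f = ≤-refl
ι-⊎ (yes a) (no ¬b) (no ¬c) f = ⊥-elim ([ ¬b , ¬c ]′ (f a))

ι-disjoint : {A B C : Set} → (a? : Dec A) (b? : Dec B) (c? : Dec C) →
  (A → C) → (B → C) → (A → B → ⊥) → ι a? + ι b? ≤ ι c?
ι-disjoint (yes a) (yes b) c? f g h = ⊥-elim (h a b)
ι-disjoint (yes a) (no ¬b) c? f g h = ≤-reflexive (sym (ι-yes c? (f a)))
ι-disjoint (no ¬a) b?      c? f g h = ι-mono b? c? g

sum-mono : {f g : Fin n → ℕ} → (∀ v → f v ≤ g v) → sum f ≤ sum g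
sum-mono {zero}  h = z≤n
sum-mono {suc n} h = +-mono-≤ (h zero) (sum-mono (h ∘ suc))

sum-mono-+ : {f g h : Fin n → ℕ} → (∀ v → f v ≤ g v + h v) → sum f ≤ sum g + sum h
sum-mono-+ {g = g} {h} le = ≤-trans (sum-mono le) (≤-reflexive (∑-distrib-+ g h))

sum-+-mono : {f g h : Fin n → ℕ} → (∀ v → f v + g v ≤ h v) → sum f + sum g ≤ sum h
sum-+-mono {f = f} {g} le = ≤-trans (≤-reflexive (sym (∑-distrib-+ f g))) (sum-mono le)

sum-zero : {f : Fin n → ℕ} → (∀ v → f v ≡ 0) → sum f ≡ 0
sum-zero {zero}  h = refl
sum-zero {suc n} h = cong₂ _+_ (h zero) (sum-zero (h ∘ suc))

sum-pos : (f : Fin n → ℕ) → 0 < sum f → ∃ λ v → 0 < f v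
sum-pos {suc n} f p with f zero in eq
... | suc k = zero , subst (0 <_) (sym eq) (s≤s z≤n)
... | zero with sum-pos (f ∘ suc) p
...   | v , q = suc v , q

sum-point : (f : Fin n → ℕ) (u : Fin n) → (∀ v → v ≢ u → f v ≡ 0) → sum f ≡ f u
sum-point f zero h = trans (cong (f zero +_) (sum-zero λ v → h (suc v) λ ())) (+-identityʳ _)
sum-point f (suc u) h =
  trans (cong (_+ sum (f ∘ suc)) (h zero λ ())) (sum-point (f ∘ suc) u λ v ne → h (suc v) λ { refl → ne refl })

sum-*ˡ : ∀ k (f : Fin n → ℕ) → sum (λ v → k * f v) ≡ k * sum f
sum-*ˡ {zero}  k f = sym (*-zeroʳ k)
sum-*ˡ {suc n} k f = trans (cong (k * f zero +_) (sum-*ˡ k (f ∘ suc))) (sym (*-distribˡ-+ k (f zero) _))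

-- Membership is a type, not a Boolean, so that unions, differences etc. are eliminated by pattern matching.
record VSet (n : ℕ) : Set₁ where
  constructor mkSet
  field
    Mem  : Fin n → Set
    mem? : ∀ v → Dec (Mem v)
open VSet public

infix 4 _∈_ _∉_ _⊆_ _∈?_
_∈_ _∉_ : Fin n → VSet n → Set
v ∈ S = Mem S v
v ∉ S = ¬ (v ∈ S)

_∈?_ : (v : Fin n) (S : VSet n) → Dec (v ∈ S)
v ∈? S = mem? S v

_⊆_ : VSet n → VSet n → Set
S ⊆ S′ = ∀ v → v ∈ S → v ∈ S′

infixl 6 _∪_ _∖_ _∩_
_∪_ _∖_ _∩_ : VSet n → VSet n → VSet n
S ∪ S′ = mkSet (λ v → v ∈ S ⊎ v ∈ S′) (λ v → (v ∈? S) ⊎-dec (v ∈? S′))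
S ∖ S′ = mkSet (λ v → v ∈ S × v ∉ S′) (λ v → (v ∈? S) ×-dec ¬? (v ∈? S′))
S ∩ S′ = mkSet (λ v → v ∈ S × v ∈ S′) (λ v → (v ∈? S) ×-dec (v ∈? S′))

⁅_⁆ : Fin n → VSet n
⁅ u ⁆ = mkSet (_≡ u) (_≟ u)

full : VSet n
full = mkSet (λ _ → ⊤) (λ _ → yes tt)

fromSubset : Subset n → VSet n
fromSubset p = mkSet (λ v → T (Vec.lookup p v)) (λ v → T? (Vec.lookup p v))

# : VSet n → ℕ
# S = sum (λ v → ι (v ∈? S))

#-mono : (S S′ : VSet n) → S ⊆ S′ → # S ≤ # S′
#-mono S S′ h = sum-mono λ v → ι-mono (v ∈? S) (v ∈? S′) (h v)

#-⊎ : (S S₁ S₂ : VSet n) → (∀ v → v ∈ S → v ∈ S₁ ⊎ v ∈ S₂) → # S ≤ # S₁ + # S₂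
#-⊎ S S₁ S₂ h = sum-mono-+ λ v → ι-⊎ (v ∈? S) (v ∈? S₁) (v ∈? S₂) (h v)

#-disjoint : (S₁ S₂ S : VSet n) → S₁ ⊆ S → S₂ ⊆ S → (∀ v → v ∈ S₁ → v ∈ S₂ → ⊥) → # S₁ + # S₂ ≤ # S
#-disjoint S₁ S₂ S f g h = sum-+-mono λ v → ι-disjoint (v ∈? S₁) (v ∈? S₂) (v ∈? S) (f v) (g v) (h v)

#-point : (u : Fin n) → # ⁅ u ⁆ ≡ 1
#-point u = trans (sum-point (λ v → ι (v ≟ u)) u λ v ne → ι-no (v ≟ u) ne) (ι-yes (u ≟ u) refl)

#-strict : (S S′ : VSet n) → S ⊆ S′ → ∀ {u} → u ∈ S′ → u ∉ S → # S < # S′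
#-strict S S′ h {u} u∈ u∉ = subst (_≤ # S′) (trans (+-comm (# S) _) (cong (_+ # S) (#-point u)))
  (#-disjoint S ⁅ u ⁆ S′ h (λ { v refl → u∈ }) (λ { v v∈ refl → u∉ v∈ }))

#-remove : (S : VSet n) → ∀ {u} → u ∈ S → suc (# (S ∖ ⁅ u ⁆)) ≡ # S
#-remove S {u} u∈ = ≤-antisym
  (#-strict (S ∖ ⁅ u ⁆) S (λ _ → proj₁) u∈ (λ p → proj₂ p refl))
  (subst (# S ≤_) (trans (+-comm (# (S ∖ ⁅ u ⁆)) _) (cong (_+ # (S ∖ ⁅ u ⁆)) (#-point u)))
    (#-⊎ S (S ∖ ⁅ u ⁆) ⁅ u ⁆ λ v v∈ → case v ≟ u of λ where
      (yes eq) → inj₂ eq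
      (no ne)  → inj₁ (v∈ , ne)))

#-split : (S S′ : VSet n) → S′ ⊆ S → # S ≡ # S′ + # (S ∖ S′)
#-split S S′ h = ≤-antisym
  (#-⊎ S S′ (S ∖ S′) λ v v∈ → case v ∈? S′ of λ where
    (yes p) → inj₁ p
    (no ¬p) → inj₂ (v∈ , ¬p))
  (#-disjoint S′ (S ∖ S′) S h (λ _ → proj₁) (λ v p q → proj₂ q p))

#-nonempty : (S : VSet n) → 0 < # S → ∃ λ v → v ∈ S
#-nonempty S p with sum-pos (λ v → ι (v ∈? S)) p
... | v , q = v , ι-pos (v ∈? S) q

#-diff : (S S′ : VSet n) → # S′ < # S → ∃ λ v → v ∈ S × v ∉ S′
#-diff S S′ lt = #-nonempty (S ∖ S′)
  (+-cancelˡ-< (# S′) 0 _ (≤-trans (≤-trans (s≤s (≤-reflexive (+-identityʳ _))) lt)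
    (#-⊎ S S′ (S ∖ S′) λ v v∈ → case v ∈? S′ of λ where
      (yes p) → inj₁ p
      (no ¬p) → inj₂ (v∈ , ¬p))))

#-full : # (full {n}) ≡ n
#-full {zero}  = refl
#-full {suc n} = cong suc (#-full {n})

_∈ₗ?_ : (v : Fin n) (vs : List (Fin n)) → Dec (v ∈ₗ vs)
v ∈ₗ? vs = Any.any? (v ≟_) vs

listSet : List (Fin n) → VSet n
listSet vs = mkSet (_∈ₗ vs) (_∈ₗ? vs)

#-listSet : (vs : List (Fin n)) → # (listSet vs) ≤ length vs
#-listSet {n} [] = ≤-reflexive (sum-zero {n} λ v → ι-no (v ∈ₗ? []) λ ())
#-listSet (v ∷ vs) = ≤-trans
  (#-⊎ (listSet (v ∷ vs)) ⁅ v ⁆ (listSet vs) λ { w (here p) → inj₁ p ; w (there p) → inj₂ p })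
  (+-mono-≤ (≤-reflexive (#-point v)) (#-listSet vs))

-- Sets with the same members may differ as terms, so a search over Boolean vectors decides only
-- properties that depend on the members alone.
Extensional : ∀ {ℓ} → (VSet n → Set ℓ) → Set _
Extensional P = ∀ S S′ → S ⊆ S′ → S′ ⊆ S → P S → P S′

canon : (S : VSet n) → Subset n
canon S = Vec.tabulate λ v → isYes (v ∈? S)

canon-⊆ : (S : VSet n) → fromSubset (canon S) ⊆ S
canon-⊆ S v p = toWitness {a? = v ∈? S} (subst T (lookup∘tabulate (λ v → isYes (v ∈? S)) v) p)

⊆-canon : (S : VSet n) → S ⊆ fromSubset (canon S)
⊆-canon S v p = subst T (sym (lookup∘tabulate (λ v → isYes (v ∈? S)) v)) (fromWitness {a? = v ∈? S} p)

anySet? : ∀ {ℓ} (P : VSet n → Set ℓ) → (∀ S → Dec (P S)) → Extensional P → Dec (∃ P)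
anySet? P P? ext = map′
  (λ (p , q) → fromSubset p , q)
  (λ (S , q) → canon S , ext S _ (⊆-canon S) (canon-⊆ S) q)
  (anySubset? (λ p → P? (fromSubset p)))

minimalSet : (P : VSet n → Set) → (∀ S → Dec (P S)) → Extensional P →
  ∀ S → P S → ∃ λ S₀ → P S₀ × (∀ S′ → # S′ < # S₀ → ¬ P S′)
minimalSet {n} P P? ext S = go S (<-wellFounded _)
  where
  go : ∀ S → Acc _<_ (# S) → P S → ∃ λ S₀ → P S₀ × (∀ S′ → # S′ < # S₀ → ¬ P S′)
  go S (acc rs) p with anySet? (λ S′ → # S′ < # S × P S′) (λ S′ → (# S′ <? # S) ×-dec P? S′)
    (λ S₁ S₂ f g (lt , q) → ≤-<-trans (#-mono S₂ S₁ g) lt , ext S₁ S₂ f g q)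
  ... | yes (S′ , lt , q) = go S′ (rs lt) q
  ... | no none = S , p , λ S′ lt q → none (S′ , lt , q)

-- Reachability and Menger's theorem

module _ {n : ℕ} where
  private
    V = Fin n

  firstHit : ∀ {R : V → V → Set} (Q : VSet n) {x y} → Star R x y → y ∈ Q →
    ∃ λ q → q ∈ Q × Star (λ a b → R a b × a ∉ Q) x q
  firstHit Q {x} s y∈ with x ∈? Q
  ... | yes x∈ = x , x∈ , ε
  firstHit Q ε y∈ | no x∉ = contradiction y∈ x∉
  firstHit Q (r ◅ s) y∈ | no x∉ with firstHit Q s y∈
  ... | q , q∈ , s′ = q , q∈ , (r , x∉) ◅ s′

  -- Either no step enters `z`, or the part after the last visit to `z` is kept. For `x` equal to
  -- `z` both outcomes have the same type, which gives `noReturn`.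
  dropReturns : ∀ {R : V → V → Set} z {x y} → Star R x y →
    Star (λ a b → R a b × b ≢ z) x y ⊎ Star (λ a b → R a b × b ≢ z) z y
  dropReturns z ε = inj₁ ε
  dropReturns z (_◅_ {j = x′} r s) with dropReturns z s
  ... | inj₂ t = inj₂ t
  ... | inj₁ t with x′ ≟ z
  ...   | yes refl = inj₂ t
  ...   | no ne = inj₁ ((r , ne) ◅ t)

  noReturn : ∀ {R : V → V → Set} {z y} → Star R z y → Star (λ a b → R a b × b ≢ z) z y
  noReturn {z = z} s = [ id , id ]′ (dropReturns z s)

  -- Edges are listed so that the induction behind Menger's theorem can delete the head and
  -- reachability can be decided by recursion on the list.
  Edge : List (V × V) → V → V → Set
  Edge [] x y = ⊥
  Edge ((u , v) ∷ es) x y = (x ≡ u × y ≡ v) ⊎ (x ≡ v × y ≡ u) ⊎ Edge es x y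

  Edge-sym : ∀ es {x y} → Edge es x y → Edge es y x
  Edge-sym (e ∷ es) (inj₁ (p , q)) = inj₂ (inj₁ (q , p))
  Edge-sym (e ∷ es) (inj₂ (inj₁ (p , q))) = inj₁ (q , p)
  Edge-sym (e ∷ es) (inj₂ (inj₂ r)) = inj₂ (inj₂ (Edge-sym es r))

  Avoid : List (V × V) → VSet n → V → V → Set
  Avoid es Z x y = Edge es x y × x ∉ Z × y ∉ Z

  Avoid-sym : ∀ es Z {x y} → Avoid es Z x y → Avoid es Z y x
  Avoid-sym es Z (e , p , q) = Edge-sym es e , q , p

  walk-end : ∀ es Z {x y} → x ∉ Z → Star (Avoid es Z) x y → y ∉ Z
  walk-end es Z x∉ ε = x∉
  walk-end es Z x∉ ((_ , _ , q) ◅ s) = walk-end es Z q s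

  -- Shortcutting leaves at most one passage through the new edge, in one of its two directions.
  walk-cons : ∀ {u v} es Z {x y} → Star (Avoid ((u , v) ∷ es) Z) x y →
    Star (Avoid es Z) x y
    ⊎ (u ∉ Z × v ∉ Z × (Star (Avoid es Z) x u × Star (Avoid es Z) v y ⊎ Star (Avoid es Z) x v × Star (Avoid es Z) u y))
  walk-cons es Z ε = inj₁ ε
  walk-cons es Z ((inj₂ (inj₂ e) , p , q) ◅ s) with walk-cons es Z s
  ... | inj₁ t = inj₁ ((e , p , q) ◅ t)
  ... | inj₂ (a , b , inj₁ (t , t′)) = inj₂ (a , b , inj₁ ((e , p , q) ◅ t , t′))
  ... | inj₂ (a , b , inj₂ (t , t′)) = inj₂ (a , b , inj₂ ((e , p , q) ◅ t , t′))
  walk-cons es Z ((inj₁ (refl , refl) , p , q) ◅ s) with walk-cons es Z s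
  ... | inj₁ t = inj₂ (p , q , inj₁ (ε , t))
  ... | inj₂ (a , b , inj₁ (t , t′)) = inj₂ (p , q , inj₁ (ε , t′))
  ... | inj₂ (a , b , inj₂ (t , t′)) = inj₁ t′
  walk-cons es Z ((inj₂ (inj₁ (refl , refl)) , p , q) ◅ s) with walk-cons es Z s
  ... | inj₁ t = inj₂ (q , p , inj₂ (ε , t))
  ... | inj₂ (a , b , inj₁ (t , t′)) = inj₁ t′
  ... | inj₂ (a , b , inj₂ (t , t′)) = inj₂ (a , b , inj₂ (ε , t′))

  walk-weaken : ∀ {e} es Z {x y} → Star (Avoid es Z) x y → Star (Avoid (e ∷ es) Z) x y
  walk-weaken es Z = mapStar λ (e , p) → inj₂ (inj₂ e) , p

  walk? : ∀ es Z x y → Dec (Star (Avoid es Z) x y)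
  walk? [] Z x y = map′ (λ { refl → ε }) (λ { ε → refl }) (x ≟ y)
  walk? ((u , v) ∷ es) Z x y = map′ to (walk-cons es Z)
    (walk? es Z x y ⊎-dec (¬? (u ∈? Z) ×-dec ¬? (v ∈? Z) ×-dec
      ((walk? es Z x u ×-dec walk? es Z v y) ⊎-dec (walk? es Z x v ×-dec walk? es Z u y))))
    where
    to : _ → Star (Avoid ((u , v) ∷ es) Z) x y
    to (inj₁ s) = walk-weaken es Z s
    to (inj₂ (a , b , inj₁ (s , t))) = walk-weaken es Z s ◅◅ (inj₁ (refl , refl) , a , b) ◅ walk-weaken es Z t
    to (inj₂ (a , b , inj₂ (s , t))) = walk-weaken es Z s ◅◅ (inj₂ (inj₁ (refl , refl)) , b , a) ◅ walk-weaken es Z t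

  Reach : List (V × V) → VSet n → VSet n → VSet n
  Reach es Z X = mkSet (λ w → ∃ λ x → x ∈ X × x ∉ Z × Star (Avoid es Z) x w)
                       (λ w → any? λ x → (x ∈? X) ×-dec ¬? (x ∈? Z) ×-dec walk? es Z x w)

  Reach-∉ : ∀ es Z X {w} → w ∈ Reach es Z X → w ∉ Z
  Reach-∉ es Z X (x , _ , x∉ , s) = walk-end es Z x∉ s

  Reach-step : ∀ es Z X {w w′} → w ∈ Reach es Z X → Edge es w w′ → w′ ∉ Z → w′ ∈ Reach es Z X
  Reach-step es Z X r@(x , x∈ , x∉ , s) e w′∉ = x , x∈ , x∉ , s ◅◅ (e , Reach-∉ es Z X r , w′∉) ◅ ε

  Separates : List (V × V) → VSet n → VSet n → VSet n → Set
  Separates es Z X T = ∀ t → t ∈ T → t ∉ Reach es Z X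

  Separates-sym : ∀ es Z X T → Separates es Z X T → Separates es Z T X
  Separates-sym es Z X T sep x x∈ (t , t∈ , t∉ , s) =
    sep t t∈ (x , x∈ , walk-end es Z t∉ s , reverse (Avoid-sym es Z) s)

  -- The vertices labelled t carry a walk from t to X; distinct labels make these walks disjoint.
  Class : List (V × V) → (V → V) → V → V → V → Set
  Class es m l x y = Edge es x y × m x ≡ l × m y ≡ l

  Saturated : List (V × V) → VSet n → VSet n → (V → V) → Set
  Saturated es X T m = ∀ t → t ∈ T → m t ≡ t × ∃ λ x → x ∈ X × Star (Class es m t) t x

  -- Follow a walk from `X` that avoids `Z`. Without the new edge it reaches neither `u` nor `S`,
  -- because `Z` cuts them off, and it reaches `v` only by crossing `S`. So it never uses the new
  -- edge, never meets `S`, and does not arrive in `T`.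
  separates-add : ∀ big es S X T Z {u v} →
    (∀ {x y} → Edge big x y → Edge es x y ⊎ (x ≡ u × y ≡ v) ⊎ (x ≡ v × y ≡ u)) →
    Separates es S X T → v ∉ Reach es S X → Separates es Z X (S ∪ ⁅ u ⁆) → Separates big Z X T
  separates-add big es S X T Z {u} {v} split sep v∉ sepZ t t∈ (x , x∈ , x∉ , s) = go start start′ s
    where
    start : x ∈ Reach es Z X
    start = x , x∈ , x∉ , ε
    start′ : x ∈ Reach es S X
    start′ = x , x∈ , (λ x∈S → sepZ x (inj₁ x∈S) start) , ε
    go : ∀ {w} → w ∈ Reach es Z X → w ∈ Reach es S X → Star (Avoid big Z) w t → ⊥
    go r r′ ε = sep t t∈ r′
    go {w} r r′ (_◅_ {j = w′} (e , _ , w′∉) s) with split e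
    ... | inj₂ (inj₁ (refl , refl)) = sepZ w (inj₂ refl) r
    ... | inj₂ (inj₂ (refl , refl)) = v∉ r′
    ... | inj₁ e′ = go r₁ (Reach-step es S X r′ e′ (λ w′∈S → sepZ w′ (inj₁ w′∈S) r₁)) s
      where
      r₁ : w′ ∈ Reach es Z X
      r₁ = Reach-step es Z X r e′ w′∉

  -- On the side of `X` the label `m₁` names the vertex of `S ∪ ⁅ u ⁆` whose walk is being followed;
  -- `ren` lets the walk from `u` continue the one that arrives at `v`, and `m₂` turns the result
  -- into the target in `T`.
  module Glue (es : List (V × V)) (S X T : VSet n) {u v : V}
    (sep : Separates es S X T) (u∈ : u ∈ Reach es S X) (v∉ : v ∉ Reach es S X)
    (m₁ m₂ : V → V) (sat₁ : Saturated es X (S ∪ ⁅ u ⁆) m₁) (sat₂ : Saturated es (S ∪ ⁅ v ⁆) T m₂)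
    (big : List (V × V)) (sub : ∀ {x y} → Edge es x y → Edge big x y) (vu : Edge big v u) where

    ren : V → V
    ren a with a ≟ u
    ... | yes _ = v
    ... | no _  = a

    ren-u : ren u ≡ v
    ren-u with u ≟ u
    ... | yes _ = refl
    ... | no ne = contradiction refl ne

    ren-S : ∀ {s} → s ∈ S → ren s ≡ s
    ren-S {s} s∈ with s ≟ u
    ... | yes refl = contradiction s∈ (Reach-∉ es S X u∈)
    ... | no _ = refl

    m : V → V
    m w with w ∈? Reach es S X
    ... | yes _ = m₂ (ren (m₁ w))
    ... | no _  = m₂ w

    m-in : ∀ {w} → w ∈ Reach es S X → m w ≡ m₂ (ren (m₁ w))
    m-in {w} w∈ with w ∈? Reach es S X
    ... | yes _ = refl
    ... | no w∉ = contradiction w∈ w∉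

    m-out : ∀ {w} → w ∉ Reach es S X → m w ≡ m₂ w
    m-out {w} w∉ with w ∈? Reach es S X
    ... | yes w∈ = contradiction w∈ w∉
    ... | no _ = refl

    tail : ∀ {l t x w} → m₂ (ren l) ≡ t → x ∈ X → w ∉ S → m₁ w ≡ l →
      Star (λ a b → Class es m₁ l a b × b ∉ S) w x → w ∈ Reach es S X × m w ≡ t × Star (Class big m t) w x
    tail {w = w} lt x∈ w∉ ml ε = r , trans (m-in r) (trans (cong (m₂ ∘ ren) ml) lt) , ε
      where
      r : w ∈ Reach es S X
      r = w , x∈ , w∉ , ε
    tail {w = w} lt x∈ w∉ ml (((e , _ , ml′) , w′∉) ◅ s) with tail lt x∈ w′∉ ml′ s
    ... | r′ , mt′ , s′ = r , mt , (sub e , mt , mt′) ◅ s′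
      where
      r : w ∈ Reach es S X
      r = Reach-step es S X r′ (Edge-sym es e) w∉
      mt = trans (m-in r) (trans (cong (m₂ ∘ ren) ml) lt)

    front : ∀ {t q w} → w ∉ Reach es S X → m₂ w ≡ t →
      Star (λ a b → Class es m₂ t a b × a ∉ (S ∪ ⁅ v ⁆)) w q →
      m₂ q ≡ t × q ∉ Reach es S X × Star (Class big m t) w q
    front w∉ mt ε = mt , w∉ , ε
    front {w = w} w∉ mt (_◅_ {j = w′} ((e , _ , mt′) , a∉) s) with front w′∉ mt′ s
      where
      w′∉ : w′ ∉ Reach es S X
      w′∉ r = w∉ (Reach-step es S X r (Edge-sym es e) (a∉ ∘ inj₁))
    ... | a , b , s′ = a , b , (sub e , trans (m-out w∉) mt , trans (m-out w′∉) mt′) ◅ s′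
      where
      w′∉ : w′ ∉ Reach es S X
      w′∉ r = w∉ (Reach-step es S X r (Edge-sym es e) (a∉ ∘ inj₁))

    saturated : Saturated big X T m
    saturated t t∈ with sat₂ t t∈
    ... | m₂t , s , s∈ , star with firstHit (S ∪ ⁅ v ⁆) star s∈
    ... | q , q∈ , star′ with front (sep t t∈) m₂t star′
    ... | m₂q , q∉ , star₁ = trans (m-out (sep t t∈)) m₂t , finish q∈
      where
      finish : q ∈ S ∪ ⁅ v ⁆ → ∃ λ x → x ∈ X × Star (Class big m t) t x
      finish (inj₂ refl) with sat₁ u (inj₂ refl)
      -- A vertex of `S` on this walk would be labelled by itself, but the label is `u`, which is
      -- not in `S`.
      ... | m₁u , x , x∈ , s₁ with tail (trans (cong m₂ ren-u) m₂q) x∈ (Reach-∉ es S X u∈) m₁u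
                (mapStar (λ c → c , λ b∈ → Reach-∉ es S X u∈ (subst (_∈ S)
                   (trans (sym (proj₁ (sat₁ _ (inj₁ b∈)))) (proj₂ (proj₂ c))) b∈)) s₁)
      ... | _ , mu , s₂ = x , x∈ , star₁ ◅◅ (vu , trans (m-out q∉) m₂q , mu) ◅ s₂
      finish (inj₁ q∈S) with sat₁ q (inj₁ q∈S)
      -- Here `q` itself lies in `S`, so the walk is taken from its last visit to `q`; what follows
      -- is labelled `q` and therefore avoids `S`.
      ... | m₁q , x , x∈ , s₁ with noReturn s₁
      ... | ε = x , x∈ , star₁
      ... | ((e , a , b) , ne) ◅ s₂ with tail (trans (cong m₂ (ren-S q∈S)) m₂q) x∈
                (λ b∈ → ne (trans (sym (proj₁ (sat₁ _ (inj₁ b∈)))) b)) b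
                (mapStar (λ (c , ne′) → c , λ b∈ → ne′ (trans (sym (proj₁ (sat₁ _ (inj₁ b∈)))) (proj₂ (proj₂ c)))) s₂)
      ... | _ , mu , s₃ = x , x∈ , star₁ ◅◅ (sub e , trans (m-out q∉) m₂q , mu) ◅ s₃

  -- Göring's proof of Menger's theorem: if deleting the edge uv creates a small separator S, then
  -- S ∪ {u} is saturated from X and T is saturated from S ∪ {v}, and the two systems meet only in S.
  saturate : ∀ es X T → (∃ λ Z → # Z < # T × Separates es Z X T) ⊎ (∃ λ m → Saturated es X T m)
  saturate [] X T with any? (λ t → (t ∈? T) ×-dec ¬? (t ∈? X))
  ... | yes (t , t∈ , t∉) = inj₁ (T ∩ X , #-strict (T ∩ X) T (λ _ → proj₁) t∈ (t∉ ∘ proj₂) ,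
          λ { x x∈T (.x , x∈X , x∉ , ε) → x∉ (x∈T , x∈X) })
  ... | no none = inj₂ (id , λ t t∈ → refl , t , t∈X t t∈ , ε)
    where
    t∈X : ∀ t → t ∈ T → t ∈ X
    t∈X t t∈ with t ∈? X
    ... | yes p = p
    ... | no ¬p = contradiction (t , t∈ , ¬p) none
  saturate ((u , v) ∷ es) X T with saturate es X T
  ... | inj₂ (m , sat) = inj₂ (m , λ t t∈ → let a , x , x∈ , s = sat t t∈ in
          a , x , x∈ , mapStar (λ (e , p) → inj₂ (inj₂ e) , p) s)
  ... | inj₁ (S , S<T , sep) = cases
    where
    big = (u , v) ∷ es
    Result = (∃ λ Z → # Z < # T × Separates big Z X T) ⊎ (∃ λ m → Saturated big X T m)
    main : ∀ u′ v′ → u′ ∈ Reach es S X → v′ ∈ Reach es S T →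
      (∀ {x y} → Edge big x y → Edge es x y ⊎ (x ≡ u′ × y ≡ v′) ⊎ (x ≡ v′ × y ≡ u′)) → Edge big v′ u′ → Result
    main u′ v′ u∈ v∈ split vu
      with v∉ ← (λ (r : v′ ∈ Reach es S X) → let (t , t∈ , t∉ , s) = v∈ ; (x , x∈ , x∉ , s′) = r in
                   sep t t∈ (x , x∈ , x∉ , s′ ◅◅ reverse (Avoid-sym es S) s))
         | u∉ ← (λ (r : u′ ∈ Reach es S T) → let (t , t∈ , t∉ , s) = r ; (x , x∈ , x∉ , s′) = u∈ in
                   sep t t∈ (x , x∈ , x∉ , s′ ◅◅ reverse (Avoid-sym es S) s))
      with saturate es X (S ∪ ⁅ u′ ⁆)
    ... | inj₁ (Z , lt , sepZ) = inj₁ (Z , <-≤-trans lt (≤-trans (#-⊎ (S ∪ ⁅ u′ ⁆) S ⁅ u′ ⁆ (λ _ → id))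
              (≤-trans (≤-reflexive (trans (cong (# S +_) (#-point u′)) (+-comm (# S) 1))) S<T)) ,
              separates-add big es S X T Z split sep v∉ sepZ)
    ... | inj₂ (m₁ , sat₁) with saturate es (S ∪ ⁅ v′ ⁆) T
    ... | inj₁ (Z , lt , sepZ) = inj₁ (Z , lt , Separates-sym big Z T X
              (separates-add big es S T X Z (λ e → [ inj₁ , (λ { (inj₁ p) → inj₂ (inj₂ p) ; (inj₂ p) → inj₂ (inj₁ p) }) ]′ (split e))
                (Separates-sym es S X T sep) u∉ (Separates-sym es Z (S ∪ ⁅ v′ ⁆) T sepZ)))
    ... | inj₂ (m₂ , sat₂) = inj₂ (Glue.m es S X T sep u∈ v∉ m₁ m₂ sat₁ sat₂ big (inj₂ ∘ inj₂) vu ,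
                                   Glue.saturated es S X T sep u∈ v∉ m₁ m₂ sat₁ sat₂ big (inj₂ ∘ inj₂) vu)
    cases : Result
    cases with (u ∈? Reach es S X) ×-dec (v ∈? Reach es S T) | (v ∈? Reach es S X) ×-dec (u ∈? Reach es S T)
    ... | yes (u∈ , v∈) | _ = main u v u∈ v∈
          (λ { (inj₁ p) → inj₂ (inj₁ p) ; (inj₂ (inj₁ p)) → inj₂ (inj₂ p) ; (inj₂ (inj₂ e)) → inj₁ e }) (inj₂ (inj₁ (refl , refl)))
    ... | no _ | yes (v∈ , u∈) = main v u v∈ u∈
          (λ { (inj₁ p) → inj₂ (inj₂ p) ; (inj₂ (inj₁ p)) → inj₂ (inj₁ p) ; (inj₂ (inj₂ e)) → inj₁ e }) (inj₁ (refl , refl))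
    -- The new edge does not join the two sides in either direction, so `S` still separates.
    ... | no ¬p | no ¬q = inj₁ (S , S<T , λ t t∈ (x , x∈ , x∉ , s) → case walk-cons es S s of λ where
          (inj₁ s′) → sep t t∈ (x , x∈ , x∉ , s′)
          (inj₂ (_ , v∉ , inj₁ (s₁ , s₂))) → ¬p ((x , x∈ , x∉ , s₁) , (t , t∈ , walk-end es S v∉ s₂ , reverse (Avoid-sym es S) s₂))
          (inj₂ (u∉ , _ , inj₂ (s₁ , s₂))) → ¬q ((x , x∈ , x∉ , s₁) , (t , t∈ , walk-end es S u∉ s₂ , reverse (Avoid-sym es S) s₂)))

  -- As long as a smaller separator exists it replaces the current target; the sizes decrease until
  -- `Y` saturates the target, and transitivity of separation leads back to `X`. The outcome `Z ≡ X`
  -- is the successful one; any other leaves a strictly smaller separator.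
  menger : ∀ es Y X → ∃ λ Z → (Z ≡ X ⊎ # Z < # X) × Separates es Z Y X × ∃ λ m → Saturated es Y Z m
  menger es Y X = go X (<-wellFounded _)
    where
    go : ∀ X → Acc _<_ (# X) → ∃ λ Z → (Z ≡ X ⊎ # Z < # X) × Separates es Z Y X × ∃ λ m → Saturated es Y Z m
    go X (acc rs) with saturate es Y X
    ... | inj₂ (m , sat) = X , inj₁ refl , (λ x x∈ r → Reach-∉ es X Y r x∈) , m , sat
    ... | inj₁ (Z , lt , sep) with go Z (rs lt)
    ... | Z′ , le , sep′ , sat = Z′ , inj₂ ([ (λ { refl → lt }) , (λ l → <-trans l lt) ]′ le) , sepX , sat
      where
      sepX : Separates es Z′ Y X
      sepX x x∈ (y , y∈ , y∉ , s) = walk start start′ s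
        where
        start : y ∈ Reach es Z′ Y
        start = y , y∈ , y∉ , ε
        start′ : y ∈ Reach es Z Y
        start′ = y , y∈ , (λ y∈Z → sep′ y y∈Z start) , ε
        walk : ∀ {w} → w ∈ Reach es Z′ Y → w ∈ Reach es Z Y → Star (Avoid es Z′) w x → ⊥
        walk r r′ ε = sep x x∈ r′
        walk r r′ (_◅_ {j = w′} (e , _ , w′∉) s) = walk r₁ (Reach-step es Z Y r′ e (λ w′∈ → sep′ w′ w′∈ r₁)) s
          where
          r₁ : w′ ∈ Reach es Z′ Y
          r₁ = Reach-step es Z′ Y r e w′∉

-- Linkages and their extension along disjoint walks

record Net (n : ℕ) : Set₁ where
  field
    E     : Fin n → Fin n → Set
    E?    : ∀ x y → Dec (E x y)
    E-sym : ∀ {x y} → E x y → E y x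
    E-irr : ∀ {x} → ¬ E x x
open Net public

module _ {n : ℕ} where
  private
    V = Fin n

  length-filter-tabulate : ∀ {k} {P : V → Set} (P? : ∀ v → Dec (P v)) (f : Fin k → V) →
    length (filter P? (tabulate f)) ≡ sum (λ i → ι (P? (f i)))
  length-filter-tabulate {zero} P? f = refl
  length-filter-tabulate {suc k} P? f with P? (f zero)
  ... | yes _ = cong suc (length-filter-tabulate P? (f ∘ suc))
  ... | no _  = length-filter-tabulate P? (f ∘ suc)

  elements : VSet n → List V
  elements S = filter (_∈? S) (allFin n)

  length-elements : ∀ S → length (elements S) ≡ # S
  length-elements S = length-filter-tabulate (_∈? S) id

  ∈-elements⁺ : ∀ S {v} → v ∈ S → v ∈ₗ elements S
  ∈-elements⁺ S v∈ = ∈-filter⁺ (_∈? S) (∈-allFin _) v∈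

  ∈-elements⁻ : ∀ S {v} → v ∈ₗ elements S → v ∈ S
  ∈-elements⁻ S p = proj₂ (∈-filter⁻ (_∈? S) {xs = allFin n} p)

  Edge⁺ : ∀ (es : List (V × V)) {x y} → (x , y) ∈ₗ es → Edge es x y
  Edge⁺ (e ∷ es) (here refl) = inj₁ (refl , refl)
  Edge⁺ (e ∷ es) (there p) = inj₂ (inj₂ (Edge⁺ es p))

  Edge⁻ : ∀ (es : List (V × V)) {x y} → Edge es x y → (x , y) ∈ₗ es ⊎ (y , x) ∈ₗ es
  Edge⁻ (e ∷ es) (inj₁ (refl , refl)) = inj₁ (here refl)
  Edge⁻ (e ∷ es) (inj₂ (inj₁ (refl , refl))) = inj₂ (here refl)
  Edge⁻ (e ∷ es) (inj₂ (inj₂ p)) = [ inj₁ ∘ there , inj₂ ∘ there ]′ (Edge⁻ es p)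

  Inside : Net n → VSet n → V × V → Set
  Inside a B (x , y) = E a x y × x ∈ B × y ∈ B

  inside? : ∀ a B (e : V × V) → Dec (Inside a B e)
  inside? a B (x , y) = E? a x y ×-dec (x ∈? B) ×-dec (y ∈? B)

  edgesIn : Net n → VSet n → List (V × V)
  edgesIn a B = filter (inside? a B) (cartesianProduct (allFin n) (allFin n))

  edgesIn⁺ : ∀ a B {x y} → E a x y → x ∈ B → y ∈ B → Edge (edgesIn a B) x y
  edgesIn⁺ a B {x} {y} e x∈ y∈ = Edge⁺ _ (∈-filter⁺ (inside? a B)
    (∈-cartesianProduct⁺ (∈-allFin x) (∈-allFin y)) (e , x∈ , y∈))

  edgesIn⁻ : ∀ a B {x y} → Edge (edgesIn a B) x y → E a x y × x ∈ B × y ∈ B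
  edgesIn⁻ a B e = [ (λ p → member p) , (λ p → let e′ , x∈ , y∈ = member p in E-sym a e′ , y∈ , x∈) ]′ (Edge⁻ (edgesIn a B) e)
    where
    member : ∀ {f} → f ∈ₗ edgesIn a B → Inside a B f
    member p = proj₂ (∈-filter⁻ (inside? a B) {xs = cartesianProduct (allFin n) (allFin n)} p)

  Step : Net n → VSet n → (V → ℕ) → V → V → Set
  Step a R c x y = E a x y × x ∈ R × y ∈ R × c x ≡ c y

  Step-sym : ∀ a R c {x y} → Step a R c x y → Step a R c y x
  Step-sym a R c (e , p , q , eq) = E-sym a e , q , p , sym eq

  -- Every partition of the roots X, given as the colour classes of c₀, extends to disjoint connected
  -- subgraphs of D ∪ X.  Unused vertices may carry any colour.
  Linked : Net n → VSet n → VSet n → Set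
  Linked a D X = ∀ (c₀ : V → ℕ) → ∃ λ c → (∀ x → x ∈ X → c x ≡ c₀ x) ×
    (∀ x y → x ∈ X → y ∈ X → c₀ x ≡ c₀ y → Star (Step a (D ∪ X) c) x y)

  Linked-mono : ∀ a D D′ X → D ⊆ D′ → Linked a D X → Linked a D′ X
  Linked-mono a D D′ X sub L c₀ with L c₀
  ... | c , agree , conn = c , agree , λ x y x∈ y∈ eq →
    mapStar (λ (e , p , q , r) → e , [ inj₁ ∘ sub _ , inj₂ ]′ p , [ inj₁ ∘ sub _ , inj₂ ]′ q , r) (conn x y x∈ y∈ eq)

  Closed : Net n → VSet n → VSet n → Set
  Closed a D X = ∀ d w → d ∈ D → E a d w → w ∈ D ∪ X

  -- The roots are an arbitrary short list from `Y` because they will be the entry points of walks,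
  -- which are known only after Menger's theorem has been applied.
  Linkable : Net n → VSet n → VSet n → ℕ → Set
  Linkable a R Y p = ∀ ys → length ys ≤ p → (∀ y → y ∈ₗ ys → y ∈ Y) → ∀ (c₀ : V → ℕ) →
    ∃ λ c → (∀ y → y ∈ₗ ys → c y ≡ c₀ y) ×
      (∀ y y′ → y ∈ₗ ys → y′ ∈ₗ ys → c₀ y ≡ c₀ y′ → Star (Step a R c) y y′)

  Linked⇒Linkable : ∀ a D X p → Linked a D X → Linkable a (D ∪ X) X p
  Linked⇒Linkable a D X p L ys _ ys⊆ c₀ with L c₀
  ... | c , agree , conn = c , (λ y y∈ → agree y (ys⊆ y y∈)) ,
    λ y y′ y∈ y′∈ → conn y y′ (ys⊆ y y∈) (ys⊆ y′ y′∈)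

  -- D₀ can be cut off from the roots X by the smaller set Z, without restricting what can be linked.
  record Rigid (a : Net n) (D X D₀ Z : VSet n) : Set where
    field
      D₀⊆D    : D₀ ⊆ D
      Z⊆      : Z ⊆ D ∪ X
      disj    : ∀ v → v ∈ D₀ → v ∉ Z
      closed  : Closed a D₀ Z
      small   : # Z < # X
      linked  : Linked a D₀ Z

  -- Each root `z` follows its labelled walk to an entry point `h z` of `R`, which inherits the
  -- colour of `z`. Outside `R` a vertex has the colour of the root that labels it, inside `R` the
  -- colour supplied by `lk`.
  module Assemble (a : Net n) (R Y Q Z : VSet n) (p : ℕ) (lk : Linkable a R Y p) (#Z≤p : # Z ≤ p)
    (Y⊆R : Y ⊆ R) (R⊆Q : R ⊆ Q) (m h : V → V) (m-root : ∀ z → z ∈ Z → m z ≡ z) (h∈Y : ∀ z → z ∈ Z → h z ∈ Y)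
    (walk : ∀ z → z ∈ Z → Star (λ x y → E a x y × x ∈ Q × y ∈ Q × m x ≡ z × m y ≡ z × x ∉ R) z (h z))
    (c₀ : V → ℕ) where

    roots : List V
    roots = map h (elements Z)

    inner = lk roots (subst (_≤ p) (sym (trans (length-map h (elements Z)) (length-elements Z))) #Z≤p)
      (λ y y∈ → let z , z∈ , eq = ∈-map⁻ h y∈ in subst (_∈ Y) (sym eq) (h∈Y z (∈-elements⁻ Z z∈))) (c₀ ∘ m)

    cR = proj₁ inner

    root∈ : ∀ {z} → z ∈ Z → h z ∈ₗ roots
    root∈ z∈ = ∈-map⁺ h (∈-elements⁺ Z z∈)

    c : V → ℕ
    c v with v ∈? R
    ... | yes _ = cR v
    ... | no _  = c₀ (m v)

    c-in : ∀ {v} → v ∈ R → c v ≡ cR v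
    c-in {v} v∈ with v ∈? R
    ... | yes _ = refl
    ... | no v∉ = contradiction v∈ v∉

    c-out : ∀ {v} → v ∉ R → c v ≡ c₀ (m v)
    c-out {v} v∉ with v ∈? R
    ... | yes v∈ = contradiction v∈ v∉
    ... | no _ = refl

    m-end : ∀ {z w q} → m w ≡ z → Star (λ x y → E a x y × x ∈ Q × y ∈ Q × m x ≡ z × m y ≡ z × x ∉ R) w q → m q ≡ z
    m-end mw ε = mw
    m-end mw ((_ , _ , _ , _ , mw′ , _) ◅ s) = m-end mw′ s

    m-h : ∀ z → z ∈ Z → m (h z) ≡ z
    m-h z z∈ = m-end (m-root z z∈) (walk z z∈)

    along : ∀ z → z ∈ Z → ∀ {w} → m w ≡ z →
      Star (λ x y → E a x y × x ∈ Q × y ∈ Q × m x ≡ z × m y ≡ z × x ∉ R) w (h z) →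
      c w ≡ c₀ z × Star (Step a Q c) w (h z)
    along z z∈ mw ε = trans (c-in (Y⊆R _ (h∈Y z z∈))) (trans (proj₁ (proj₂ inner) (h z) (root∈ z∈)) (cong c₀ mw)) , ε
    along z z∈ mw ((e , x∈ , y∈ , _ , mw′ , x∉) ◅ s) with along z z∈ mw′ s
    ... | cw′ , s′ = cw , (e , x∈ , y∈ , trans cw (sym cw′)) ◅ s′
      where cw = trans (c-out x∉) (cong c₀ mw)

    agree : ∀ z → z ∈ Z → c z ≡ c₀ z
    agree z z∈ = proj₁ (along z z∈ (m-root z z∈) (walk z z∈))

    conn : ∀ x y → x ∈ Z → y ∈ Z → c₀ x ≡ c₀ y → Star (Step a Q c) x y
    conn x y x∈ y∈ eq = proj₂ (along x x∈ (m-root x x∈) (walk x x∈))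
      ◅◅ mapStar (λ (e , p , q , r) → e , R⊆Q _ p , R⊆Q _ q , trans (c-in p) (trans r (sym (c-in q))))
           (proj₂ (proj₂ inner) (h x) (h y) (root∈ x∈) (root∈ y∈)
             (trans (cong c₀ (m-h x x∈)) (trans eq (cong c₀ (sym (m-h y y∈))))))
      ◅◅ reverse (Step-sym a Q c) (proj₂ (along y y∈ (m-root y y∈) (walk y y∈)))

  -- Menger's theorem is applied in `B`, where only the gate `Y` is left of `R`. Full saturation
  -- brings `X` to `Y`, and `R` does the linking. A smaller separator `Z` cuts off the part of `R`
  -- outside `Y` together with all that `Y` reaches, and this part is linked from `Z` in the same
  -- way. By `guard`, edges from `R` outside `Y` cannot bypass the gate.
  module Attach (a : Net n) (D X R Y : VSet n) (p : ℕ) (#X≤p : # X ≤ p) (closed : Closed a D X)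
    (R⊆ : R ⊆ D ∪ X) (Y⊆R : Y ⊆ R) (X∩R : ∀ x → x ∈ X → x ∈ R → x ∈ Y)
    (guard : ∀ r w → r ∈ R → r ∉ Y → E a r w → w ∈ R) (lk : Linkable a R Y p) where

    B : VSet n
    B = (D ∪ X) ∖ (R ∖ Y)

    es = edgesIn a B

    Y⊆B : Y ⊆ B
    Y⊆B y y∈ = R⊆ y (Y⊆R y y∈) , λ (_ , y∉) → y∉ y∈

    B-∉R : ∀ {v} → v ∈ B → v ∉ Y → v ∉ R
    B-∉R (_ , v∉) v∉Y v∈R = v∉ (v∈R , v∉Y)

    module WithSeparator (Z : VSet n) (sep : Separates es Z Y X) (#Z≤p : # Z ≤ p) (m : V → V) (sat : Saturated es Y Z m) where

      -- The condition `y ≢ z` keeps every vertex after the first outside `Z`, since vertices of `Z`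
      -- are labelled by themselves.
      LabelWalk : V → V → V → Set
      LabelWalk z = Star (λ x y → (Class es m z x y × x ∉ Y) × y ≢ z)

      hit : ∀ z → z ∈ Z → ∃ λ q → q ∈ Y × LabelWalk z z q
      hit z z∈ with sat z z∈
      ... | _ , y , y∈ , s with firstHit Y s y∈
      ... | q , q∈ , s′ = q , q∈ , noReturn s′

      h : V → V
      h z with z ∈? Z
      ... | yes z∈ = proj₁ (hit z z∈)
      ... | no _   = z

      h-spec : ∀ z → z ∈ Z → h z ∈ Y × LabelWalk z z (h z)
      h-spec z z∈ with z ∈? Z
      ... | yes z∈′ = proj₂ (hit z z∈′)
      ... | no z∉ = contradiction z∈ z∉

      m-root : ∀ z → z ∈ Z → m z ≡ z
      m-root z z∈ = proj₁ (sat z z∈)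

      Z⊆B : Z ⊆ B
      Z⊆B z z∈ with h-spec z z∈
      ... | y∈ , s with h z | s
      ... | _ | ε = Y⊆B z y∈
      ... | _ | (((e , _) , _) , _) ◅ _ = proj₁ (proj₂ (edgesIn⁻ a B e))

      linked-in : (Q : VSet n) → R ⊆ Q → (∀ z → z ∈ Z → ∀ {w} → m w ≡ z → w ∈ Q →
          Star (λ x y → (Class es m z x y × x ∉ Y) × y ≢ z) w (h z) →
          Star (λ x y → E a x y × x ∈ Q × y ∈ Q × m x ≡ z × m y ≡ z × x ∉ R) w (h z)) → Z ⊆ Q → ∀ c₀ → ∃ λ c →
        (∀ z → z ∈ Z → c z ≡ c₀ z) × (∀ x y → x ∈ Z → y ∈ Z → c₀ x ≡ c₀ y → Star (Step a Q c) x y)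
      linked-in Q R⊆Q conv Z⊆Q c₀ = A.c , A.agree , A.conn
        where module A = Assemble a R Y Q Z p lk #Z≤p Y⊆R R⊆Q m h m-root (λ z z∈ → proj₁ (h-spec z z∈))
                           (λ z z∈ → conv z z∈ (m-root z z∈) (Z⊆Q z z∈) (proj₂ (h-spec z z∈))) c₀

      D₀ : VSet n
      D₀ = (R ∖ Y) ∪ Reach es Z Y

      Reach⊆B : Reach es Z Y ⊆ B
      Reach⊆B v (y , y∈ , _ , s) = go (Y⊆B y y∈) s
        where
        go : ∀ {w} → w ∈ B → Star (Avoid es Z) w v → v ∈ B
        go w∈ ε = w∈
        go w∈ ((e , _) ◅ s) = go (proj₂ (proj₂ (edgesIn⁻ a B e))) s

      R⊆D₀∪Z : R ⊆ D₀ ∪ Z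
      R⊆D₀∪Z r r∈ with r ∈? Y | r ∈? Z
      ... | no r∉ | _ = inj₁ (inj₁ (r∈ , r∉))
      ... | yes r∈Y | yes r∈Z = inj₂ r∈Z
      ... | yes r∈Y | no r∉Z = inj₁ (inj₂ (r , r∈Y , r∉Z , ε))

      suffix-reach : ∀ z → z ∈ Z → ∀ {w} → w ∉ Z → LabelWalk z w (h z) →
        w ∈ Reach es Z Y × Star (λ x y → E a x y × x ∈ D₀ ∪ Z × y ∈ D₀ ∪ Z × m x ≡ z × m y ≡ z × x ∉ R) w (h z)
      suffix-reach z z∈ w∉ ε = (_ , proj₁ (h-spec z z∈) , w∉ , ε) , ε
      suffix-reach z z∈ w∉ ((((e , mx , my) , x∉) , ne) ◅ s)
        with suffix-reach z z∈ (λ w′∈ → ne (trans (sym (m-root _ w′∈)) my)) s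
      ... | r′ , s′ = r , (proj₁ (edgesIn⁻ a B e) , inj₁ (inj₂ r) , inj₁ (inj₂ r′) , mx , my , B-∉R (proj₁ (proj₂ (edgesIn⁻ a B e))) x∉) ◅ s′
        where r = Reach-step es Z Y r′ (Edge-sym es e) w∉

      rigid : # Z < # X → Rigid a D X D₀ Z
      rigid lt = record
        { D₀⊆D = λ where
            v (inj₁ (v∈R , v∉Y)) → [ id , (λ v∈X → contradiction (X∩R v v∈X v∈R) v∉Y) ]′ (R⊆ v v∈R)
            v (inj₂ r) → [ id , (λ v∈X → contradiction r (sep v v∈X)) ]′ (proj₁ (Reach⊆B v r))
        ; Z⊆ = λ z z∈ → proj₁ (Z⊆B z z∈)
        ; disj = λ where
            v (inj₁ b) v∈Z → proj₂ (Z⊆B v v∈Z) b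
            v (inj₂ r) v∈Z → Reach-∉ es Z Y r v∈Z
        ; closed = cl
        ; small = lt
        ; linked = linked-in (D₀ ∪ Z) R⊆D₀∪Z conv (λ _ → inj₂)
        }
        where
        cl : Closed a D₀ Z
        cl d w (inj₁ (d∈R , d∉Y)) e = R⊆D₀∪Z w (guard d w d∈R d∉Y e)
        cl d w (inj₂ r) e with w ∈? R | w ∈? Z
        ... | yes w∈R | _ = R⊆D₀∪Z w w∈R
        ... | no w∉R | yes w∈Z = inj₂ w∈Z
        ... | no w∉R | no w∉Z = inj₁ (inj₂ (Reach-step es Z Y r (edgesIn⁺ a B e d∈B (w∈ , w∉R ∘ proj₁)) w∉Z))
          where
          d∈B = Reach⊆B d r
          w∈ : w ∈ D ∪ X
          w∈ = [ (λ d∈D → closed d w d∈D e) , (λ d∈X → contradiction r (sep d d∈X)) ]′ (proj₁ d∈B)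
        conv : ∀ z → z ∈ Z → ∀ {w} → m w ≡ z → w ∈ D₀ ∪ Z → LabelWalk z w (h z) →
          Star (λ x y → E a x y × x ∈ D₀ ∪ Z × y ∈ D₀ ∪ Z × m x ≡ z × m y ≡ z × x ∉ R) w (h z)
        conv z z∈ mw w∈ ε = ε
        conv z z∈ mw w∈ ((((e , mx , my) , x∉) , ne) ◅ s)
          with suffix-reach z z∈ (λ w′∈ → ne (trans (sym (m-root _ w′∈)) my)) s
        ... | r′ , s′ = (proj₁ (edgesIn⁻ a B e) , w∈ , inj₁ (inj₂ r′) , mx , my , B-∉R (proj₁ (proj₂ (edgesIn⁻ a B e))) x∉) ◅ s′

      linkedX : Z ≡ X → Linked a D X
      linkedX refl = linked-in (D ∪ X) R⊆ (λ _ _ _ _ → mapStar conv) (λ _ → inj₂)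
        where
        conv : ∀ {z x y} → (Class es m z x y × x ∉ Y) × y ≢ z →
          E a x y × x ∈ D ∪ X × y ∈ D ∪ X × m x ≡ z × m y ≡ z × x ∉ R
        conv (((e , mx , my) , x∉) , _) = let e′ , x∈ , y∈ = edgesIn⁻ a B e in
          e′ , proj₁ x∈ , proj₁ y∈ , mx , my , B-∉R x∈ x∉

    attach : Linked a D X ⊎ ∃ λ D₀ → ∃ λ Z → Rigid a D X D₀ Z × R ⊆ D₀ ∪ Z × (R ∖ Y) ⊆ D₀
    attach with menger es Y X
    ... | Z , inj₁ eq , sep , m , sat = inj₁ (WithSeparator.linkedX Z sep (subst (λ Z → # Z ≤ p) (sym eq) #X≤p) m sat eq)
    ... | Z , inj₂ lt , sep , m , sat = inj₂ (W.D₀ , Z , W.rigid lt , W.R⊆D₀∪Z , λ _ → inj₁)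
      where module W = WithSeparator Z sep (≤-trans (<⇒≤ lt) #X≤p) m sat

  open Attach public using (attach)

-- Edge counts, massed sets, clique replacement and contraction

module _ {n : ℕ} where
  private
    V = Fin n

  ι-disjoint₃ : {A B C F : Set} (a? : Dec A) (b? : Dec B) (c? : Dec C) (d? : Dec F) →
    (A → F) → (B → F) → (C → F) → (A → ¬ B) → (A → ¬ C) → (B → ¬ C) → ι a? + ι b? + ι c? ≤ ι d?
  ι-disjoint₃ a? (yes b) c? d? f g h ab ac bc =
    ≤-trans (≤-reflexive (cong₂ _+_ (cong (_+ 1) (ι-no a? λ a → ab a b)) (ι-no c? (bc b)))) (≤-reflexive (sym (ι-yes d? (g b))))
  ι-disjoint₃ a? (no _) c? d? f g h ab ac bc =
    ≤-trans (≤-reflexive (cong (_+ ι c?) (+-identityʳ (ι a?)))) (ι-disjoint a? c? d? f h ac)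

  ι-⊎₃ : {A B C F : Set} (d? : Dec F) (a? : Dec A) (b? : Dec B) (c? : Dec C) →
    (F → A ⊎ B ⊎ C) → ι d? ≤ ι a? + ι b? + ι c?
  ι-⊎₃ (no _) a? b? c? f = z≤n
  ι-⊎₃ (yes d) a? b? c? f with f d
  ... | inj₁ a = ≤-trans (≤-reflexive (sym (ι-yes a? a))) (≤-trans (m≤m+n _ (ι b?)) (m≤m+n _ (ι c?)))
  ... | inj₂ (inj₁ b) = ≤-trans (≤-reflexive (sym (ι-yes b? b))) (≤-trans (m≤n+m _ (ι a?)) (m≤m+n _ (ι c?)))
  ... | inj₂ (inj₂ c) = ≤-trans (≤-reflexive (sym (ι-yes c? c))) (m≤n+m _ (ι a? + ι b?))

  pairs : {P : V → V → Set} → (∀ x y → Dec (P x y)) → ℕ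
  pairs P? = sum λ x → sum λ y → ι (P? x y)

  sum-+₃ : ∀ {k} (f g h : Fin k → ℕ) → sum (λ x → f x + g x + h x) ≡ sum f + sum g + sum h
  sum-+₃ f g h = trans (∑-distrib-+ (λ x → f x + g x) h) (cong (_+ sum h) (∑-distrib-+ f g))

  pairs-mono : {P Q : V → V → Set} (P? : ∀ x y → Dec (P x y)) (Q? : ∀ x y → Dec (Q x y)) →
    (∀ x y → P x y → Q x y) → pairs P? ≤ pairs Q?
  pairs-mono P? Q? f = sum-mono λ x → sum-mono λ y → ι-mono (P? x y) (Q? x y) (f x y)

  pairs-⊎ : {P Q R : V → V → Set} (P? : ∀ x y → Dec (P x y)) (Q? : ∀ x y → Dec (Q x y)) (R? : ∀ x y → Dec (R x y)) →
    (∀ x y → P x y → Q x y ⊎ R x y) → pairs P? ≤ pairs Q? + pairs R?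
  pairs-⊎ P? Q? R? f = sum-mono-+ λ x → sum-mono-+ λ y → ι-⊎ (P? x y) (Q? x y) (R? x y) (f x y)

  private
    nested-+₃ : (f g h : V → V → ℕ) → sum (λ x → sum λ y → f x y + g x y + h x y)
      ≡ sum (λ x → sum (f x)) + sum (λ x → sum (g x)) + sum (λ x → sum (h x))
    nested-+₃ f g h = trans (sum-cong-≗ λ x → sum-+₃ (f x) (g x) (h x))
      (sum-+₃ (λ x → sum (f x)) (λ x → sum (g x)) (λ x → sum (h x)))

  pairs-⊎₃ : {S P Q R : V → V → Set} (S? : ∀ x y → Dec (S x y)) (P? : ∀ x y → Dec (P x y)) (Q? : ∀ x y → Dec (Q x y)) (R? : ∀ x y → Dec (R x y)) →
    (∀ x y → S x y → P x y ⊎ Q x y ⊎ R x y) → pairs S? ≤ pairs P? + pairs Q? + pairs R?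
  pairs-⊎₃ S? P? Q? R? f = ≤-trans (sum-mono λ x → sum-mono λ y → ι-⊎₃ (S? x y) (P? x y) (Q? x y) (R? x y) (f x y))
    (≤-reflexive (nested-+₃ (λ x y → ι (P? x y)) (λ x y → ι (Q? x y)) (λ x y → ι (R? x y))))

  pairs-disjoint₃ : {S P Q R : V → V → Set} (P? : ∀ x y → Dec (P x y)) (Q? : ∀ x y → Dec (Q x y)) (R? : ∀ x y → Dec (R x y)) (S? : ∀ x y → Dec (S x y)) →
    (∀ x y → P x y → S x y) → (∀ x y → Q x y → S x y) → (∀ x y → R x y → S x y) →
    (∀ x y → P x y → ¬ Q x y) → (∀ x y → P x y → ¬ R x y) → (∀ x y → Q x y → ¬ R x y) →
    pairs P? + pairs Q? + pairs R? ≤ pairs S?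
  pairs-disjoint₃ P? Q? R? S? f g h pq pr qr = ≤-trans
    (≤-reflexive (sym (nested-+₃ (λ x y → ι (P? x y)) (λ x y → ι (Q? x y)) (λ x y → ι (R? x y)))))
    (sum-mono λ x → sum-mono λ y → ι-disjoint₃ (P? x y) (Q? x y) (R? x y) (S? x y) (f x y) (g x y) (h x y) (pq x y) (pr x y) (qr x y))

  inRow? inCol? : (v : V) (S : VSet n) (x y : V) → Dec _
  inRow? v S x y = (x ≟ v) ×-dec (y ∈? S)
  inCol? v S x y = (y ≟ v) ×-dec (x ∈? S)

  private
    ι-× : {A B : Set} (a? : Dec A) (b? : Dec B) → A → ι (a? ×-dec b?) ≡ ι b?
    ι-× (yes _) (yes _) _ = refl
    ι-× (yes _) (no _)  _ = refl
    ι-× (no ¬a) _ a = contradiction a ¬a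

  pairs-row : ∀ v S → pairs (inRow? v S) ≡ # S
  pairs-row v S = trans
    (sum-point _ v λ x ne → sum-zero λ y → ι-no (inRow? v S x y) (ne ∘ proj₁))
    (sum-cong-≗ λ y → ι-× (v ≟ v) (y ∈? S) refl)

  pairs-col : ∀ v S → pairs (inCol? v S) ≡ # S
  pairs-col v S = sum-cong-≗ λ x → trans
    (sum-point _ v λ y ne → ι-no (inCol? v S x y) (ne ∘ proj₁)) (ι-× (v ≟ v) (x ∈? S) refl)

  Touch : Net n → VSet n → V → V → Set
  Touch a D x y = E a x y × (x ∈ D ⊎ y ∈ D)

  touch? : ∀ a D x y → Dec (Touch a D x y)
  touch? a D x y = E? a x y ×-dec ((x ∈? D) ⊎-dec (y ∈? D))

  -- Ordered pairs, so this is twice the number of edges meeting D.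
  ρ : Net n → VSet n → ℕ
  ρ a D = pairs (touch? a D)

  nbr : Net n → V → VSet n
  nbr a u = mkSet (E a u) (E? a u)

  ∂ : Net n → VSet n → VSet n
  ∂ a D = mkSet (λ v → v ∉ D × ∃ λ d → d ∈ D × E a d v)
                (λ v → ¬? (v ∈? D) ×-dec any? λ d → (d ∈? D) ×-dec E? a d v)

  Closed-∂ : ∀ a D → Closed a D (∂ a D)
  Closed-∂ a D d w d∈ e with w ∈? D
  ... | yes w∈ = inj₁ w∈
  ... | no w∉ = inj₂ (w∉ , d , d∈ , e)

  ∂-⊆ : ∀ a D Z → Closed a D Z → ∂ a D ⊆ Z
  ∂-⊆ a D Z cl v (v∉ , d , d∈ , e) = [ (λ v∈ → contradiction v∈ v∉) , id ]′ (cl d v d∈ e)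

  ⊆? : (S S′ : VSet n) → Dec (S ⊆ S′)
  ⊆? S S′ = all? λ v → (v ∈? S) →-dec (v ∈? S′)

  module MassBound (L : ℕ) where

    -- D is the interior and X the set of roots of a graph with vertex set D ∪ X.
    record Massed (a : Net n) (D X : VSet n) : Set₁ where
      field
        heavy : L * # D < ρ a D
        light : ∀ F → F ⊆ D → # (∂ a F) < # X → ρ a F ≤ L * # F
    open Massed public

    Violation : Net n → VSet n → VSet n → VSet n → Set
    Violation a D X F = F ⊆ D × # (∂ a F) < # X × L * # F < ρ a F

    Violation-ext : ∀ a D X → Extensional (Violation a D X)
    Violation-ext a D X S S′ f g (sub , bd , hv) =
      (λ v → sub v ∘ g v) ,
      ≤-<-trans (#-mono (∂ a S′) (∂ a S) λ v (v∉ , d , d∈ , e) → v∉ ∘ f v , d , g d d∈ , e) bd ,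
      <-≤-trans (≤-<-trans (*-monoʳ-≤ L (#-mono S′ S g)) hv)
        (pairs-mono (touch? a S) (touch? a S′) λ x y (e , t) → e , [ inj₁ ∘ f x , inj₂ ∘ f y ]′ t)

    violation? : ∀ a D X F → Dec (Violation a D X F)
    violation? a D X F = ⊆? F D ×-dec (# (∂ a F) <? # X) ×-dec (L * # F <? ρ a F)

    -- Take a smallest violating `F`. A subset that violates lightness relative to the boundary of
    -- `F` has a smaller boundary than `F`, hence is a proper subset, and it violates lightness
    -- relative to `X` as well.
    massedOrViolated : ∀ a D X → L * # D < ρ a D →
      Massed a D X ⊎ ∃ λ F → Violation a D X F × Massed a F (∂ a F)
    massedOrViolated a D X hv with anySet? (Violation a D X) (violation? a D X) (Violation-ext a D X)
    ... | no none = inj₁ record { heavy = hv ; light = λ F sub bd → ≮⇒≥ λ lt → none (F , sub , bd , lt) }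
    ... | yes (F₀ , viol) with minimalSet (Violation a D X) (violation? a D X) (Violation-ext a D X) F₀ viol
    ... | F , (sub , bd , hvF) , least = inj₂ (F , (sub , bd , hvF) , record
            { heavy = hvF
            ; light = λ F′ F′⊆F bd′ → ≮⇒≥ λ lt → least F′ (smaller F′ F′⊆F bd′) ((λ v → sub v ∘ F′⊆F v) , <-trans bd′ bd , lt) })
      where
      smaller : ∀ F′ → F′ ⊆ F → # (∂ a F′) < # (∂ a F) → # F′ < # F
      smaller F′ F′⊆F bd′ with any? (λ v → (v ∈? F) ×-dec ¬? (v ∈? F′))
      ... | yes (v , v∈ , v∉) = #-strict F′ F F′⊆F v∈ v∉
      ... | no none = contradiction bd′ (≤⇒≯ (#-mono (∂ a F) (∂ a F′) λ v (v∉ , d , d∈ , e) → v∉ ∘ F′⊆F v , d , back d d∈ , e))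
        where
        back : F ⊆ F′
        back d d∈ with d ∈? F′
        ... | yes p = p
        ... | no ¬p = contradiction (d , d∈ , ¬p) none

    heavy⇒nonempty : ∀ a F → L * # F < ρ a F → ∃ λ v → v ∈ F
    heavy⇒nonempty a F lt with sum-pos _ (≤-<-trans z≤n lt)
    ... | x , p with sum-pos _ p
    ... | y , q with ι-pos (touch? a F x y) q
    ... | _ , inj₁ x∈ = x , x∈
    ... | _ , inj₂ y∈ = y , y∈

    -- This induction hypothesis ranges over all nets, because contraction and clique replacement
    -- change the net.
    LinkedBelow : ℕ → ℕ → Set₁
    LinkedBelow p N = ∀ a D X → # D < N → # X ≤ p → Closed a D X → (∀ v → v ∈ D → v ∉ X) → Massed a D X → Linked a D X

  -- `D₀` stays in the vertex type as isolated vertices, so all nets share one type. The clique on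
  -- `Z` stands for the connections available through `D₀`.
  shrink : Net n → VSet n → VSet n → Net n
  shrink a D₀ Z = record
    { E = λ x y → x ∉ D₀ × y ∉ D₀ × (E a x y ⊎ (x ∈ Z × y ∈ Z × x ≢ y))
    ; E? = λ x y → ¬? (x ∈? D₀) ×-dec ¬? (y ∈? D₀) ×-dec (E? a x y ⊎-dec ((x ∈? Z) ×-dec (y ∈? Z) ×-dec ¬? (x ≟ y)))
    ; E-sym = λ (p , q , r) → q , p , [ inj₁ ∘ E-sym a , (λ (s , t , ne) → inj₂ (t , s , ne ∘ sym)) ]′ r
    ; E-irr = λ (_ , _ , r) → [ E-irr a , (λ (_ , _ , ne) → ne refl) ]′ r
    }

  -- The outer colouring prescribes the partition of `Z` to be linked in `D₀`; an added edge inside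
  -- a colour class is then replaced by a path of that colour.
  lift-shrink : ∀ a D₀ Z D₁ X₁ → Linked a D₀ Z → (∀ v → v ∈ X₁ → v ∉ D₀) → Z ⊆ D₁ ∪ X₁ →
    Linked (shrink a D₀ Z) D₁ X₁ → Linked a (D₀ ∪ D₁) X₁
  lift-shrink a D₀ Z D₁ X₁ inner X₁∩D₀ Z⊆ outer c₀ with outer c₀
  ... | c₁ , agree₁ , conn₁ with inner c₁
  ... | c₂ , agree₂ , conn₂ = c , (λ x x∈ → trans (c-out (X₁∩D₀ x x∈)) (agree₁ x x∈)) ,
        λ x y x∈ y∈ eq → (conv ⋆) (conn₁ x y x∈ y∈ eq)
    where
    c : V → ℕ
    c v with v ∈? D₀
    ... | yes _ = c₂ v
    ... | no _  = c₁ v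
    c-out : ∀ {v} → v ∉ D₀ → c v ≡ c₁ v
    c-out {v} v∉ with v ∈? D₀
    ... | yes v∈ = contradiction v∈ v∉
    ... | no _ = refl
    c-in : ∀ {v} → v ∈ D₀ ∪ Z → c v ≡ c₂ v
    c-in {v} v∈ with v ∈? D₀
    ... | yes _ = refl
    ... | no v∉ = [ (λ v∈D → contradiction v∈D v∉) , (λ z → sym (agree₂ v z)) ]′ v∈
    Q = (D₀ ∪ D₁) ∪ X₁
    toQ : ∀ {v} → v ∈ D₁ ∪ X₁ → v ∈ Q
    toQ = [ inj₁ ∘ inj₂ , inj₂ ]′
    toQ′ : ∀ {v} → v ∈ D₀ ∪ Z → v ∈ Q
    toQ′ = [ inj₁ ∘ inj₁ , toQ ∘ Z⊆ _ ]′
    conv : ∀ {x y} → Step (shrink a D₀ Z) (D₁ ∪ X₁) c₁ x y → Star (Step a Q c) x y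
    conv ((x∉ , y∉ , inj₁ e) , x∈ , y∈ , eq) = (e , toQ x∈ , toQ y∈ , trans (c-out x∉) (trans eq (sym (c-out y∉)))) ◅ ε
    conv {x} {y} ((x∉ , y∉ , inj₂ (zx , zy , _)) , x∈ , y∈ , eq) =
      mapStar (λ (e , p , q , r) → e , toQ′ p , toQ′ q , trans (c-in p) (trans r (sym (c-in q)))) (conn₂ x y zx zy eq)

  contract : Net n → V → V → Net n
  contract a u v = record
    { E = λ x y → x ≢ u × y ≢ u × x ≢ y × (E a x y ⊎ (x ≡ v × E a u y) ⊎ (y ≡ v × E a u x))
    ; E? = λ x y → ¬? (x ≟ u) ×-dec ¬? (y ≟ u) ×-dec ¬? (x ≟ y) ×-dec
             (E? a x y ⊎-dec (((x ≟ v) ×-dec E? a u y) ⊎-dec ((y ≟ v) ×-dec E? a u x)))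
    ; E-sym = λ (p , q , ne , r) → q , p , ne ∘ sym , [ inj₁ ∘ E-sym a , [ inj₂ ∘ inj₂ , inj₂ ∘ inj₁ ]′ ]′ r
    ; E-irr = λ (_ , _ , ne , _) → ne refl
    }

  -- `u` receives the colour of `v`, so a new edge at `v` becomes a detour through `u` within one
  -- colour class.
  lift-contract : ∀ a u v D₁ X₁ → E a u v → u ∉ X₁ → v ∈ D₁ ∪ X₁ →
    Linked (contract a u v) D₁ X₁ → Linked a (D₁ ∪ ⁅ u ⁆) X₁
  lift-contract a u v D₁ X₁ uv u∉X v∈ L c₀ with L c₀
  ... | c₁ , agree₁ , conn₁ = c , (λ x x∈ → trans (c-old λ { refl → u∉X x∈ }) (agree₁ x x∈)) ,
        λ x y x∈ y∈ eq → (conv ⋆) (conn₁ x y x∈ y∈ eq)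
    where
    c : V → ℕ
    c w with w ≟ u
    ... | yes _ = c₁ v
    ... | no _  = c₁ w
    c-old : ∀ {w} → w ≢ u → c w ≡ c₁ w
    c-old {w} ne with w ≟ u
    ... | yes eq = contradiction eq ne
    ... | no _ = refl
    c-u : c u ≡ c₁ v
    c-u with u ≟ u
    ... | yes _ = refl
    ... | no ne = contradiction refl ne
    Q = (D₁ ∪ ⁅ u ⁆) ∪ X₁
    toQ : ∀ {w} → w ∈ D₁ ∪ X₁ → w ∈ Q
    toQ = [ inj₁ ∘ inj₁ , inj₂ ]′
    u∈Q : u ∈ Q
    u∈Q = inj₁ (inj₂ refl)
    conv : ∀ {x y} → Step (contract a u v) (D₁ ∪ X₁) c₁ x y → Star (Step a Q c) x y
    conv ((x≢u , y≢u , _ , inj₁ e) , x∈ , y∈ , eq) =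
      (e , toQ x∈ , toQ y∈ , trans (c-old x≢u) (trans eq (sym (c-old y≢u)))) ◅ ε
    conv ((x≢u , y≢u , _ , inj₂ (inj₁ (refl , uy))) , x∈ , y∈ , eq) =
      (E-sym a uv , toQ x∈ , u∈Q , trans (c-old x≢u) (sym c-u)) ◅
      (uy , u∈Q , toQ y∈ , trans c-u (trans eq (sym (c-old y≢u)))) ◅ ε
    conv ((x≢u , y≢u , _ , inj₂ (inj₂ (refl , ux))) , x∈ , y∈ , eq) =
      (E-sym a ux , toQ x∈ , u∈Q , trans (c-old x≢u) (trans eq (sym c-u))) ◅
      (uv , u∈Q , toQ y∈ , trans c-u (sym (c-old y≢u))) ◅ ε

  -- An edge of the contraction that is new at v comes from an edge at u.
  ρ-contract-≤ : ∀ a u v F → u ∉ F → v ∉ F → ρ (contract a u v) F ≤ ρ a F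
  ρ-contract-≤ a u v F u∉ v∉ = begin
    ρ (contract a u v) F
      ≤⟨ pairs-⊎₃ (touch? (contract a u v) F) old? (inRow? v Nu) (inCol? v Nu) split ⟩
    pairs old? + pairs (inRow? v Nu) + pairs (inCol? v Nu)
      ≡⟨ cong₂ (λ s t → pairs old? + s + t) (trans (pairs-row v Nu) (sym (pairs-row u Nu))) (trans (pairs-col v Nu) (sym (pairs-col u Nu))) ⟩
    pairs old? + pairs (inRow? u Nu) + pairs (inCol? u Nu)
      ≤⟨ pairs-disjoint₃ old? (inRow? u Nu) (inCol? u Nu) (touch? a F)
           (λ x y → proj₁)
           (λ { x y (refl , e , y∈) → e , inj₂ y∈ })
           (λ { x y (refl , e , x∈) → E-sym a e , inj₁ x∈ })
           (λ x y (_ , x≢u , _) (x≡u , _) → x≢u x≡u)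
           (λ x y (_ , _ , y≢u) (y≡u , _) → y≢u y≡u)
           (λ { x y (refl , e , _) (refl , _) → E-irr a e }) ⟩
    ρ a F ∎
    where
    open ≤-Reasoning
    Nu : VSet n
    Nu = nbr a u ∩ F
    old? : ∀ x y → Dec (Touch a F x y × x ≢ u × y ≢ u)
    old? x y = touch? a F x y ×-dec ¬? (x ≟ u) ×-dec ¬? (y ≟ u)
    split : ∀ x y → Touch (contract a u v) F x y → (Touch a F x y × x ≢ u × y ≢ u) ⊎ (x ≡ v × y ∈ Nu) ⊎ (y ≡ v × x ∈ Nu)
    split x y ((x≢u , y≢u , _ , inj₁ e) , t) = inj₁ ((e , t) , x≢u , y≢u)
    split x y ((_ , _ , _ , inj₂ (inj₁ (refl , e))) , t) = inj₂ (inj₁ (refl , e , [ (λ p → contradiction p v∉) , id ]′ t))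
    split x y ((_ , _ , _ , inj₂ (inj₂ (refl , e))) , t) = inj₂ (inj₂ (refl , e , [ id , (λ p → contradiction p v∉) ]′ t))

  codeg : Net n → V → V → ℕ
  codeg a u v = # (nbr a u ∩ nbr a v)

  -- The edges lost are uv, one for each common neighbour, and those that end up inside X.
  contract-loss : ∀ a D X u v → Closed a D X → u ∈ D → E a u v →
    ρ a D ≤ ρ (contract a u v) (D ∖ ⁅ u ⁆) + 2 * (1 + codeg a u v + # X)
  contract-loss a D X u v cl u∈ uv = begin
    ρ a D
      ≤⟨ pairs-⊎₃ (touch? a D) old? (inRow? u (nbr a u)) (inCol? u (nbr a u)) split ⟩
    pairs old? + pairs (inRow? u (nbr a u)) + pairs (inCol? u (nbr a u))
      ≡⟨ cong₂ (λ s t → pairs old? + s + t) (pairs-row u (nbr a u)) (pairs-col u (nbr a u)) ⟩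
    pairs old? + # (nbr a u) + # (nbr a u)
      ≤⟨ +-mono-≤ (+-monoʳ-≤ (pairs old?) deg≤) deg≤ ⟩
    pairs old? + (# New + K) + (# New + K)
      ≡⟨ regroup (pairs old?) (# New) K ⟩
    pairs old? + # New + # New + 2 * K
      ≤⟨ +-monoˡ-≤ (2 * K) gain ⟩
    ρ (contract a u v) (D ∖ ⁅ u ⁆) + 2 * K ∎
    where
    open ≤-Reasoning
    K = 1 + codeg a u v + # X
    regroup : ∀ o w k → o + (w + k) + (w + k) ≡ o + w + w + 2 * k
    regroup = solve-∀
    old? : ∀ x y → Dec (Touch a D x y × x ≢ u × y ≢ u)
    old? x y = touch? a D x y ×-dec ¬? (x ≟ u) ×-dec ¬? (y ≟ u)
    New : VSet n
    New = mkSet (λ y → E a u y × ¬ E a v y × y ≢ v × y ∈ D) (λ y → E? a u y ×-dec ¬? (E? a v y) ×-dec ¬? (y ≟ v) ×-dec (y ∈? D))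
    split : ∀ x y → Touch a D x y → (Touch a D x y × x ≢ u × y ≢ u) ⊎ (x ≡ u × E a u y) ⊎ (y ≡ u × E a u x)
    split x y t with x ≟ u | y ≟ u
    ... | yes refl | _ = inj₂ (inj₁ (refl , proj₁ t))
    ... | no _ | yes refl = inj₂ (inj₂ (refl , E-sym a (proj₁ t)))
    ... | no x≢u | no y≢u = inj₁ (t , x≢u , y≢u)
    deg≤ : # (nbr a u) ≤ # New + K
    deg≤ = begin
      # (nbr a u) ≤⟨ #-⊎ (nbr a u) New (⁅ v ⁆ ∪ (nbr a u ∩ nbr a v) ∪ X) cover ⟩
      # New + # (⁅ v ⁆ ∪ (nbr a u ∩ nbr a v) ∪ X)
        ≤⟨ +-monoʳ-≤ (# New) (#-⊎ (⁅ v ⁆ ∪ (nbr a u ∩ nbr a v) ∪ X) (⁅ v ⁆ ∪ (nbr a u ∩ nbr a v)) X (λ _ → id)) ⟩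
      # New + (# (⁅ v ⁆ ∪ (nbr a u ∩ nbr a v)) + # X)
        ≤⟨ +-monoʳ-≤ (# New) (+-monoˡ-≤ (# X) (#-⊎ (⁅ v ⁆ ∪ (nbr a u ∩ nbr a v)) ⁅ v ⁆ (nbr a u ∩ nbr a v) (λ _ → id))) ⟩
      # New + (# ⁅ v ⁆ + codeg a u v + # X)
        ≡⟨ cong (λ k → # New + (k + codeg a u v + # X)) (#-point v) ⟩
      # New + K ∎
      where
      cover : ∀ y → E a u y → y ∈ New ⊎ y ∈ (⁅ v ⁆ ∪ (nbr a u ∩ nbr a v) ∪ X)
      cover y uy with y ≟ v | E? a v y | cl u y u∈ uy
      ... | yes eq | _ | _ = inj₂ (inj₁ (inj₁ eq))
      ... | no _ | yes vy | _ = inj₂ (inj₁ (inj₂ (uy , vy)))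
      ... | no _ | no _ | inj₂ y∈X = inj₂ (inj₂ y∈X)
      ... | no ne | no ¬vy | inj₁ y∈D = inj₁ (uy , ¬vy , ne , y∈D)
    v≢u : v ≢ u
    v≢u refl = E-irr a uv
    new-edge : ∀ {y} → y ∈ New → Touch (contract a u v) (D ∖ ⁅ u ⁆) v y
    new-edge {y} (uy , _ , y≢v , y∈D) = (v≢u , y≢u , y≢v ∘ sym , inj₂ (inj₁ (refl , uy))) , inj₂ (y∈D , y≢u)
      where
      y≢u : y ≢ u
      y≢u refl = E-irr a uy
    gain : pairs old? + # New + # New ≤ ρ (contract a u v) (D ∖ ⁅ u ⁆)
    gain = begin
      pairs old? + # New + # New
        ≡⟨ cong₂ (λ s t → pairs old? + s + t) (sym (pairs-row v New)) (sym (pairs-col v New)) ⟩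
      pairs old? + pairs (inRow? v New) + pairs (inCol? v New)
        ≤⟨ pairs-disjoint₃ old? (inRow? v New) (inCol? v New) (touch? (contract a u v) (D ∖ ⁅ u ⁆))
             (λ { x y ((e , t) , x≢u , y≢u) → (x≢u , y≢u , (λ { refl → E-irr a e }) , inj₁ e) , [ (λ p → inj₁ (p , x≢u)) , (λ p → inj₂ (p , y≢u)) ]′ t })
             (λ { x y (refl , y∈) → new-edge y∈ })
             (λ { x y (refl , x∈) → let e , t = new-edge x∈ in E-sym (contract a u v) e , [ inj₂ , inj₁ ]′ t })
             (λ { x y ((e , _) , _) (refl , _ , ¬vy , _) → ¬vy e })
             (λ { x y ((e , _) , _) (refl , _ , ¬vx , _) → ¬vx (E-sym a e) })
             (λ { x y (refl , _ , _ , y≢v , _) (y≡v , _) → y≢v y≡v }) ⟩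
      ρ (contract a u v) (D ∖ ⁅ u ⁆) ∎

-- The reductions of the linkage induction

module _ {n : ℕ} where
  private
    V = Fin n

  module Reduction (L p : ℕ) (a : Net n) (D X : VSet n) (#X≤p : # X ≤ p)
    (closed : Closed a D X) (D∩X : ∀ v → v ∈ D → v ∉ X) where

    open MassBound {n} L

    module _ (massed : Massed a D X) (below : LinkedBelow p (# D)) where

      -- Replace D₀ by a clique on Z.  If this makes some set F too dense behind a small boundary, then F
      -- meets Z, and F ∪ D₀ is a larger rigid set.
      absorb : ∀ D₀ Z → Rigid a D X D₀ Z → (∃ λ d → d ∈ D₀) → Acc _<_ (# (D ∖ D₀)) → Linked a D X
      absorb D₀ Z rg (d , d∈) (acc rs) = cases (massedOrViolated a′ (D ∖ D₀) X heavy′)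
        where
        open Rigid rg renaming (closed to closed₀)
        a′ = shrink a D₀ Z
        #D₀<D : # (D ∖ D₀) < # D
        #D₀<D = #-strict (D ∖ D₀) D (λ _ → proj₁) (D₀⊆D d d∈) (λ q → proj₂ q d∈)
        -- Lightness allows at most `L * # D₀` for the edges meeting `D₀`, and all other edges
        -- survive in `a′`, so the surplus of `D` stays with the rest.
        heavy′ : L * # (D ∖ D₀) < ρ a′ (D ∖ D₀)
        heavy′ = +-cancelˡ-< (L * # D₀) _ _ (begin-strict
          L * # D₀ + L * # (D ∖ D₀) ≡⟨ sym (*-distribˡ-+ L (# D₀) _) ⟩
          L * (# D₀ + # (D ∖ D₀))   ≡⟨ cong (L *_) (sym (#-split D D₀ D₀⊆D)) ⟩
          L * # D                   <⟨ heavy massed ⟩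
          ρ a D                     ≤⟨ pairs-⊎ (touch? a D) (touch? a D₀) (touch? a′ (D ∖ D₀)) split ⟩
          ρ a D₀ + ρ a′ (D ∖ D₀)    ≤⟨ +-monoˡ-≤ _ (light massed D₀ D₀⊆D (≤-<-trans (#-mono (∂ a D₀) Z (∂-⊆ a D₀ Z closed₀)) small)) ⟩
          L * # D₀ + ρ a′ (D ∖ D₀)  ∎)
          where
          open ≤-Reasoning
          split : ∀ x y → Touch a D x y → Touch a D₀ x y ⊎ Touch a′ (D ∖ D₀) x y
          split x y (e , t) with x ∈? D₀ | y ∈? D₀
          ... | yes x∈ | _ = inj₁ (e , inj₁ x∈)
          ... | no _ | yes y∈ = inj₁ (e , inj₂ y∈)
          ... | no x∉ | no y∉ = inj₂ ((x∉ , y∉ , inj₁ e) , [ (λ q → inj₁ (q , x∉)) , (λ q → inj₂ (q , y∉)) ]′ t)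
        Z⊆′ : Z ⊆ (D ∖ D₀) ∪ X
        Z⊆′ z z∈ = [ (λ z∈D → inj₁ (z∈D , λ z∈D₀ → disj z z∈D₀ z∈)) , inj₂ ]′ (Z⊆ z z∈)
        cases : Massed a′ (D ∖ D₀) X ⊎ (∃ λ F → Violation a′ (D ∖ D₀) X F × Massed a′ F (∂ a′ F)) → Linked a D X
        cases (inj₁ massed′) = Linked-mono a (D₀ ∪ (D ∖ D₀)) D X (λ v → [ D₀⊆D v , proj₁ ]′)
          (lift-shrink a D₀ Z (D ∖ D₀) X linked (λ v v∈X v∈D₀ → D∩X v (D₀⊆D v v∈D₀) v∈X) Z⊆′
            (below a′ (D ∖ D₀) X #D₀<D #X≤p closed′ (λ v v∈ → D∩X v (proj₁ v∈)) massed′))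
          where
          closed′ : Closed a′ (D ∖ D₀) X
          closed′ d w (d∈D , _) (_ , w∉ , inj₁ e) = [ (λ w∈D → inj₁ (w∈D , w∉)) , inj₂ ]′ (closed d w d∈D e)
          closed′ d w _ (_ , _ , inj₂ (_ , zw , _)) = Z⊆′ w zw
        cases (inj₂ (F , (F⊆ , bd , hv) , massedF)) with any? (λ v → (v ∈? F) ×-dec (v ∈? Z))
        -- If `F` misses `Z`, it touches no added edge and has no neighbour in `D₀`, so lightness in
        -- `a` already excludes the violation.
        ... | no none = contradiction (light massed F (λ v → proj₁ ∘ F⊆ v) (≤-<-trans (#-mono (∂ a F) (∂ a′ F) ∂⊆) bd)) (<⇒≱ (<-≤-trans hv ρ≤))
          where
          off-D₀ : ∀ {f w} → f ∈ F → E a f w → w ∉ D₀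
          off-D₀ {f} {w} f∈ e w∈ = [ proj₂ (F⊆ f f∈) , (λ f∈Z → none (f , f∈ , f∈Z)) ]′ (closed₀ w f w∈ (E-sym a e))
          ∂⊆ : ∂ a F ⊆ ∂ a′ F
          ∂⊆ v (v∉ , f , f∈ , e) = v∉ , f , f∈ , proj₂ (F⊆ f f∈) , off-D₀ f∈ e , inj₁ e
          ρ≤ : ρ a′ F ≤ ρ a F
          ρ≤ = pairs-mono (touch? a′ F) (touch? a F) λ where
            x y ((_ , _ , inj₁ e) , t) → e , t
            x y ((_ , _ , inj₂ (zx , zy , _)) , inj₁ x∈) → contradiction (x , x∈ , zx) none
            x y ((_ , _ , inj₂ (zx , zy , _)) , inj₂ y∈) → contradiction (y , y∈ , zy) none
        ... | yes (z , z∈F , z∈Z) = absorb (D₀ ∪ F) (∂ a′ F) rigid′ (d , inj₁ d∈)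
              (rs (#-strict (D ∖ (D₀ ∪ F)) (D ∖ D₀) (λ v (v∈D , v∉) → v∈D , v∉ ∘ inj₁) (F⊆ z z∈F) (λ q → proj₂ q (inj₂ z∈F))))
          where
          -- `F` contains a vertex of the clique `Z`, so all of `Z` lies in `F` or on its boundary,
          -- as is required for putting `D₀` back.
          Z⊆F : Z ⊆ F ∪ ∂ a′ F
          Z⊆F w w∈ with w ∈? F
          ... | yes w∈F = inj₁ w∈F
          ... | no w∉F = inj₂ (w∉F , z , z∈F , proj₂ (F⊆ z z∈F) , (λ w∈D₀ → disj w w∈D₀ w∈) , inj₂ (z∈Z , w∈ , λ { refl → w∉F z∈F }))
          F∩D₀ : ∀ v → v ∈ ∂ a′ F → v ∉ D₀
          F∩D₀ v (_ , _ , _ , _ , v∉ , _) = v∉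
          rigid′ : Rigid a D X (D₀ ∪ F) (∂ a′ F)
          rigid′ = record
            { D₀⊆D = λ v → [ D₀⊆D v , proj₁ ∘ F⊆ v ]′
            ; Z⊆ = λ where
                v (_ , f , f∈ , _ , _ , inj₁ e) → closed f v (proj₁ (F⊆ f f∈)) e
                v (_ , _ , _ , _ , _ , inj₂ (_ , zv , _)) → Z⊆ v zv
            ; disj = λ where
                v (inj₁ v∈D₀) q → F∩D₀ v q v∈D₀
                v (inj₂ v∈F) q → proj₁ q v∈F
            ; closed = cl
            ; small = bd
            ; linked = lift-shrink a D₀ Z F (∂ a′ F) linked F∩D₀ Z⊆F
                (below a′ F (∂ a′ F) (≤-<-trans (#-mono F (D ∖ D₀) F⊆) #D₀<D) (≤-trans (<⇒≤ bd) #X≤p)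
                  (Closed-∂ a′ F) (λ v v∈F q → proj₁ q v∈F) massedF)
            }
            where
            cl : Closed a (D₀ ∪ F) (∂ a′ F)
            cl e w (inj₁ e∈) ew = [ inj₁ ∘ inj₁ , [ inj₁ ∘ inj₂ , inj₂ ]′ ∘ Z⊆F w ]′ (closed₀ e w e∈ ew)
            cl e w (inj₂ e∈) ew with w ∈? D₀ | w ∈? F
            ... | yes w∈ | _ = inj₁ (inj₁ w∈)
            ... | no _ | yes w∈ = inj₁ (inj₂ w∈)
            ... | no w∉ | no w∉F = inj₂ (w∉F , e , e∈ , proj₂ (F⊆ e e∈) , w∉ , inj₁ ew)

      -- If Menger's theorem does not bring all of `X` to the core, it leaves a rigid set to absorb.
      -- The last hypothesis makes that set nonempty: it contains every vertex of `R` outside `Y`,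
      -- and a core of more than `p` vertices does not fit into the separator.
      linkedFromCore : ∀ R Y → R ⊆ D ∪ X → Y ⊆ R → (∀ x → x ∈ X → x ∈ R → x ∈ Y) →
        (∀ r w → r ∈ R → r ∉ Y → E a r w → w ∈ R) → Linkable a R Y p →
        (∃ λ r → r ∈ R × r ∉ Y) ⊎ p < # R → Linked a D X
      linkedFromCore R Y R⊆ Y⊆R X∩R guard lk big with attach a D X R Y p #X≤p closed R⊆ Y⊆R X∩R guard lk
      ... | inj₁ done = done
      ... | inj₂ (D₀ , Z , rg , R⊆′ , R∖Y⊆) = absorb D₀ Z rg (nonempty big) (<-wellFounded _)
        where
        nonempty : (∃ λ r → r ∈ R × r ∉ Y) ⊎ p < # R → ∃ λ d → d ∈ D₀
        nonempty (inj₁ (r , r∈)) = r , R∖Y⊆ r r∈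
        nonempty (inj₂ lt) with #-diff R Z (<-≤-trans (Rigid.small rg) (≤-trans #X≤p (<⇒≤ lt)))
        ... | r , r∈ , r∉ = r , [ id , (λ z → contradiction z r∉) ]′ (R⊆′ r r∈)

      linkedByDeletion : ∀ u → u ∈ D → (∀ v → ¬ E a u v) → Linked a D X
      linkedByDeletion u u∈ isolated = Linked-mono a (D ∖ ⁅ u ⁆) D X (λ _ → proj₁)
        (below a (D ∖ ⁅ u ⁆) X (≤-reflexive (#-remove D u∈)) #X≤p closed′ (λ v q → D∩X v (proj₁ q)) record
          { heavy = ≤-<-trans (*-monoʳ-≤ L (#-mono (D ∖ ⁅ u ⁆) D λ _ → proj₁)) (<-≤-trans (heavy massed)
              (pairs-mono (touch? a D) (touch? a (D ∖ ⁅ u ⁆)) λ x y (e , t) →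
                e , [ (λ q → inj₁ (q , λ { refl → isolated y e })) , (λ q → inj₂ (q , λ { refl → isolated x (E-sym a e) })) ]′ t))
          ; light = λ F F⊆ → light massed F (λ v → proj₁ ∘ F⊆ v) })
        where
        closed′ : Closed a (D ∖ ⁅ u ⁆) X
        closed′ d w (d∈ , _) e = [ (λ w∈ → inj₁ (w∈ , λ { refl → isolated d (E-sym a e) })) , inj₂ ]′ (closed d w d∈ e)

      -- If a violation `F` created by the contraction contains `v`, then `F` with `u` restored is
      -- rigid behind the same boundary. Otherwise the boundary may gain `u` and reach the size of
      -- `X`, which is too large for a rigid set; but `F` is then massed in the original net, hence
      -- linked by induction, and serves as a core.
      linkedByContraction : ∀ u v → u ∈ D → E a u v → L * # (D ∖ ⁅ u ⁆) < ρ (contract a u v) (D ∖ ⁅ u ⁆) → Linked a D X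
      linkedByContraction u v u∈ uv hv = cases (massedOrViolated b (D ∖ ⁅ u ⁆) X hv)
        where
        b = contract a u v
        v≢u : v ≢ u
        v≢u refl = E-irr a uv
        less : # (D ∖ ⁅ u ⁆) < # D
        less = ≤-reflexive (#-remove D u∈)
        v∈DX : v ∈ (D ∖ ⁅ u ⁆) ∪ X
        v∈DX = [ (λ v∈ → inj₁ (v∈ , v≢u)) , inj₂ ]′ (closed u v u∈ uv)
        closed′ : Closed b (D ∖ ⁅ u ⁆) X
        closed′ d w (d∈ , _) (_ , w≢u , _ , inj₁ e) = [ (λ w∈ → inj₁ (w∈ , w≢u)) , inj₂ ]′ (closed d w d∈ e)
        closed′ d w _ (_ , w≢u , _ , inj₂ (inj₁ (_ , uw))) = [ (λ w∈ → inj₁ (w∈ , w≢u)) , inj₂ ]′ (closed u w u∈ uw)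
        closed′ d w _ (_ , _ , _ , inj₂ (inj₂ (refl , _))) = v∈DX
        restore : (D ∖ ⁅ u ⁆) ∪ ⁅ u ⁆ ⊆ D
        restore w (inj₁ (w∈ , _)) = w∈
        restore w (inj₂ refl) = u∈
        cases : Massed b (D ∖ ⁅ u ⁆) X ⊎ (∃ λ F → Violation b (D ∖ ⁅ u ⁆) X F × Massed b F (∂ b F)) → Linked a D X
        cases (inj₁ massed′) = Linked-mono a ((D ∖ ⁅ u ⁆) ∪ ⁅ u ⁆) D X restore
          (lift-contract a u v (D ∖ ⁅ u ⁆) X uv (D∩X u u∈) v∈DX
            (below b (D ∖ ⁅ u ⁆) X less #X≤p closed′ (λ w q → D∩X w (proj₁ q)) massed′))
        cases (inj₂ (F , (F⊆ , bd , hvF) , massedF)) with v ∈? F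
        ... | yes v∈F = absorb (F ∪ ⁅ u ⁆) (∂ b F) rigid′ (u , inj₂ refl) (<-wellFounded _)
          where
          linkedF = below b F (∂ b F) (≤-<-trans (#-mono F (D ∖ ⁅ u ⁆) F⊆) less) (≤-trans (<⇒≤ bd) #X≤p)
                      (Closed-∂ b F) (λ w w∈ q → proj₁ q w∈) massedF
          u∉∂ : u ∉ ∂ b F
          u∉∂ (_ , _ , _ , _ , u≢u , _) = u≢u refl
          rigid′ : Rigid a D X (F ∪ ⁅ u ⁆) (∂ b F)
          rigid′ = record
            { D₀⊆D = λ { w (inj₁ w∈) → proj₁ (F⊆ w w∈) ; w (inj₂ refl) → u∈ }
            ; Z⊆ = λ w (_ , f , f∈ , e) → [ inj₁ ∘ proj₁ , inj₂ ]′ (closed′ f w (F⊆ f f∈) e)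
            ; disj = λ { w (inj₁ w∈) q → proj₁ q w∈ ; w (inj₂ refl) q → u∉∂ q }
            ; closed = cl
            ; small = bd
            ; linked = lift-contract a u v F (∂ b F) uv u∉∂ (inj₁ v∈F) linkedF
            }
            where
            cl : Closed a (F ∪ ⁅ u ⁆) (∂ b F)
            cl d w (inj₁ d∈) e with w ≟ u
            ... | yes eq = inj₁ (inj₂ eq)
            ... | no w≢u = [ inj₁ ∘ inj₁ , inj₂ ]′ (Closed-∂ b F d w d∈ (proj₂ (F⊆ d d∈) , w≢u , (λ { refl → E-irr a e }) , inj₁ e))
            cl d w (inj₂ refl) e with w ≟ v
            ... | yes refl = inj₁ (inj₁ v∈F)
            ... | no w≢v = [ inj₁ ∘ inj₁ , inj₂ ]′ (Closed-∂ b F v w v∈F (v≢u , (λ { refl → E-irr a e }) , w≢v ∘ sym , inj₂ (inj₁ (refl , e))))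
        ... | no v∉F = linkedFromCore (F ∪ ∂ a F) (∂ a F) sub (λ _ → inj₂) meet guard
                (Linked⇒Linkable a F (∂ a F) p linkedF) (inj₁ (let f , f∈ = heavy⇒nonempty b F hvF in f , inj₁ f∈ , λ q → proj₁ q f∈))
          where
          F⊆D : F ⊆ D
          F⊆D w w∈ = proj₁ (F⊆ w w∈)
          u∉F : u ∉ F
          u∉F u∈F = proj₂ (F⊆ u u∈F) refl
          ∂≤ : # (∂ a F) ≤ # X
          ∂≤ = ≤-trans (#-⊎ (∂ a F) (∂ b F) ⁅ u ⁆ cover)
            (≤-trans (≤-reflexive (trans (cong (# (∂ b F) +_) (#-point u)) (+-comm _ 1))) bd)
            where
            cover : ∀ w → w ∈ ∂ a F → w ∈ ∂ b F ⊎ w ≡ u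
            cover w (w∉ , f , f∈ , e) with w ≟ u
            ... | yes eq = inj₂ eq
            ... | no w≢u = inj₁ (w∉ , f , f∈ , proj₂ (F⊆ f f∈) , w≢u , (λ { refl → w∉ f∈ }) , inj₁ e)
          linkedF = below a F (∂ a F) (≤-<-trans (#-mono F (D ∖ ⁅ u ⁆) F⊆) less) (≤-trans ∂≤ #X≤p) (Closed-∂ a F)
            (λ w w∈ q → proj₁ q w∈) record
              { heavy = <-≤-trans hvF (ρ-contract-≤ a u v F u∉F v∉F)
              ; light = λ F′ F′⊆ lt → light massed F′ (λ w → F⊆D w ∘ F′⊆ w) (<-≤-trans lt ∂≤) }
          sub : F ∪ ∂ a F ⊆ D ∪ X
          sub w (inj₁ w∈) = inj₁ (F⊆D w w∈)
          sub w (inj₂ (_ , f , f∈ , e)) = closed f w (F⊆D f f∈) e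
          meet : ∀ x → x ∈ X → x ∈ F ∪ ∂ a F → x ∈ ∂ a F
          meet x x∈X (inj₁ x∈F) = contradiction x∈X (D∩X x (F⊆D x x∈F))
          meet x x∈X (inj₂ q) = q
          guard : ∀ r w → r ∈ F ∪ ∂ a F → r ∉ ∂ a F → E a r w → w ∈ F ∪ ∂ a F
          guard r w (inj₁ r∈) _ e = Closed-∂ a F r w r∈ e
          guard r w (inj₂ q) r∉ _ = contradiction q r∉

-- Linking inside a dense core

infixl 6 _⊕_
_⊕_ : ∀ {k l m o : ℕ} → k ≤ l → m ≤ o → k + m ≤ l + o
_⊕_ = +-mono-≤

abstract
  -- Fixed multiples of the hypotheses are added, and the terms common to both sides, collected in
  -- `M`, are cancelled.
  common-arith : ∀ sx sy cx cy c co h p l → sx ≤ cx + 6 * p → sy ≤ cy + 6 * p → cx + cy ≤ c + co → 2 * c ≤ h →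
    h ≤ 2 * sx + (2 + 2 * p) → l < sy + 1 + p → 21 * p + 3 ≤ l → 2 * (6 * p) < 2 * co
  common-arith sx sy cx cy c co h p l h₁ h₂ h₃ h₄ h₅ h₆ h₇ = +-cancelˡ-≤ M _ _ (begin
    M + suc (2 * (6 * p)) ≤⟨ m≤m+n _ (2 * p + 3) ⟩
    M + suc (2 * (6 * p)) + (2 * p + 3) ≡⟨ lhs sx sy cx cy c h p l ⟩
    2 * sx + 2 * sy + 2 * (cx + cy) + 2 * c + h + 2 * suc l + 2 * (21 * p + 3)
      ≤⟨ *-monoʳ-≤ 2 h₁ ⊕ *-monoʳ-≤ 2 h₂ ⊕ *-monoʳ-≤ 2 h₃ ⊕ h₄ ⊕ h₅ ⊕ *-monoʳ-≤ 2 h₆ ⊕ *-monoʳ-≤ 2 h₇ ⟩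
    2 * (cx + 6 * p) + 2 * (cy + 6 * p) + 2 * (c + co) + h + (2 * sx + (2 + 2 * p)) + 2 * (sy + 1 + p) + 2 * l
      ≡⟨ rhs sx sy cx cy c co h p l ⟩
    M + 2 * co ∎)
    where
    open ≤-Reasoning
    M : ℕ
    M = 2 * sx + 2 * sy + 2 * (cx + cy) + 2 * c + h + 2 * l + 28 * p + 4
    lhs : ∀ sx sy cx cy c h p l → 2 * sx + 2 * sy + 2 * (cx + cy) + 2 * c + h + 2 * l + 28 * p + 4 + suc (2 * (6 * p)) + (2 * p + 3)
      ≡ 2 * sx + 2 * sy + 2 * (cx + cy) + 2 * c + h + 2 * suc l + 2 * (21 * p + 3)
    lhs = solve-∀
    rhs : ∀ sx sy cx cy c co h p l → 2 * (cx + 6 * p) + 2 * (cy + 6 * p) + 2 * (c + co) + h + (2 * sx + (2 + 2 * p)) + 2 * (sy + 1 + p) + 2 * l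
      ≡ 2 * sx + 2 * sy + 2 * (cx + cy) + 2 * c + h + 2 * l + 28 * p + 4 + 2 * co
    rhs = solve-∀

  -- The origin of 21p + 3. Of three disjoint sets in a set of size h, each a neighbourhood reduced
  -- by at most 6p, the first two come from neighbourhoods of total size at least h - 2 - 2p. The
  -- third neighbourhood then has at most 20p + 2 vertices, while it must have at least l - p.
  spread-arith : ∀ sx sy sf A B C h p l → sx ≤ A + 6 * p → sy ≤ B + 6 * p → sf ≤ C + 6 * p → A + B + C ≤ h →
    h ≤ 2 * sx + (2 + 2 * p) → h ≤ 2 * sy + (2 + 2 * p) → l < sf + 1 + p → 21 * p + 3 ≤ l → 0 < 0
  spread-arith sx sy sf A B C h p l h₁ h₂ h₃ h₄ h₅ h₆ h₇ h₈ = +-cancelˡ-≤ M _ _ (begin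
    M + 1 ≤⟨ m≤m+n _ 1 ⟩
    M + 1 + 1 ≡⟨ lhs sx sy sf A B C h p l ⟩
    2 * sx + 2 * sy + 2 * sf + 2 * (A + B + C) + h + h + 2 * suc l + 2 * (21 * p + 3)
      ≤⟨ *-monoʳ-≤ 2 h₁ ⊕ *-monoʳ-≤ 2 h₂ ⊕ *-monoʳ-≤ 2 h₃ ⊕ *-monoʳ-≤ 2 h₄ ⊕ h₅ ⊕ h₆ ⊕ *-monoʳ-≤ 2 h₇ ⊕ *-monoʳ-≤ 2 h₈ ⟩
    2 * (A + 6 * p) + 2 * (B + 6 * p) + 2 * (C + 6 * p) + 2 * h + (2 * sx + (2 + 2 * p)) + (2 * sy + (2 + 2 * p)) + 2 * (sf + 1 + p) + 2 * l
      ≡⟨ rhs sx sy sf A B C h p l ⟩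
    M + 0 ∎)
    where
    open ≤-Reasoning
    M : ℕ
    M = 2 * sx + 2 * sy + 2 * sf + 2 * (A + B + C) + h + h + 2 * l + 42 * p + 6
    lhs : ∀ sx sy sf A B C h p l → 2 * sx + 2 * sy + 2 * sf + 2 * (A + B + C) + h + h + 2 * l + 42 * p + 6 + 1 + 1
      ≡ 2 * sx + 2 * sy + 2 * sf + 2 * (A + B + C) + h + h + 2 * suc l + 2 * (21 * p + 3)
    lhs = solve-∀
    rhs : ∀ sx sy sf A B C h p l → 2 * (A + 6 * p) + 2 * (B + 6 * p) + 2 * (C + 6 * p) + 2 * h + (2 * sx + (2 + 2 * p)) + (2 * sy + (2 + 2 * p)) + 2 * (sf + 1 + p) + 2 * l
      ≡ 2 * sx + 2 * sy + 2 * sf + 2 * (A + B + C) + h + h + 2 * l + 42 * p + 6 + 0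
    rhs = solve-∀

  large-arith : ∀ s p l → l < s + 1 + p → 21 * p + 3 ≤ l → p < s
  large-arith s p l h₁ h₂ = +-cancelˡ-≤ (1 + p) _ _ (begin
    1 + p + suc p ≤⟨ m≤m+n _ (19 * p + 2) ⟩
    1 + p + suc p + (19 * p + 2) ≡⟨ lhs p ⟩
    suc (21 * p + 3) ≤⟨ s≤s h₂ ⟩
    suc l ≤⟨ h₁ ⟩
    s + 1 + p ≡⟨ rhs s p ⟩
    1 + p + s ∎)
    where
    open ≤-Reasoning
    lhs : ∀ p → 1 + p + suc p + (19 * p + 2) ≡ suc (21 * p + 3)
    lhs = solve-∀
    rhs : ∀ s p → s + 1 + p ≡ 1 + p + s
    rhs = solve-∀

module _ {n : ℕ} where
  private
    V = Fin n

  Trail : Net n → V → List V → V → Set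
  Trail a x [] y = x ≡ y
  Trail a x (w ∷ ws) y = E a x w × Trail a w ws y

  Trail-++ : ∀ a {x y z} ws ws′ → Trail a x ws y → Trail a y ws′ z → Trail a x (ws ++ ws′) z
  Trail-++ a [] ws′ refl t′ = t′
  Trail-++ a (w ∷ ws) ws′ (e , t) t′ = e , Trail-++ a ws ws′ t t′

  Within : VSet n → VSet n → List V → Set
  Within R U ws = ∀ w → w ∈ₗ ws → w ∈ R × w ∉ U

  ShortTrail : Net n → VSet n → VSet n → ℕ → V → V → Set
  ShortTrail a R U k x y = ∃ λ ws → length ws ≤ k × Within R U ws × Trail a x ws y

  ShortTrail-++ : ∀ a R U {k l x y z} → ShortTrail a R U k x y → ShortTrail a R U l y z → ShortTrail a R U (k + l) x z
  ShortTrail-++ a R U (ws , l₁ , w₁ , t₁) (ws′ , l₂ , w₂ , t₂) = ws ++ ws′ ,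
    ≤-trans (≤-reflexive (length-++ ws)) (+-mono-≤ l₁ l₂) ,
    (λ w w∈ → [ w₁ w , w₂ w ]′ (∈-++⁻ ws w∈)) , Trail-++ a ws ws′ t₁ t₂

  Robust : Net n → VSet n → ℕ → Set₁
  Robust a R K = ∀ U → # U ≤ K → ∀ x y → x ∈ R → y ∈ R → x ∉ U → y ∉ U → ShortTrail a R U 5 x y

  -- Each root is joined to a root of the same colour treated before, by a trail avoiding everything
  -- used so far: p roots and at most p trails of five vertices account for 6p. `U` contains all
  -- roots from the beginning, so no trail runs through a root whose turn comes later.
  robust⇒linkable : ∀ a R p → Robust a R (6 * p) → Linkable a R R p
  robust⇒linkable a R p robust ys len≤ ys⊆R c₀ = let c , U , ys⊆U , _ , agree , conn = go ys (λ _ → id) len≤ in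
      c , agree , λ y y′ y∈ y′∈ eq → mapStar proj₁ (conn y y′ y∈ y′∈ eq)
    where
    StepIn : (V → ℕ) → VSet n → V → V → Set
    StepIn c U x y = Step a R c x y × x ∈ U × y ∈ U
    go : ∀ zs → (∀ z → z ∈ₗ zs → z ∈ₗ ys) → length zs ≤ p → ∃ λ c → ∃ λ U →
      (∀ y → y ∈ₗ ys → y ∈ U) × # U ≤ p + 5 * length zs × (∀ y → y ∈ₗ ys → c y ≡ c₀ y) ×
      (∀ z z′ → z ∈ₗ zs → z′ ∈ₗ zs → c₀ z ≡ c₀ z′ → Star (StepIn c U) z z′)
    go [] _ _ = c₀ , listSet ys , (λ _ → id) , ≤-trans (#-listSet ys) (≤-trans len≤ (m≤m+n p 0)) , (λ _ _ → refl) , λ _ _ ()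
    go (y ∷ zs) zs⊆ len with go zs (λ z → zs⊆ z ∘ there) (≤-trans (n≤1+n _) len)
    ... | c , U , ys⊆U , #U , agree , conn with Any.any? (λ z → c₀ z ℕ.≟ c₀ y) zs
    ... | no none = c , U , ys⊆U , ≤-trans #U (+-monoʳ-≤ p (*-monoʳ-≤ 5 (n≤1+n (length zs)))) , agree , λ where
          z z′ (here refl) (here refl) eq → ε
          z z′ (here refl) (there z′∈) eq → contradiction (lose z′∈ (sym eq)) none
          z z′ (there z∈) (here refl) eq → contradiction (lose z∈ eq) none
          z z′ (there z∈) (there z′∈) eq → conn z z′ z∈ z′∈ eq
    ... | yes some with find some
    -- The ends `y` and `z` already belong to `U`, so they alone are taken out of the set to be
    -- avoided.
    ... | z , z∈ , cz with robust (U ∖ (⁅ y ⁆ ∪ ⁅ z ⁆))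
                  (≤-trans (#-mono (U ∖ (⁅ y ⁆ ∪ ⁅ z ⁆)) U λ _ → proj₁) (≤-trans #U (+-monoʳ-≤ p (*-monoʳ-≤ 5 (≤-trans (n≤1+n _) len)))))
                  y z (ys⊆R y (zs⊆ y (here refl))) (ys⊆R z (zs⊆ z (there z∈))) (λ q → proj₂ q (inj₁ refl)) (λ q → proj₂ q (inj₂ refl))
    ... | ws , len5 , within , trail = c′ , U ∪ listSet ws , (λ v v∈ → inj₁ (ys⊆U v v∈)) , size , agree′ , conn′
      where
      c′ : V → ℕ
      c′ v with (v ∈ₗ? ws) ×-dec ¬? (v ∈? U)
      ... | yes _ = c₀ y
      ... | no _  = c v
      c′-old : ∀ {v} → v ∈ U → c′ v ≡ c v
      c′-old {v} v∈ with (v ∈ₗ? ws) ×-dec ¬? (v ∈? U)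
      ... | yes (_ , v∉) = contradiction v∈ v∉
      ... | no _ = refl
      agree′ : ∀ v → v ∈ₗ ys → c′ v ≡ c₀ v
      agree′ v v∈ = trans (c′-old (ys⊆U v v∈)) (agree v v∈)
      c′-y : c′ y ≡ c₀ y
      c′-y = agree′ y (zs⊆ y (here refl))
      c′-z : c′ z ≡ c₀ y
      c′-z = trans (agree′ z (zs⊆ z (there z∈))) cz
      c′-fresh : ∀ {v} → v ∈ₗ ws → v ∉ U → c′ v ≡ c₀ y
      c′-fresh {v} v∈ v∉ with (v ∈ₗ? ws) ×-dec ¬? (v ∈? U)
      ... | yes _ = refl
      ... | no ¬p = contradiction (v∈ , v∉) ¬p
      c′-new : ∀ {v} → v ∈ₗ ws → c′ v ≡ c₀ y
      c′-new {v} v∈ = case v ∈? U of λ where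
        (no v∉) → c′-fresh v∈ v∉
        (yes v∈U) → case (v ≟ y) ⊎-dec (v ≟ z) of λ where
          (yes (inj₁ refl)) → c′-y
          (yes (inj₂ refl)) → c′-z
          (no ne) → contradiction (v∈U , ne) (proj₂ (within v v∈))
      size : # (U ∪ listSet ws) ≤ p + 5 * suc (length zs)
      size = ≤-trans (#-⊎ (U ∪ listSet ws) U (listSet ws) λ _ → id)
        (≤-trans (+-mono-≤ #U (≤-trans (#-listSet ws) len5)) (≤-reflexive (arith p (length zs))))
        where
        arith : ∀ p k → p + 5 * k + 5 ≡ p + 5 * suc k
        arith = solve-∀
      U′ = U ∪ listSet ws
      follow : ∀ {x} vs → (∀ v → v ∈ₗ vs → v ∈ₗ ws) → x ∈ R → x ∈ U′ → c′ x ≡ c₀ y → Trail a x vs z → Star (StepIn c′ U′) x z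
      follow [] _ _ _ _ refl = ε
      follow (v ∷ vs) sub x∈R x∈U cx (e , t) =
        ((e , x∈R , v∈R , trans cx (sym cv)) , x∈U , inj₂ v∈ws) ◅ follow vs (λ w → sub w ∘ there) v∈R (inj₂ v∈ws) cv t
        where
        v∈ws = sub v (here refl)
        v∈R = proj₁ (within v v∈ws)
        cv = c′-new v∈ws
      y⇝z : Star (StepIn c′ U′) y z
      y⇝z = follow ws (λ _ → id) (ys⊆R y (zs⊆ y (here refl))) (inj₁ (ys⊆U y (zs⊆ y (here refl)))) c′-y trail
      old : ∀ {u v} → Star (StepIn c U) u v → Star (StepIn c′ U′) u v
      old = mapStar λ ((e , p , q , eq) , u∈ , v∈) → (e , p , q , trans (c′-old u∈) (trans eq (sym (c′-old v∈)))) , inj₁ u∈ , inj₁ v∈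
      StepIn-sym : ∀ {u v} → StepIn c′ U′ u v → StepIn c′ U′ v u
      StepIn-sym (s , p , q) = Step-sym a R c′ s , q , p
      conn′ : ∀ u v → u ∈ₗ y ∷ zs → v ∈ₗ y ∷ zs → c₀ u ≡ c₀ v → Star (StepIn c′ U′) u v
      conn′ u v (here refl) (here refl) eq = ε
      conn′ u v (here refl) (there v∈) eq = y⇝z ◅◅ old (conn z v z∈ v∈ (trans cz eq))
      conn′ u v (there u∈) (here refl) eq = old (conn u z u∈ z∈ (trans eq (sym cz))) ◅◅ reverse StepIn-sym y⇝z
      conn′ u v (there u∈) (there v∈) eq = old (conn u v u∈ v∈ eq)

  #-incl-excl : (S A B : VSet n) → # (S ∩ A) + # (S ∩ B) ≤ # S + # (S ∩ A ∩ B)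
  #-incl-excl S A B = begin
    # (S ∩ A) + # (S ∩ B)
      ≤⟨ +-monoˡ-≤ _ (#-⊎ (S ∩ A) (S ∩ A ∩ B) (S ∩ A ∖ B) λ v v∈ → case v ∈? B of λ where
           (yes b) → inj₁ (v∈ , b)
           (no ¬b) → inj₂ (v∈ , ¬b)) ⟩
    # (S ∩ A ∩ B) + # (S ∩ A ∖ B) + # (S ∩ B)
      ≡⟨ regroup (# (S ∩ A ∩ B)) _ _ ⟩
    # (S ∩ A ∖ B) + # (S ∩ B) + # (S ∩ A ∩ B)
      ≤⟨ +-monoˡ-≤ _ (#-disjoint (S ∩ A ∖ B) (S ∩ B) S (λ v q → proj₁ (proj₁ q)) (λ v → proj₁) λ v q r → proj₂ q (proj₂ r)) ⟩
    # S + # (S ∩ A ∩ B) ∎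
    where
    open ≤-Reasoning
    regroup : ∀ x y z → x + y + z ≡ y + z + x
    regroup = solve-∀

  -- Neighbourhoods in H have about half the size of H.  So among three vertices two have many common
  -- neighbours, and any two vertices have distance at most 5 unless few vertices U separate H; then the
  -- smaller side is nearly complete.
  module Core (a : Net n) (H : VSet n) (p λ′ : ℕ) (λ-big : 21 * p + 3 ≤ λ′)
    (wide : ∀ w → w ∈ H → # H ≤ 2 * # (H ∩ nbr a w) + (2 + 2 * p))
    (deep : ∀ w → w ∈ H → λ′ < # (H ∩ nbr a w) + 1 + p) where

    K = 6 * p

    record CutBy (U C : VSet n) : Set where
      field
        C⊆H   : C ⊆ H
        C∩U   : ∀ v → v ∈ C → v ∉ U
        occupied  : ∃ λ c → c ∈ C
        remainder : ∃ λ d → d ∈ H × d ∉ U × d ∉ C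
        shut  : ∀ x y → x ∈ C → y ∈ H → y ∉ U → E a x y → y ∈ C

    cutBy? : ∀ U C → Dec (CutBy U C)
    cutBy? U C = map′ (λ (p , q , r , s , t) → record { C⊆H = p ; C∩U = q ; occupied = r ; remainder = s ; shut = t })
      (λ q → let open CutBy q in C⊆H , C∩U , occupied , remainder , shut)
      (⊆? C H ×-dec (all? λ v → (v ∈? C) →-dec ¬? (v ∈? U)) ×-dec (any? λ c → c ∈? C) ×-dec
       (any? λ d → (d ∈? H) ×-dec ¬? (d ∈? U) ×-dec ¬? (d ∈? C)) ×-dec
       (all? λ x → all? λ y → (x ∈? C) →-dec ((y ∈? H) →-dec (¬? (y ∈? U) →-dec (E? a x y →-dec (y ∈? C))))))

    CutBy-ext : ∀ {U U′ C C′} → U ⊆ U′ → U′ ⊆ U → C ⊆ C′ → C′ ⊆ C → CutBy U C → CutBy U′ C′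
    CutBy-ext uu′ u′u cc′ c′c q = record
      { C⊆H = λ v → C⊆H v ∘ c′c v
      ; C∩U = λ v v∈ v∈U → C∩U v (c′c v v∈) (u′u v v∈U)
      ; occupied = let c , c∈ = occupied in c , cc′ c c∈
      ; remainder = let d , d∈ , d∉U , d∉C = remainder in d , d∈ , d∉U ∘ u′u d , d∉C ∘ c′c d
      ; shut = λ x y x∈ y∈ y∉ e → cc′ y (shut x y (c′c x x∈) y∈ (y∉ ∘ uu′ y) e)
      }
      where open CutBy q

    Cut : VSet n → Set₁
    Cut U = # U ≤ K × ∃ λ C → CutBy U C

    cut? : Dec (∃ Cut)
    cut? = anySet? Cut
      (λ U → (# U ≤? K) ×-dec anySet? (CutBy U) (cutBy? U) (λ C C′ → CutBy-ext (λ _ → id) (λ _ → id)))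
      (λ U U′ f g (le , C , q) → ≤-trans (#-mono U′ U g) le , C , CutBy-ext f g (λ _ → id) (λ _ → id) q)

    module SmallSide (U C : VSet n) (#U : # U ≤ K) (cut : CutBy U C) (half : 2 * # C ≤ # H) where
      open CutBy cut

      inside-deg : ∀ x → x ∈ C → # (H ∩ nbr a x) ≤ # (C ∩ nbr a x) + K
      inside-deg x x∈ = ≤-trans (#-⊎ (H ∩ nbr a x) (C ∩ nbr a x) U cover) (+-monoʳ-≤ _ #U)
        where
        cover : ∀ v → v ∈ H ∩ nbr a x → v ∈ C ∩ nbr a x ⊎ v ∈ U
        cover v (v∈ , e) with v ∈? U
        ... | yes v∈U = inj₂ v∈U
        ... | no v∉ = inj₁ (shut x v x∈ v∈ v∉ e , e)

      -- `x` is adjacent to nearly all of `C`, since `C` has at most half of the vertices of `H` and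
      -- few neighbours of `x` lie outside `C`. So most of the at least `λ′` - p neighbours of `y`
      -- are common ones.
      common : ∀ x y → x ∈ C → y ∈ C → K < # (C ∩ nbr a x ∩ nbr a y)
      common x y x∈ y∈ = *-cancelˡ-< 2 K (# (C ∩ nbr a x ∩ nbr a y)) (common-arith (# (H ∩ nbr a x)) (# (H ∩ nbr a y)) (# (C ∩ nbr a x)) (# (C ∩ nbr a y)) (# C) (# (C ∩ nbr a x ∩ nbr a y)) (# H) p λ′ (inside-deg x x∈) (inside-deg y y∈) (#-incl-excl C (nbr a x) (nbr a y))
          half (wide x (C⊆H x x∈)) (deep y (C⊆H y y∈)) λ-big)

      robust : Robust a C K
      robust W #W x y x∈ y∈ x∉ y∉ = let w , ((w∈ , xw) , yw) , w∉ = #-diff (C ∩ nbr a x ∩ nbr a y) W (≤-<-trans #W (common x y x∈ y∈)) in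
        w ∷ y ∷ [] , s≤s (s≤s z≤n) ,
        (λ { _ (here refl) → w∈ , w∉ ; _ (there (here refl)) → y∈ , y∉ }) , xw , E-sym a yw , refl

      large : p < # C
      large = let c , c∈ = occupied in <-≤-trans (≤-<-trans (m≤m+n p (5 * p)) (common c c c∈ c∈))
        (#-mono (C ∩ nbr a c ∩ nbr a c) C λ _ → proj₁ ∘ proj₁)

    Ball : VSet n → V → VSet n
    Ball U x = mkSet
      (λ v → (v ∈ H × v ∉ U) × (v ≡ x ⊎ E a x v ⊎ ∃ λ w → (w ∈ H × w ∉ U) × E a x w × E a w v))
      (λ v → ((v ∈? H) ×-dec ¬? (v ∈? U)) ×-dec ((v ≟ x) ⊎-dec (E? a x v ⊎-dec
        any? λ w → ((w ∈? H) ×-dec ¬? (w ∈? U)) ×-dec (E? a x w ×-dec E? a w v))))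

    from-centre : ∀ U {x v} → v ∈ Ball U x → ShortTrail a H U 2 x v
    from-centre U (_ , inj₁ refl) = [] , z≤n , (λ _ ()) , refl
    from-centre U {v = v} (ok , inj₂ (inj₁ e)) = v ∷ [] , s≤s z≤n , (λ { _ (here refl) → ok }) , e , refl
    from-centre U {v = v} (ok , inj₂ (inj₂ (w , ok′ , e , e′))) = w ∷ v ∷ [] , ≤-refl ,
      (λ { _ (here refl) → ok′ ; _ (there (here refl)) → ok }) , e , e′ , refl

    to-centre : ∀ U {y v} → y ∈ H → y ∉ U → v ∈ Ball U y → ShortTrail a H U 2 v y
    to-centre U y∈ y∉ (_ , inj₁ refl) = [] , z≤n , (λ _ ()) , refl
    to-centre U {y} y∈ y∉ (_ , inj₂ (inj₁ e)) = y ∷ [] , s≤s z≤n , (λ { _ (here refl) → y∈ , y∉ }) , E-sym a e , refl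
    to-centre U {y} y∈ y∉ (_ , inj₂ (inj₂ (w , ok′ , e , e′))) = w ∷ y ∷ [] , ≤-refl ,
      (λ { _ (here refl) → ok′ ; _ (there (here refl)) → y∈ , y∉ }) , E-sym a e′ , E-sym a e , refl

    -- Pairwise distances above two would make the three neighbourhoods outside `U` disjoint, and
    -- `H` has no room for them.
    spread : ∀ U → # U ≤ K → ∀ x y f → x ∈ H → y ∈ H → f ∈ H → f ∉ U → y ∉ U →
      y ∉ Ball U x → f ∉ Ball U x → f ∉ Ball U y → ⊥
    spread U #U x y f x∈ y∈ f∈ f∉U y∉U yx fx fy =
      n≮n 0 (spread-arith (# (H ∩ nbr a x)) (# (H ∩ nbr a y)) (# (H ∩ nbr a f)) (# (N x)) (# (N y)) (# (N f)) (# H) p λ′ (part x) (part y) (part f) three (wide x x∈) (wide y y∈) (deep f f∈) λ-big)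
      where
      N : V → VSet n
      N v = H ∩ nbr a v ∖ U
      part : ∀ v → # (H ∩ nbr a v) ≤ # (N v) + 6 * p
      part v = ≤-trans (#-⊎ (H ∩ nbr a v) (N v) U λ w w∈ → case w ∈? U of λ where
        (yes u) → inj₂ u
        (no ¬u) → inj₁ (w∈ , ¬u)) (+-monoʳ-≤ _ #U)
      three : # (N x) + # (N y) + # (N f) ≤ # H
      three = ≤-trans (+-monoˡ-≤ _ (#-disjoint (N x) (N y) (N x ∪ N y) (λ _ → inj₁) (λ _ → inj₂)
                λ w ((w∈ , xw) , w∉) ((_ , yw) , _) → yx ((y∈ , y∉U) , inj₂ (inj₂ (w , (w∈ , w∉) , xw , E-sym a yw)))))
        (#-disjoint (N x ∪ N y) (N f) H (λ { w (inj₁ q) → proj₁ (proj₁ q) ; w (inj₂ q) → proj₁ (proj₁ q) }) (λ w q → proj₁ (proj₁ q)) λ where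
          w (inj₁ ((w∈ , xw) , w∉)) ((_ , fw) , _) → fx ((f∈ , f∉U) , inj₂ (inj₂ (w , (w∈ , w∉) , xw , E-sym a fw)))
          w (inj₂ ((w∈ , yw) , w∉)) ((_ , fw) , _) → fy ((f∈ , f∉U) , inj₂ (inj₂ (w , (w∈ , w∉) , yw , E-sym a fw))))
    -- If no edge leaves the ball of radius two about `x`, this ball is a side of a cut. Otherwise
    -- an edge from `e` to `f` leaves it; since `f` and `y` are both far from `x`, they are close to
    -- each other, and the route has length at most 2 + 1 + 2 = 5.
    uncut⇒robust : ¬ ∃ Cut → Robust a H K
    uncut⇒robust uncut U #U x y x∈ y∈ x∉ y∉ with y ∈? Ball U x
    ... | yes y∈B = let ws , l , w , t = from-centre U y∈B in ws , ≤-trans l (s≤s (s≤s z≤n)) , w , t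
    ... | no y∉B with any? (λ e → any? λ f → (e ∈? Ball U x) ×-dec (f ∈? H) ×-dec ¬? (f ∈? U) ×-dec ¬? (f ∈? Ball U x) ×-dec E? a e f)
    ... | no none = contradiction (U , #U , Ball U x , record
            { C⊆H = λ v q → proj₁ (proj₁ q)
            ; C∩U = λ v q → proj₂ (proj₁ q)
            ; occupied = x , (x∈ , x∉) , inj₁ refl
            ; remainder = y , y∈ , y∉ , y∉B
            ; shut = λ e f e∈ f∈ f∉ ef → shut e f e∈ f∈ f∉ ef }) uncut
      where
      shut : ∀ e f → e ∈ Ball U x → f ∈ H → f ∉ U → E a e f → f ∈ Ball U x
      shut e f e∈ f∈ f∉ ef with f ∈? Ball U x
      ... | yes q = q
      ... | no ¬q = contradiction (e , f , e∈ , f∈ , f∉ , ¬q , ef) none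
    ... | yes (e , f , e∈ , f∈ , f∉ , f∉B , ef) with f ∈? Ball U y
    ... | no f∉B′ = ⊥-elim (spread U #U x y f x∈ y∈ f∈ f∉ y∉ y∉B f∉B f∉B′)
    ... | yes f∈B′ = ShortTrail-++ a H U (from-centre U e∈)
            (ShortTrail-++ a H U {1} (f ∷ [] , ≤-refl , (λ { _ (here refl) → f∈ , f∉ }) , ef , refl) (to-centre U y∈ y∉ f∈B′))

    RobustPart : Set₁
    RobustPart = ∃ λ R → R ⊆ H × Robust a R K × p < # R

    core-uncut : (∃ λ w → w ∈ H) → ¬ ∃ Cut → RobustPart
    core-uncut (w , w∈) uncut = H , (λ _ → id) , uncut⇒robust uncut ,
      ≤-trans (large-arith (# (H ∩ nbr a w)) p λ′ (deep w w∈) λ-big) (#-mono (H ∩ nbr a w) H λ _ → proj₁)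

    core-cut : ∃ Cut → RobustPart
    core-cut (U , #U , C , cut) = [ left , right ]′ (≤-<-connex (2 * # C) (# H))
      where
      open CutBy cut
      left : 2 * # C ≤ # H → RobustPart
      left half = C , CutBy.C⊆H cut , SmallSide.robust U C #U cut half , SmallSide.large U C #U cut half
      C′ = H ∖ U ∖ C
      cut′ : CutBy U C′
      cut′ = record
        { C⊆H = λ v q → proj₁ (proj₁ q)
        ; C∩U = λ v q → proj₂ (proj₁ q)
        ; occupied = let d , d∈ , d∉ , d∉C = remainder in d , (d∈ , d∉) , d∉C
        ; remainder = let c , c∈ = occupied in c , C⊆H c c∈ , C∩U c c∈ , λ q → proj₂ q c∈
        ; shut = λ x y ((x∈ , x∉) , x∉C) y∈ y∉ e → (y∈ , y∉) , λ y∈C → x∉C (shut y x y∈C x∈ x∉ (E-sym a e))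
        }
      both : # C + # C′ ≤ # H
      both = #-disjoint C C′ H C⊆H (λ v q → proj₁ (proj₁ q)) (λ v c q → proj₂ q c)
      half′ : # H < 2 * # C → 2 * # C′ ≤ # H
      half′ ¬half = +-cancelˡ-≤ (# H) _ _ (begin
        # H + 2 * # C′ ≤⟨ +-monoˡ-≤ _ (<⇒≤ ¬half) ⟩
        2 * # C + 2 * # C′ ≡⟨ sym (*-distribˡ-+ 2 (# C) (# C′)) ⟩
        2 * (# C + # C′) ≤⟨ *-monoʳ-≤ 2 both ⟩
        2 * # H ≡⟨ cong (# H +_) (+-identityʳ (# H)) ⟩
        # H + # H ∎)
        where open ≤-Reasoning
      right : # H < 2 * # C → RobustPart
      right ¬half = C′ , (λ v q → proj₁ (proj₁ q)) , SmallSide.robust U C′ #U cut′ (half′ ¬half) , SmallSide.large U C′ #U cut′ (half′ ¬half)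

    core : (∃ λ w → w ∈ H) → RobustPart
    core ne = decide cut?
      where
      decide : Dec (∃ Cut) → RobustPart
      decide (yes c) = core-cut c
      decide (no uncut) = core-uncut ne uncut

-- Massed sets are linked

abstract
  -- The contraction used up the density surplus, so more than 2l ordered pairs were lost, whereas
  -- at most 2(1 + cd + p) can be.
  deep-arith : ∀ l N r r′ cd x p → 2 * l * suc N < r → r ≤ r′ + 2 * (1 + cd + x) → r′ ≤ 2 * l * N → x ≤ p → l < cd + 1 + p
  deep-arith l N r r′ cd x p h₁ h₂ h₃ h₄ = *-cancelˡ-< 2 l (cd + 1 + p) (+-cancelˡ-< (2 * l * N) _ _ (begin-strict
    2 * l * N + 2 * l               ≡⟨ lhs l N ⟩
    2 * l * suc N                   <⟨ h₁ ⟩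
    r                               ≤⟨ h₂ ⟩
    r′ + 2 * (1 + cd + x)           ≤⟨ +-mono-≤ h₃ (*-monoʳ-≤ 2 (+-monoʳ-≤ (1 + cd) h₄)) ⟩
    2 * l * N + 2 * (1 + cd + p)    ≡⟨ cong (λ k → 2 * l * N + 2 * (k + p)) (+-comm 1 cd) ⟩
    2 * l * N + 2 * (cd + 1 + p)    ∎))
    where
    open ≤-Reasoning
    lhs : ∀ l N → 2 * l * N + 2 * l ≡ 2 * l * suc N
    lhs = solve-∀

  -- Since l < cd + 1 + p, the failed contraction bounds the whole count r by 2(cd + 1 + p)(N + 1).
  -- A degree d not above the average r / (N + 1) is then at most 2(cd + 1 + p).
  wide-arith : ∀ l N r r′ cd x p d → r ≤ r′ + 2 * (1 + cd + x) → r′ ≤ 2 * l * N → x ≤ p → l < cd + 1 + p →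
    d * suc N ≤ r → d ≤ 2 * cd + (2 + 2 * p)
  wide-arith l N r r′ cd x p d h₂ h₃ h₄ h₅ h₆ = ≮⇒≥ λ lt → n≮n r (begin-strict
    r                                            ≤⟨ h₂ ⟩
    r′ + 2 * (1 + cd + x)                        ≤⟨ +-mono-≤ h₃ (*-monoʳ-≤ 2 (+-monoʳ-≤ (1 + cd) h₄)) ⟩
    2 * l * N + 2 * (1 + cd + p)                 ≤⟨ +-monoˡ-≤ _ (*-monoˡ-≤ N (*-monoʳ-≤ 2 (<⇒≤ h₅))) ⟩
    2 * (cd + 1 + p) * N + 2 * (1 + cd + p)      ≡⟨ eq cd p N ⟩
    (2 * cd + (2 + 2 * p)) * suc N               <⟨ *-monoˡ-< (suc N) lt ⟩
    d * suc N                                    ≤⟨ h₆ ⟩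
    r                                            ∎)
    where
    open ≤-Reasoning
    eq : ∀ cd p N → 2 * (cd + 1 + p) * N + 2 * (1 + cd + p) ≡ (2 * cd + (2 + 2 * p)) * suc N
    eq = solve-∀

module _ {n : ℕ} where
  private
    V = Fin n

  degree-sum : ∀ a (D : VSet n) → sum (λ v → ι (v ∈? D) * # (nbr a v)) ≤ ρ a D
  degree-sum a D = sum-mono row
    where
    row : ∀ v → ι (v ∈? D) * # (nbr a v) ≤ sum (λ y → ι (touch? a D v y))
    row v with v ∈? D
    ... | no _ = z≤n
    ... | yes v∈ = ≤-trans (≤-reflexive (+-identityʳ _)) (sum-mono λ y → ι-mono (E? a v y) (E? a v y ×-dec (yes v∈ ⊎-dec (y ∈? D))) λ e → e , inj₁ v∈)

  lowDegree : ∀ a (D : VSet n) → (∃ λ v → v ∈ D) → ∃ λ v → v ∈ D × # (nbr a v) * # D ≤ ρ a D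
  lowDegree a D (d , d∈) = search (any? λ v → (v ∈? D) ×-dec (# (nbr a v) * # D ≤? ρ a D))
    where
    open ≤-Reasoning
    search : Dec (∃ λ v → v ∈ D × # (nbr a v) * # D ≤ ρ a D) → ∃ λ v → v ∈ D × # (nbr a v) * # D ≤ ρ a D
    search (yes q) = q
    search (no none) = contradiction total (<⇒≱ (begin-strict
        # D * ρ a D <⟨ m<n+m (# D * ρ a D) nonempty ⟩
        # D + # D * ρ a D ≡⟨ sym (*-suc (# D) (ρ a D)) ⟩
        # D * suc (ρ a D) ∎))
      where
      nonempty : 0 < # D
      nonempty = ≤-<-trans z≤n (#-strict (D ∖ D) D (λ _ → proj₁) d∈ (λ q → proj₂ q d∈))
      term : ∀ v → suc (ρ a D) * ι (v ∈? D) ≤ # D * (ι (v ∈? D) * # (nbr a v))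
      term v with v ∈? D
      ... | no _ = ≤-trans (≤-reflexive (*-zeroʳ (suc (ρ a D)))) z≤n
      ... | yes v∈ = ≤-trans (≤-reflexive (*-identityʳ _)) (≤-trans (≰⇒> λ le → none (v , v∈ , le))
              (≤-reflexive (trans (*-comm (# (nbr a v)) (# D)) (cong (# D *_) (sym (+-identityʳ _))))))
      total : # D * suc (ρ a D) ≤ # D * ρ a D
      total = begin
        # D * suc (ρ a D)                                       ≡⟨ *-comm (# D) (suc (ρ a D)) ⟩
        suc (ρ a D) * # D                                       ≡⟨ sym (sum-*ˡ (suc (ρ a D)) (λ v → ι (v ∈? D))) ⟩
        sum (λ v → suc (ρ a D) * ι (v ∈? D))                    ≤⟨ sum-mono term ⟩
        sum (λ v → # D * (ι (v ∈? D) * # (nbr a v)))            ≡⟨ sum-*ˡ (# D) (λ v → ι (v ∈? D) * # (nbr a v)) ⟩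
        # D * sum (λ v → ι (v ∈? D) * # (nbr a v))              ≤⟨ *-monoʳ-≤ (# D) (degree-sum a D) ⟩
        # D * ρ a D                                             ∎

  module _ (p l : ℕ) (l-big : 21 * p + 3 ≤ l) where
    open MassBound {n} (2 * l)

    linkedStep : ∀ a D X → # X ≤ p → Closed a D X → (∀ v → v ∈ D → v ∉ X) → Massed a D X →
      LinkedBelow p (# D) → Linked a D X
    linkedStep a D X #X≤p closed D∩X massed below
      -- Isolated vertices go first: the vertex of low degree chosen below must have neighbours, as
      -- the core is found among them.
      with any? (λ u → (u ∈? D) ×-dec all? λ v → ¬? (E? a u v))
    ... | yes (u , u∈ , isolated) = Reduction.linkedByDeletion (2 * l) p a D X #X≤p closed D∩X massed below u u∈ isolated
    ... | no active
      with any? (λ u → any? λ v → (u ∈? D) ×-dec E? a u v ×-dec (2 * l * # (D ∖ ⁅ u ⁆) <? ρ (contract a u v) (D ∖ ⁅ u ⁆)))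
    ... | yes (u , v , u∈ , uv , hv) = Reduction.linkedByContraction (2 * l) p a D X #X≤p closed D∩X massed below u v u∈ uv hv
    ... | no stuck = dense (lowDegree a D (heavy⇒nonempty a D (heavy massed)))
      where
      dense : (∃ λ v → v ∈ D × # (nbr a v) * # D ≤ ρ a D) → Linked a D X
      -- The core is its own gate: every vertex of `R` may serve as an entry point.
      dense (v , v∈ , low) = Reduction.linkedFromCore (2 * l) p a D X #X≤p closed D∩X massed below R R
            (λ r r∈ → closed v r v∈ (R⊆ r r∈)) (λ _ → id) (λ _ _ → id) (λ r w r∈ r∉ _ → contradiction r∈ r∉)
            (robust⇒linkable a R p robust) (inj₂ large)
        where
        N′ : ℕ
        N′ = # (D ∖ ⁅ v ⁆)
        #D : suc N′ ≡ # D
        #D = #-remove D v∈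
        loss : ∀ w → E a v w → ρ (contract a v w) (D ∖ ⁅ v ⁆) ≤ 2 * l * N′
        loss w e = ≮⇒≥ λ lt → stuck (v , w , v∈ , e , lt)
        deep : ∀ w → w ∈ nbr a v → l < # (nbr a v ∩ nbr a w) + 1 + p
        deep w e = deep-arith l N′ (ρ a D) (ρ (contract a v w) (D ∖ ⁅ v ⁆)) (codeg a v w) (# X) p
          (subst (λ k → 2 * l * k < ρ a D) (sym #D) (heavy massed)) (contract-loss a D X v w closed v∈ e) (loss w e) #X≤p
        wide : ∀ w → w ∈ nbr a v → # (nbr a v) ≤ 2 * # (nbr a v ∩ nbr a w) + (2 + 2 * p)
        wide w e = wide-arith l N′ (ρ a D) (ρ (contract a v w) (D ∖ ⁅ v ⁆)) (codeg a v w) (# X) p (# (nbr a v))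
          (contract-loss a D X v w closed v∈ e) (loss w e) #X≤p (deep w e)
          (subst (λ k → # (nbr a v) * k ≤ ρ a D) (sym #D) low)
        neighbour : ∃ λ w → w ∈ nbr a v
        neighbour = decide (any? (E? a v))
          where
          decide : Dec (∃ λ w → E a v w) → ∃ λ w → E a v w
          decide (yes q) = q
          decide (no none) = contradiction (v , v∈ , λ w e → none (w , e)) active
        found = Core.core a (nbr a v) p l l-big wide deep neighbour
        R = proj₁ found
        R⊆ = proj₁ (proj₂ found)
        robust = proj₁ (proj₂ (proj₂ found))
        large = proj₂ (proj₂ (proj₂ found))

    massed⇒linked : ∀ a D X → # X ≤ p → Closed a D X → (∀ v → v ∈ D → v ∉ X) → Massed a D X → Linked a D X
    massed⇒linked a D X = go a D X (<-wellFounded _)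
      where
      go : ∀ a D X → Acc _<_ (# D) → # X ≤ p → Closed a D X → (∀ v → v ∈ D → v ∉ X) → Massed a D X → Linked a D X
      go a D X (acc rs) #X cl dj ms = linkedStep a D X #X cl dj ms
        λ a′ D′ X′ lt #X′ cl′ dj′ ms′ → go a′ D′ X′ (rs lt) #X′ cl′ dj′ ms′

-- From a linkage to a subdivision

module _ {n : ℕ} where
  private
    V = Fin n

  image : ∀ {m} → (Fin m → V) → VSet n
  image f = mkSet (λ v → ∃ λ k → v ≡ f k) (λ v → any? λ k → v ≟ f k)

  image-≤ : ∀ {m} (f : Fin m → V) → # (image f) ≤ m
  image-≤ {zero} f = ≤-reflexive (sum-zero {n} λ v → ι-no (v ∈? image f) λ ())
  image-≤ {suc m} f = ≤-trans
    (#-⊎ (image f) ⁅ f zero ⁆ (image (f ∘ suc)) λ { v (zero , eq) → inj₁ eq ; v (suc k , eq) → inj₂ (k , eq) })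
    (+-mono-≤ (≤-reflexive (#-point (f zero))) (image-≤ (f ∘ suc)))

  image-≥ : ∀ {m} (f : Fin m → V) → (∀ {i j} → f i ≡ f j → i ≡ j) → m ≤ # (image f)
  image-≥ {zero} f inj = z≤n
  image-≥ {suc m} f inj = ≤-trans
    (+-mono-≤ (≤-reflexive (sym (#-point (f zero)))) (image-≥ (f ∘ suc) (suc-injective ∘ inj)))
    (#-disjoint ⁅ f zero ⁆ (image (f ∘ suc)) (image f) (λ v eq → zero , eq) (λ v (k , eq) → suc k , eq)
      λ { v refl (k , eq) → case inj eq of λ () })

  Transversal : ∀ m → (Fin m → VSet n) → List V → Set
  Transversal m S U = ∃ λ (f : Fin m → V) → (∀ k → f k ∈ S k) × (∀ k → ¬ f k ∈ₗ U) × (∀ {i j} → f i ≡ f j → i ≡ j)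

  -- Greedy choice: each chosen vertex joins the forbidden list, so `length U + m` stays constant
  -- while `m` decreases.
  transversal : ∀ m (S : Fin m → VSet n) (U : List V) → (∀ k → length U + m ≤ # (S k)) → Transversal m S U
  transversal zero S U h = (λ ()) , (λ ()) , (λ ()) , λ { {()} }
  transversal (suc m) S U h = choose
      (#-diff (S zero) (listSet U) (≤-trans (s≤s (#-listSet U)) (≤-trans (m<m+n (length U) (s≤s z≤n)) (h zero))))
    where
    extend : ∀ {v} → v ∈ S zero → ¬ v ∈ₗ U → Transversal m (S ∘ suc) (v ∷ U) → Transversal (suc m) S U
    extend {v} v∈ v∉ (f , f∈ , f∉ , inj) =
      g , (λ { zero → v∈ ; (suc k) → f∈ k }) , (λ { zero → v∉ ; (suc k) → f∉ k ∘ there }) , g-inj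
      where
      g : Fin (suc m) → V
      g zero = v
      g (suc k) = f k
      g-inj : ∀ {i j} → g i ≡ g j → i ≡ j
      g-inj {zero} {zero} _ = refl
      g-inj {zero} {suc j} eq = contradiction (here (sym eq)) (f∉ j)
      g-inj {suc i} {zero} eq = contradiction (here eq) (f∉ i)
      g-inj {suc i} {suc j} eq = cong suc (inj eq)
    choose : (∃ λ v → v ∈ S zero × ¬ v ∈ₗ U) → Transversal (suc m) S U
    choose (v , v∈ , v∉) = extend v∈ v∉ (transversal m (S ∘ suc) (v ∷ U)
      λ k → subst (_≤ # (S (suc k))) (+-suc (length U) m) (h (suc k)))

  prod? : (A B : VSet n) (x y : V) → Dec (x ∈ A × y ∈ B)
  prod? A B x y = (x ∈? A) ×-dec (y ∈? B)

  pairs-prod : ∀ A B → pairs (prod? A B) ≡ # A * # B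
  pairs-prod A B = trans (sum-cong-≗ row) (trans (sum-*ˡ (# B) (λ x → ι (x ∈? A))) (*-comm (# B) (# A)))
    where
    row : ∀ x → sum (λ y → ι (prod? A B x y)) ≡ # B * ι (x ∈? A)
    row x with x ∈? A
    ... | yes _ = trans (sum-cong-≗ λ y → ι-eq (y ∈? B)) (sym (*-identityʳ (# B)))
      where
      ι-eq : {Q P : Set} {q : Q} (b? : Dec P) → ι (yes q ×-dec b?) ≡ ι b?
      ι-eq (yes _) = refl
      ι-eq (no _) = refl
    ... | no x∉ = trans (sum-zero λ y → ι-no (no x∉ ×-dec (y ∈? B)) (x∉ ∘ proj₁)) (sym (*-zeroʳ (# B)))

  module _ (G : Graph n) where

    adj-sym : ∀ {x y} → Adj G x y → Adj G y x
    adj-sym {x} {y} = subst T (Graph.sym G x y)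

    adj-irr : ∀ {x} → ¬ Adj G x x
    adj-irr {x} = subst T (irrefl G x)

    net : VSet n → Net n
    net W = record
      { E = λ x y → Adj G x y × x ∈ W × y ∈ W
      ; E? = λ x y → T? (adj G x y) ×-dec (x ∈? W) ×-dec (y ∈? W)
      ; E-sym = λ (e , p , q) → adj-sym e , q , p
      ; E-irr = λ (e , _) → adj-irr e
      }

    size : VSet n → ℕ
    size W = pairs (E? (net W))

    suffix : ∀ {x z} (vs : List V) → Walk G (vs ++ [ z ]) → Unique vs → x ∈ₗ vs →
      ∃ λ ws → Walk G (x ∷ ws ++ [ z ]) × Unique (x ∷ ws) × (∀ {w} → w ∈ₗ x ∷ ws → w ∈ₗ vs)
    suffix (v ∷ vs) walk uniq (here refl) = vs , walk , uniq , id
    suffix (v ∷ v′ ∷ vs) (step _ _ _ _ walk) (_ ∷ uniq) (there x∈) with suffix (v′ ∷ vs) walk uniq x∈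
    ... | ws , w , u , sub = ws , w , u , there ∘ sub

    -- The path is built from its end; a new start that already occurs on it cuts it down to a
    -- suffix. The final vertex `z` is left out of the distinctness claim, because later its colour
    -- separates it from the rest.
    simplePath : ∀ {R : V → V → Set} (P : V → Set) → (∀ {x y} → R x y → Adj G x y) → (∀ {x y} → R x y → P x) →
      ∀ {x y z} → Star R x y → P y → Adj G y z →
      ∃ λ ws → Walk G (x ∷ ws ++ [ z ]) × Unique (x ∷ ws) × (∀ {w} → w ∈ₗ x ∷ ws → P w)
    simplePath P toAdj toP {z = z} ε py yz = [] , step _ _ [] yz (single z) , [] ∷ [] , λ { (here refl) → py }
    simplePath P toAdj toP {x} (_◅_ {j = x′} r s) py yz with simplePath P toAdj toP s py yz
    ... | ws , walk , uniq , all with x ∈ₗ? (x′ ∷ ws)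
    ... | no x∉ = x′ ∷ ws , step x x′ _ (toAdj r) walk , ¬Any⇒All¬ _ x∉ ∷ uniq , λ { (here refl) → toP r ; (there w∈) → all w∈ }
    ... | yes x∈ with suffix (x′ ∷ ws) walk uniq x∈
    ... | ws′ , walk′ , uniq′ , sub = ws′ , walk′ , uniq′ , all ∘ sub

  -- y i i is the i-th branch vertex and y i j the vertex at which it is left towards the j-th one.
  module Hubs (G : Graph n) (t : ℕ) (W : VSet n) (y : Fin t → Fin t → V)
    (y-inj : ∀ i j k l → y i j ≡ y k l → i ≡ k × j ≡ l) (spoke : ∀ i j → i ≢ j → Adj G (y i i) (y i j))
    (X D : VSet n) (y∈X : ∀ i j → y i j ∈ X) (linked : Linked (net G W) D X) where

    pair : Fin t → Fin t → ℕ
    pair i j = toℕ (combine i j)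

    pair-inj : ∀ i j k l → pair i j ≡ pair k l → i ≡ k × j ≡ l
    pair-inj i j k l eq = combine-injective i j k l (toℕ-injective eq)

    -- Symmetric in its arguments, so that `y i j` and `y j i` get the same colour and are joined,
    -- while each branch vertex `y i i` has a colour shared with no other `y k l`.
    code : Fin t → Fin t → ℕ
    code i j with toℕ i ≤? toℕ j
    ... | yes _ = pair i j
    ... | no _  = pair j i

    code-≤ : ∀ i j → toℕ i ≤ toℕ j → code i j ≡ pair i j
    code-≤ i j le with toℕ i ≤? toℕ j
    ... | yes _ = refl
    ... | no ¬le = contradiction le ¬le

    code-> : ∀ i j → toℕ j < toℕ i → code i j ≡ pair j i
    code-> i j lt with toℕ i ≤? toℕ j
    ... | yes le = contradiction lt (≤⇒≯ le)
    ... | no _ = refl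

    label : V → ℕ
    label v with any? (λ i → any? λ j → v ≟ y i j)
    ... | yes (i , j , _) = code i j
    -- A default value; only the colours of the `y i j` are used.
    ... | no _ = 0

    label-y : ∀ i j → label (y i j) ≡ code i j
    label-y i j with any? (λ k → any? λ l → y i j ≟ y k l)
    ... | no none = contradiction (i , j , refl) none
    ... | yes (k , l , eq) with y-inj i j k l eq
    ... | refl , refl = refl

    colouring = linked label

    c : V → ℕ
    c = proj₁ colouring

    c-y : ∀ i j → c (y i j) ≡ code i j
    c-y i j = trans (proj₁ (proj₂ colouring) (y i j) (y∈X i j)) (label-y i j)

    module Path (i j : Fin t) (i<j : i <ᶠ j) where
      i≢j : i ≢ j
      i≢j refl = n≮n _ i<j

      c-ij : c (y i j) ≡ pair i j
      c-ij = trans (c-y i j) (code-≤ i j (<⇒≤ i<j))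

      c-ji : c (y j i) ≡ pair i j
      c-ji = trans (c-y j i) (code-> j i i<j)

      path = simplePath G (λ v → c v ≡ pair i j) (λ (e , _) → proj₁ e) proj₂
        (constant c-ij (proj₂ (proj₂ colouring) (y i j) (y j i) (y∈X i j) (y∈X j i)
          (trans (label-y i j) (trans (sym (c-y i j)) (trans c-ij (trans (sym c-ji) (trans (c-y j i) (sym (label-y j i)))))))))
        c-ji (adj-sym G (spoke j i (i≢j ∘ sym)))
        where
        constant : ∀ {u v} → c u ≡ pair i j → Star (Step (net G W) (D ∪ X) c) u v →
          Star (λ u v → E (net G W) u v × c u ≡ pair i j) u v
        constant cu ε = ε
        constant cu ((e , _ , _ , eq) ◅ s) = (e , cu) ◅ constant (trans (sym eq) cu) s

      route : List V
      route = y i j ∷ proj₁ path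

      route-colour : ∀ {v} → v ∈ₗ route → c v ≡ pair i j
      route-colour = proj₂ (proj₂ (proj₂ path))

      off-branch : ∀ {v} → v ∈ₗ route → ∀ k → v ≢ y k k
      off-branch v∈ k refl = i≢j (trans (proj₁ eqs) (sym (proj₂ eqs)))
        where
        eqs : i ≡ k × j ≡ k
        eqs = pair-inj i j k k (trans (sym (route-colour v∈)) (trans (c-y k k) (code-≤ k k ≤-refl)))

      is-path : IsPath G (y i i ∷ route ++ [ y j j ])
      is-path = step _ _ _ (spoke i j i≢j) (proj₁ (proj₂ path)) ,
        All.tabulate (λ {v} v∈ eq → [ (λ q → off-branch q i (sym eq)) ,
                        (λ { (here refl) → i≢j (proj₁ (y-inj i i j j eq)) }) ]′ (∈-++⁻ route v∈))
        ∷ Uniqueₚ.++⁺ (proj₁ (proj₂ (proj₂ path))) ([] ∷ []) (λ { (v∈ , here refl) → off-branch v∈ j refl })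

    subdivision : KSubdivision t G
    subdivision = record
      { branch = λ i → y i i
      ; branch-inj = λ i j eq → proj₁ (y-inj i i j j eq)
      ; inner = Path.route
      ; isPath = Path.is-path
      ; inner-notBranch = λ i j i<j v v∈ → Path.off-branch i j i<j v∈
      ; disjoint = λ i j i<j i′ j′ i′<j′ v v∈ v∈′ →
          pair-inj i j i′ j′ (trans (sym (Path.route-colour i j i<j v∈)) (Path.route-colour i′ j′ i′<j′ v∈′))
      }

-- Minimal dense sets and degeneracy

abstract
  -- A set of exactly l vertices has too few pairs to be dense. Hence a dense set has more than l
  -- vertices, and deleting one vertex preserves the size condition.
  small-arith : ∀ l q e → e ≤ l * l → 2 * l * l < e + 2 * l * q → 2 * q ≤ l → ⊥
  small-arith l q e h₁ h₂ h₃ = n≮n (2 * l * l) (begin-strict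
    2 * l * l           <⟨ h₂ ⟩
    e + 2 * l * q       ≤⟨ +-monoˡ-≤ _ h₁ ⟩
    l * l + 2 * l * q   ≡⟨ eq₁ l q ⟩
    l * l + l * (2 * q) ≤⟨ +-monoʳ-≤ (l * l) (*-monoʳ-≤ l h₃) ⟩
    l * l + l * l       ≡⟨ eq₂ l ⟩
    2 * l * l           ∎)
    where
    open ≤-Reasoning
    eq₁ : ∀ l q → l * l + 2 * l * q ≡ l * l + l * (2 * q)
    eq₁ = solve-∀
    eq₂ : ∀ l → l * l + l * l ≡ 2 * l * l
    eq₂ = solve-∀

  degree-arith : ∀ l q w e e′ d → 2 * l * suc w < e + 2 * l * q → e ≤ e′ + d + d → e′ + 2 * l * q ≤ 2 * l * w → l < d
  degree-arith l q w e e′ d h₁ h₂ h₃ = *-cancelˡ-< 2 l d (+-cancelˡ-< (2 * l * w) _ _ (begin-strict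
    2 * l * w + 2 * l             ≡⟨ eq₁ l w ⟩
    2 * l * suc w                 <⟨ h₁ ⟩
    e + 2 * l * q                 ≤⟨ +-monoˡ-≤ _ h₂ ⟩
    e′ + d + d + 2 * l * q        ≡⟨ eq₂ e′ d l q ⟩
    e′ + 2 * l * q + 2 * d        ≤⟨ +-monoˡ-≤ _ h₃ ⟩
    2 * l * w + 2 * d             ∎))
    where
    open ≤-Reasoning
    eq₁ : ∀ l w → 2 * l * w + 2 * l ≡ 2 * l * suc w
    eq₁ = solve-∀
    eq₂ : ∀ e d l q → e + d + d + 2 * l * q ≡ e + 2 * l * q + 2 * d
    eq₂ = solve-∀

  -- The root set has q + 1 vertices, one more than the slack in `Dense` covers. This one vertex is
  -- worth 2l, which pays for the at most p² ordered pairs inside the root set.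
  heavy-arith : ∀ l q w d e r p → 2 * l * w < e + 2 * l * q → d + suc q ≤ w → e ≤ r + p * p → p * p ≤ 2 * l → 2 * l * d < r
  heavy-arith l q w d e r p h₁ h₂ h₃ h₄ = +-cancelˡ-< (2 * l * suc q) _ _ (begin-strict
    2 * l * suc q + 2 * l * d     ≡⟨ eq₁ l q d ⟩
    2 * l * (d + suc q)           ≤⟨ *-monoʳ-≤ (2 * l) h₂ ⟩
    2 * l * w                     <⟨ h₁ ⟩
    e + 2 * l * q                 ≤⟨ +-monoˡ-≤ _ (≤-trans h₃ (+-monoʳ-≤ r h₄)) ⟩
    r + 2 * l + 2 * l * q         ≡⟨ eq₂ r l q ⟩
    2 * l * suc q + r             ∎)
    where
    open ≤-Reasoning
    eq₁ : ∀ l q d → 2 * l * suc q + 2 * l * d ≡ 2 * l * (d + suc q)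
    eq₁ = solve-∀
    eq₂ : ∀ r l q → r + 2 * l + 2 * l * q ≡ 2 * l * suc q + r
    eq₂ = solve-∀

  -- The slack 2lq is exactly the allowance for a boundary of at most q vertices.
  light-arith : ∀ l q w f b e → w ≤ f + b → b < suc q → e + 2 * l * q ≤ 2 * l * w → e ≤ 2 * l * f
  light-arith l q w f b e h₁ (s≤s h₂) h₃ = +-cancelʳ-≤ (2 * l * q) _ _ (begin
    e + 2 * l * q           ≤⟨ h₃ ⟩
    2 * l * w               ≤⟨ *-monoʳ-≤ (2 * l) (≤-trans h₁ (+-monoʳ-≤ f h₂)) ⟩
    2 * l * (f + q)         ≡⟨ *-distribˡ-+ (2 * l) f q ⟩
    2 * l * f + 2 * l * q   ∎)
    where open ≤-Reasoning

module _ {n : ℕ} (G : Graph n) where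
  private
    V = Fin n

  size-mono : ∀ W W′ → W ⊆ W′ → size G W ≤ size G W′
  size-mono W W′ sub = pairs-mono (E? (net G W)) (E? (net G W′)) λ x y (e , x∈ , y∈) → e , sub x x∈ , sub y y∈

  size-≤ : ∀ W → size G W ≤ # W * # W
  size-≤ W = ≤-trans (pairs-mono (E? (net G W)) (prod? W W) λ x y → proj₂) (≤-reflexive (pairs-prod W W))

  size-remove : ∀ W v → size G W ≤ size G (W ∖ ⁅ v ⁆) + # (nbr (net G W) v) + # (nbr (net G W) v)
  size-remove W v = ≤-trans (pairs-⊎₃ (E? (net G W)) (E? (net G (W ∖ ⁅ v ⁆))) (inRow? v N) (inCol? v N) split)
    (≤-reflexive (cong₂ (λ s t → size G (W ∖ ⁅ v ⁆) + s + t) (pairs-row v N) (pairs-col v N)))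
    where
    N : VSet n
    N = nbr (net G W) v
    split : ∀ x y → E (net G W) x y → E (net G (W ∖ ⁅ v ⁆)) x y ⊎ (x ≡ v × y ∈ N) ⊎ (y ≡ v × x ∈ N)
    split x y e@(xy , x∈ , y∈) with x ≟ v | y ≟ v
    ... | yes refl | _ = inj₂ (inj₁ (refl , e))
    ... | no _ | yes refl = inj₂ (inj₂ (refl , E-sym (net G W) e))
    ... | no x≢ | no y≢ = inj₁ (xy , (x∈ , x≢) , (y∈ , y≢))

  module _ (r l : ℕ) where
    private
      t p q : ℕ
      t = suc r
      p = t * t
      q = r + r * t

    -- Here q = t² − 1 is the largest order of a separation which has to be excluded.
    Dense : VSet n → Set
    Dense W = l ≤ # W × 2 * l * # W < size G W + 2 * l * q

    dense? : ∀ W → Dec (Dense W)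
    dense? W = (l ≤? # W) ×-dec (2 * l * # W <? size G W + 2 * l * q)

    Dense-ext : Extensional Dense
    Dense-ext W W′ f g (le , lt) = ≤-trans le (#-mono W W′ f) ,
      ≤-<-trans (*-monoʳ-≤ (2 * l) (#-mono W′ W g)) (<-≤-trans lt (+-monoˡ-≤ _ (size-mono W W′ f)))

    module _ (l-big : 21 * p + 3 ≤ l) (l-big′ : p * p ≤ 2 * l) where

      p+p≤l : p + p ≤ l
      p+p≤l = ≤-trans (≤-trans (≤-trans (≤-reflexive (cong (p +_) (sym (+-identityʳ p)))) (*-monoˡ-≤ p (s≤s (s≤s (z≤n {19}))))) (m≤m+n (21 * p) 3)) l-big

      t≤p : t ≤ p
      t≤p = m≤m*n t t

      module Minimal (W : VSet n) (dense : Dense W) (least : ∀ W′ → # W′ < # W → ¬ Dense W′) where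

        sparse : ∀ W′ → # W′ < # W → l ≤ # W′ → size G W′ + 2 * l * q ≤ 2 * l * # W′
        sparse W′ lt le = ≮⇒≥ λ hv → least W′ lt (le , hv)

        l<W : l < # W
        l<W = ≤∧≢⇒< (proj₁ dense) λ eq → small-arith l q (size G W)
          (subst (λ k → size G W ≤ k * k) (sym eq) (size-≤ W)) (subst (λ k → 2 * l * k < size G W + 2 * l * q) (sym eq) (proj₂ dense))
          (≤-trans (≤-reflexive (cong (q +_) (+-identityʳ q))) (≤-trans (+-mono-≤ (n≤1+n q) (n≤1+n q)) p+p≤l))

        degree : ∀ v → v ∈ W → l < # (nbr (net G W) v)
        degree v v∈ = degree-arith l q (# (W ∖ ⁅ v ⁆)) (size G W) (size G (W ∖ ⁅ v ⁆)) (# (nbr (net G W) v))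
          (subst (λ k → 2 * l * k < size G W + 2 * l * q) (sym #W) (proj₂ dense)) (size-remove W v)
          (sparse (W ∖ ⁅ v ⁆) (≤-reflexive #W) (≤-pred (subst (l <_) (sym #W) l<W)))
          where
          #W : suc (# (W ∖ ⁅ v ⁆)) ≡ # W
          #W = #-remove W v∈

        hubs : Transversal t (λ _ → W) []
        hubs = transversal t (λ _ → W) [] λ _ → ≤-trans t≤p (≤-trans (m≤m+n p p) (≤-trans p+p≤l (<⇒≤ l<W)))

        hub : Fin t → V
        hub = proj₁ hubs

        hub∈ : ∀ i → hub i ∈ W
        hub∈ = proj₁ (proj₂ hubs)

        hub-inj : ∀ {i j} → hub i ≡ hub j → i ≡ j
        hub-inj = proj₂ (proj₂ (proj₂ hubs))

        hubList : List V
        hubList = map hub (allFin t)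

        at : Fin p → Fin t × Fin t
        at = remQuot {t} t

        spokes : Transversal p (λ k → nbr (net G W) (hub (proj₁ (at k)))) hubList
        spokes = transversal p (λ k → nbr (net G W) (hub (proj₁ (at k)))) hubList λ k → ≤-trans (+-monoˡ-≤ p (≤-trans (≤-reflexive (trans (length-map hub (allFin t)) (length-tabulate (λ x → x)))) t≤p))
          (≤-trans p+p≤l (<⇒≤ (degree (hub (proj₁ (at k))) (hub∈ (proj₁ (at k))))))

        spoke : Fin t → Fin t → V
        spoke i j = proj₁ spokes (combine i j)

        y : Fin t → Fin t → V
        y i j with i ≟ j
        ... | yes _ = hub i
        ... | no _  = spoke i j

        spoke-edge : ∀ i j → E (net G W) (hub i) (spoke i j)
        spoke-edge i j = subst (λ k → E (net G W) (hub (proj₁ k)) (spoke i j)) (remQuot-combine {t} i j) (proj₁ (proj₂ spokes) (combine i j))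

        spoke-≢ : ∀ i j k → spoke i j ≢ hub k
        spoke-≢ i j k eq = proj₁ (proj₂ (proj₂ spokes)) (combine i j) (subst (_∈ₗ hubList) (sym eq) (∈-map⁺ hub (∈-allFin k)))

        y-inj : ∀ i j k m → y i j ≡ y k m → i ≡ k × j ≡ m
        y-inj i j k m eq with i ≟ j | k ≟ m
        ... | yes refl | yes refl = hub-inj eq , hub-inj eq
        ... | yes refl | no _ = contradiction (sym eq) (spoke-≢ k m i)
        ... | no _ | yes refl = contradiction eq (spoke-≢ i j k)
        ... | no _ | no _ = combine-injective i j k m (proj₂ (proj₂ (proj₂ spokes)) eq)

        y∈W : ∀ i j → y i j ∈ W
        y∈W i j with i ≟ j
        ... | yes _ = hub∈ i
        ... | no _ = proj₂ (proj₂ (spoke-edge i j))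

        y-spoke : ∀ i j → i ≢ j → Adj G (y i i) (y i j)
        y-spoke i j i≢j with i ≟ i | i ≟ j
        ... | no ne | _ = contradiction refl ne
        ... | yes _ | yes eq = contradiction eq i≢j
        ... | yes _ | no _ = proj₁ (spoke-edge i j)

        point : Fin p → V
        point k = y (proj₁ (at k)) (proj₂ (at k))

        X : VSet n
        X = image point

        point-inj : ∀ {k m} → point k ≡ point m → k ≡ m
        point-inj {k} {m} eq = trans (sym (combine-remQuot {t} t k)) (trans (cong₂ combine (proj₁ eqs) (proj₂ eqs)) (combine-remQuot {t} t m))
          where
          eqs : proj₁ (at k) ≡ proj₁ (at m) × proj₂ (at k) ≡ proj₂ (at m)
          eqs = y-inj (proj₁ (at k)) (proj₂ (at k)) (proj₁ (at m)) (proj₂ (at m)) eq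

        #X≤p : # X ≤ p
        #X≤p = image-≤ point

        p≤#X : p ≤ # X
        p≤#X = image-≥ point point-inj

        y∈X : ∀ i j → y i j ∈ X
        y∈X i j = combine i j , cong (λ k → y (proj₁ k) (proj₂ k)) (sym (remQuot-combine {t} i j))

        X⊆W : X ⊆ W
        X⊆W v (k , refl) = y∈W (proj₁ (at k)) (proj₂ (at k))

        D : VSet n
        D = W ∖ X

        open MassBound {n} (2 * l)

        closed : Closed (net G W) D X
        closed d w _ (_ , _ , w∈) with w ∈? X
        ... | yes w∈X = inj₂ w∈X
        ... | no w∉X = inj₁ (w∈ , w∉X)

        heavyD : 2 * l * # D < ρ (net G W) D
        heavyD = heavy-arith l q (# W) (# D) (size G W) (ρ (net G W) D) p (proj₂ dense)
          (≤-trans (≤-trans (+-monoʳ-≤ (# D) p≤#X) (≤-reflexive (+-comm (# D) (# X)))) (≤-reflexive (sym (#-split W X X⊆W))))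
          (≤-trans (pairs-⊎ (E? (net G W)) (touch? (net G W) D) (prod? X X) split)
            (+-monoʳ-≤ _ (≤-trans (≤-reflexive (pairs-prod X X)) (*-mono-≤ #X≤p #X≤p)))) l-big′
          where
          split : ∀ x y → E (net G W) x y → Touch (net G W) D x y ⊎ (x ∈ X × y ∈ X)
          split x y e@(_ , x∈ , y∈) with x ∈? X | y ∈? X
          ... | no x∉ | _ = inj₁ (e , inj₁ (x∈ , x∉))
          ... | yes _ | no y∉ = inj₁ (e , inj₂ (y∈ , y∉))
          ... | yes x∈X | yes y∈X = inj₂ (x∈X , y∈X)

        lightF : ∀ F → F ⊆ D → # (∂ (net G W) F) < # X → ρ (net G W) F ≤ 2 * l * # F
        -- With at least l vertices `W′` is sparse by minimality of `W`; with fewer, the crude count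
        -- suffices, as every vertex of `F` has fewer than l possible neighbours.
        lightF F F⊆ bd = [ large , small ]′ (≤-<-connex l (# W′))
          where
          a : Net n
          a = net G W
          W′ : VSet n
          W′ = F ∪ ∂ a F
          sub : W′ ⊆ W
          sub v (inj₁ v∈) = proj₁ (F⊆ v v∈)
          sub v (inj₂ (_ , _ , _ , _ , _ , v∈)) = v∈
          -- The boundary of `F` is smaller than `X`, so `W′` omits a root.
          less : # W′ < # W
          less = let x , x∈ , x∉ = #-diff X (∂ a F) bd in
            #-strict W′ W sub (X⊆W x x∈) [ (λ x∈F → proj₂ (F⊆ x x∈F) x∈) , x∉ ]′
          near : ∀ x y → Touch a F x y → x ∈ W′ × y ∈ W′
          near x y (e , inj₁ x∈) = inj₁ x∈ , Closed-∂ a F x y x∈ e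
          near x y (e , inj₂ y∈) = Closed-∂ a F y x y∈ (E-sym a e) , inj₁ y∈
          large : l ≤ # W′ → ρ a F ≤ 2 * l * # F
          large le = ≤-trans
            (pairs-mono (touch? a F) (E? (net G W′)) λ x y t → proj₁ (proj₁ t) , near x y t)
            (light-arith l q (# W′) (# F) (# (∂ a F)) (size G W′) (#-⊎ W′ F (∂ a F) λ _ → id)
              (<-≤-trans bd #X≤p) (sparse W′ less le))
          small : # W′ < l → ρ a F ≤ 2 * l * # F
          small lt = ≤-trans (pairs-⊎ (touch? a F) (prod? F W′) (prod? W′ F) λ where
              x y t@(_ , inj₁ x∈) → inj₁ (x∈ , proj₂ (near x y t))
              x y t@(_ , inj₂ y∈) → inj₂ (proj₁ (near x y t) , y∈))
            (≤-trans (+-mono-≤ (≤-trans (≤-reflexive (pairs-prod F W′)) (*-monoʳ-≤ (# F) (<⇒≤ lt)))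
                               (≤-trans (≤-reflexive (pairs-prod W′ F)) (*-monoˡ-≤ (# F) (<⇒≤ lt))))
              (≤-reflexive (eq (# F) l)))
            where
            eq : ∀ f l → f * l + l * f ≡ 2 * l * f
            eq = solve-∀

        subdivision : KSubdivision t G
        subdivision = Hubs.subdivision G t W y y-inj y-spoke X D y∈X
          (massed⇒linked p l l-big (net G W) D X #X≤p closed (λ v → proj₂) record { heavy = heavyD ; light = lightF })

      no-dense : ¬ KSubdivision t G → ∀ W → ¬ Dense W
      no-dense none W dense = let W₀ , d , least = minimalSet Dense dense? Dense-ext W dense in
        none (Minimal.subdivision W₀ d least)

      -- A set of at least l vertices that is not dense has average degree at most 2l; in a smaller
      -- set every degree is below l.
      degenerate : ¬ KSubdivision t G → ∀ S → (∃ λ v → v ∈ S) → ∃ λ v → v ∈ S × # (nbr (net G S) v) ≤ 2 * l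
      degenerate none S (s , s∈) = [ large , small ]′ (≤-<-connex l (# S))
        where
        small : # S < l → ∃ λ v → v ∈ S × # (nbr (net G S) v) ≤ 2 * l
        small lt = s , s∈ , ≤-trans (#-mono (nbr (net G S) s) S λ v e → proj₂ (proj₂ e)) (≤-trans (<⇒≤ lt) (m≤m+n l (l + 0)))
        large : l ≤ # S → ∃ λ v → v ∈ S × # (nbr (net G S) v) ≤ 2 * l
        large le = let v , v∈ , low = lowDegree (net G S) S (s , s∈) in v , v∈ , finish v low
          where
          bound : ρ (net G S) S ≤ 2 * l * # S
          bound = ≤-trans (pairs-mono (touch? (net G S) S) (E? (net G S)) λ x y → proj₁)
            (≤-trans (m≤m+n _ (2 * l * q)) (≮⇒≥ λ lt → no-dense none S (le , lt)))
          finish : ∀ v → # (nbr (net G S) v) * # S ≤ ρ (net G S) S → # (nbr (net G S) v) ≤ 2 * l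
          finish v low = ≮⇒≥ λ lt → n≮n (2 * l * # S) (begin-strict
            2 * l * # S                   <⟨ *-monoˡ-< (# S) {{>-nonZero (≤-<-trans z≤n (#-strict (S ∖ S) S (λ _ → proj₁) s∈ (λ q → proj₂ q s∈)))}} lt ⟩
            # (nbr (net G S) v) * # S     ≤⟨ low ⟩
            ρ (net G S) S                 ≤⟨ bound ⟩
            2 * l * # S                   ∎)
            where open ≤-Reasoning

-- Counting cliques by removing vertices

sumˢ : ∀ {n} → (Subset n → ℕ) → ℕ
sumˢ {zero} f = f []
sumˢ {suc n} f = sumˢ (λ T → f (outside ∷ T)) + sumˢ (λ T → f (inside ∷ T))

sumˢ-mono : ∀ {n} {f g : Subset n → ℕ} → (∀ T → f T ≤ g T) → sumˢ f ≤ sumˢ g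
sumˢ-mono {zero} h = h []
sumˢ-mono {suc n} h = +-mono-≤ (sumˢ-mono λ T → h (outside ∷ T)) (sumˢ-mono λ T → h (inside ∷ T))

sumˢ-+ : ∀ {n} (f g : Subset n → ℕ) → sumˢ (λ T → f T + g T) ≡ sumˢ f + sumˢ g
sumˢ-+ {zero} f g = refl
sumˢ-+ {suc n} f g = trans (cong₂ _+_ (sumˢ-+ (λ T → f (outside ∷ T)) _) (sumˢ-+ (λ T → f (inside ∷ T)) _))
  (swap (sumˢ λ T → f (outside ∷ T)) (sumˢ λ T → g (outside ∷ T)) (sumˢ λ T → f (inside ∷ T)) (sumˢ λ T → g (inside ∷ T)))
  where
  swap : ∀ a b c d → a + b + (c + d) ≡ a + c + (b + d)
  swap = solve-∀

-- Subsets are grouped into pairs that differ only in `v`, and the two terms of `f` are charged to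
-- `g` at the member without `v`.
sumˢ-insert : ∀ {n} (v : Fin n) (f g : Subset n → ℕ) →
  (∀ T → ¬ v ∈ˢ T → f T + f (T [ v ]≔ inside) ≤ g T) → sumˢ f ≤ sumˢ g
sumˢ-insert {suc n} zero f g h = ≤-trans (≤-reflexive (sym (sumˢ-+ (λ T → f (outside ∷ T)) (λ T → f (inside ∷ T)))))
  (≤-trans (sumˢ-mono λ T → h (outside ∷ T) λ ()) (m≤m+n _ _))
sumˢ-insert {suc n} (suc v) f g h = +-mono-≤
  (sumˢ-insert v _ _ λ T v∉ → h (outside ∷ T) λ { (there p) → v∉ p })
  (sumˢ-insert v _ _ λ T v∉ → h (inside ∷ T) λ { (there p) → v∉ p })

sumˢ-zero : ∀ {n} {f : Subset n → ℕ} → (∀ T → f T ≡ 0) → sumˢ f ≡ 0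
sumˢ-zero {zero} h = h []
sumˢ-zero {suc n} h = cong₂ _+_ (sumˢ-zero λ T → h (outside ∷ T)) (sumˢ-zero λ T → h (inside ∷ T))

sumˢ-empty : ∀ {n} (f : Subset n → ℕ) → (∀ T → f T ≤ 1) → (∀ T v → v ∈ˢ T → f T ≡ 0) → sumˢ f ≤ 1
sumˢ-empty {zero} f h₁ h₂ = h₁ []
sumˢ-empty {suc n} f h₁ h₂ = ≤-trans (≤-reflexive (trans
    (cong (sumˢ (λ T → f (outside ∷ T)) +_) (sumˢ-zero λ T → h₂ (inside ∷ T) zero here)) (+-identityʳ _)))
  (sumˢ-empty (λ T → f (outside ∷ T)) (λ T → h₁ _) (λ T v p → h₂ (outside ∷ T) (suc v) (there p)))

length-filter-map : ∀ {A B : Set} {P : B → Set} (P? : ∀ b → Dec (P b)) (f : A → B) xs →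
  length (filter P? (map f xs)) ≡ length (filter (λ a → P? (f a)) xs)
length-filter-map P? f [] = refl
length-filter-map P? f (x ∷ xs) with P? (f x)
... | yes _ = cong suc (length-filter-map P? f xs)
... | no _ = length-filter-map P? f xs

length-filter-allSubsets : ∀ {n} {P : Subset n → Set} (P? : ∀ T → Dec (P T)) →
  length (filter P? (allSubsets n)) ≡ sumˢ (λ T → ι (P? T))
length-filter-allSubsets {zero} P? with P? []
... | yes _ = refl
... | no _ = refl
length-filter-allSubsets {suc n} P? = trans
  (cong length (filter-++ P? (map (outside ∷_) (allSubsets n)) (map (inside ∷_) (allSubsets n))))
  (trans (length-++ (filter P? (map (outside ∷_) (allSubsets n))))
    (cong₂ _+_ (trans (length-filter-map P? (outside ∷_) (allSubsets n)) (length-filter-allSubsets (λ T → P? (outside ∷ T))))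
               (trans (length-filter-map P? (inside ∷_) (allSubsets n)) (length-filter-allSubsets (λ T → P? (inside ∷ T))))))

module _ {n : ℕ} (G : Graph n) where
  private
    V = Fin n

  N : V → VSet n
  N v = mkSet (Adj G v) (λ w → T? (adj G v w))

  CliqueIn : VSet n → Subset n → Set
  CliqueIn S T = IsClique G T × (∀ u → u ∈ˢ T → u ∈ S)

  cliqueIn? : ∀ S T → Dec (CliqueIn S T)
  cliqueIn? S T = isClique? G T ×-dec all? λ u → (u ∈ˢ? T) →-dec (u ∈? S)

  cl : VSet n → ℕ
  cl S = sumˢ λ T → ι (cliqueIn? S T)

  numCliques≤cl : numCliques G ≤ cl full
  numCliques≤cl = ≤-trans (≤-reflexive (length-filter-allSubsets (isClique? G)))
    (sumˢ-mono λ T → ι-mono (isClique? G T) (cliqueIn? full T) λ c → c , λ _ _ → _)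

  cl-rec : ∀ S v → v ∈ S → cl S ≤ cl (S ∖ ⁅ v ⁆) + cl (S ∩ N v)
  cl-rec S v v∈ = ≤-trans
    (sumˢ-insert v (λ T → ι (cliqueIn? S T)) (λ T → ι (cliqueIn? (S ∖ ⁅ v ⁆) T) + ι (cliqueIn? (S ∩ N v) T)) λ T v∉ →
      +-mono-≤
        (ι-mono (cliqueIn? S T) (cliqueIn? (S ∖ ⁅ v ⁆) T) λ (c , sub) → c , λ u u∈ → sub u u∈ , λ { refl → v∉ u∈ })
        (ι-mono (cliqueIn? S (T [ v ]≔ inside)) (cliqueIn? (S ∩ N v) T) λ (c , sub) →
          (λ u w u∈ w∈ → c u w (keep T v∉ u∈) (keep T v∉ w∈)) ,
          λ u u∈ → sub u (keep T v∉ u∈) , c v u ([]≔-updates T v) (keep T v∉ u∈) λ { refl → v∉ u∈ }))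
    (≤-reflexive (sumˢ-+ (λ T → ι (cliqueIn? (S ∖ ⁅ v ⁆) T)) (λ T → ι (cliqueIn? (S ∩ N v) T))))
    where
    keep : ∀ T → ¬ v ∈ˢ T → ∀ {u} → u ∈ˢ T → u ∈ˢ T [ v ]≔ inside
    keep T v∉ {u} u∈ = []≔-minimal T u v (λ { refl → v∉ u∈ }) u∈

  cl-empty : ∀ S → (∀ v → v ∉ S) → cl S ≤ 1
  cl-empty S empty = sumˢ-empty _ (λ T → ι≤1 (cliqueIn? S T)) λ T v v∈ → ι-no (cliqueIn? S T) λ (_ , sub) → empty v (sub v v∈)

  Bounded : ℕ → ℕ → Set₁
  Bounded k M = ∀ S → # S ≤ k → cl S ≤ M

  empty-or-element : (S : VSet n) → (∀ v → v ∉ S) ⊎ ∃ λ v → v ∈ S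
  empty-or-element S with any? (_∈? S)
  ... | yes q = inj₂ q
  ... | no none = inj₁ λ v v∈ → none (v , v∈)

  bounded-2^ : ∀ k → Bounded k (2 ^ k)
  bounded-2^ k S le with empty-or-element S
  ... | inj₁ empty = ≤-trans (cl-empty S empty) (m^n>0 2 k)
  bounded-2^ zero S le | inj₂ (v , v∈) = contradiction (≤-trans (≤-reflexive (#-remove S v∈)) le) λ ()
  bounded-2^ (suc k) S le | inj₂ (v , v∈) = ≤-trans (cl-rec S v v∈)
    (≤-trans (+-mono-≤ (bounded-2^ k (S ∖ ⁅ v ⁆) less)
      (bounded-2^ k (S ∩ N v) (≤-trans (#-mono (S ∩ N v) (S ∖ ⁅ v ⁆) λ { w (w∈ , vw) → w∈ , λ { refl → adj-irr G vw } }) less)))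
      (≤-reflexive (cong (2 ^ k +_) (sym (+-identityʳ (2 ^ k))))))
    where
    less : # (S ∖ ⁅ v ⁆) ≤ k
    less = ≤-pred (≤-trans (≤-reflexive (#-remove S v∈)) le)

  -- The bound b counts v itself among the vertices of S that are not adjacent to v.
  Peelable : ℕ → ℕ → ℕ → Set₁
  Peelable lo hi b = ∀ S → lo < # S → # S ≤ hi → ∃ λ v → v ∈ S × # (S ∩ N v) + b ≤ # S

  -- In a set of at most k + b vertices the removed vertex has at most k neighbours, so each of the
  -- at most b removals needed to get down to k vertices adds at most M cliques.
  peel : ∀ k b M → Peelable k (k + b) b → Bounded k M → Bounded (k + b) (suc b * M)
  peel k b M peelable bd = go b ≤-refl
    where
    go : ∀ i → i ≤ b → Bounded (k + i) (suc i * M)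
    go zero _ S le = ≤-trans (bd S (≤-trans le (≤-reflexive (+-identityʳ k)))) (≤-reflexive (sym (+-identityʳ M)))
    go (suc i) i<b S le = [ small , large ]′ (≤-<-connex (# S) (k + i))
      where
      small : # S ≤ k + i → cl S ≤ suc (suc i) * M
      small s≤ = ≤-trans (go i (<⇒≤ i<b) S s≤) (m≤n+m _ M)
      large : k + i < # S → cl S ≤ suc (suc i) * M
      large <s = remove (peelable S (≤-<-trans (m≤m+n k i) <s) (≤-trans le (+-monoʳ-≤ k i<b)))
        where
        remove : (∃ λ v → v ∈ S × # (S ∩ N v) + b ≤ # S) → cl S ≤ suc (suc i) * M
        remove (v , v∈ , nd) = ≤-trans (cl-rec S v v∈) (≤-trans (≤-reflexive (+-comm (cl (S ∖ ⁅ v ⁆)) _))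
          (+-mono-≤ (bd (S ∩ N v) (+-cancelʳ-≤ b _ _ (≤-trans nd (≤-trans le (+-monoʳ-≤ k i<b)))))
                    (go i (<⇒≤ i<b) (S ∖ ⁅ v ⁆) (≤-pred (≤-trans (≤-reflexive (#-remove S v∈)) (≤-trans le (≤-reflexive (+-suc k i))))))))

  peel* : ∀ m k b M → Peelable k (k + m * b) b → Bounded k M → Bounded (k + m * b) (suc b ^ m * M)
  peel* zero k b M _ bd S le = ≤-trans (bd S (≤-trans le (≤-reflexive (+-identityʳ k)))) (≤-reflexive (sym (+-identityʳ M)))
  peel* (suc m) k b M peelable bd S le = ≤-trans
    (peel* m (k + b) b (suc b * M)
      (λ S′ lo hi → peelable S′ (≤-<-trans (m≤m+n k b) lo) (≤-trans hi (≤-reflexive (+-assoc k b (m * b)))))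
      (peel k b M (λ S′ lo hi → peelable S′ lo (≤-trans hi (≤-trans (m≤m+n (k + b) (m * b)) (≤-reflexive (+-assoc k b (m * b)))))) bd)
      S (≤-trans le (≤-reflexive (sym (+-assoc k b (m * b))))))
    (≤-reflexive (trans (sym (*-assoc (suc b ^ m) (suc b) M)) (cong (_* M) (*-comm (suc b ^ m) (suc b)))))

  orderBound : ∀ Δ M → (∀ S → (∃ λ v → v ∈ S) → ∃ λ v → v ∈ S × # (S ∩ N v) ≤ Δ) → Bounded Δ M →
    ∀ k S → # S ≤ k → cl S ≤ 1 + k * M
  orderBound Δ M low bd k S le with empty-or-element S
  ... | inj₁ empty = ≤-trans (cl-empty S empty) (m≤m+n 1 _)
  orderBound Δ M low bd zero S le | inj₂ (v , v∈) = contradiction (≤-trans (≤-reflexive (#-remove S v∈)) le) λ ()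
  orderBound Δ M low bd (suc k) S le | inj₂ some = remove (low S some)
    where
    remove : (∃ λ v → v ∈ S × # (S ∩ N v) ≤ Δ) → cl S ≤ 1 + suc k * M
    remove (v , v∈ , deg) = ≤-trans (cl-rec S v v∈)
      (≤-trans (+-mono-≤ (orderBound Δ M low bd k (S ∖ ⁅ v ⁆) (≤-pred (≤-trans (≤-reflexive (#-remove S v∈)) le))) (bd (S ∩ N v) deg))
        (≤-reflexive (cong suc (+-comm (k * M) M))))

  clique⇒subdivision : ∀ t (h : Fin t → V) → (∀ i j → i ≢ j → Adj G (h i) (h j)) → KSubdivision t G
  clique⇒subdivision t h clique = record
    { branch = h
    ; branch-inj = inj
    ; inner = λ _ _ _ → []
    ; isPath = λ i j i<j → step _ _ [] (clique i j (λ { refl → n≮n _ i<j })) (single (h j)) ,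
        ((λ eq → n≮n _ (subst (λ k → toℕ i < toℕ k) (sym (inj i j eq)) i<j)) ∷ []) ∷ [] ∷ []
    ; inner-notBranch = λ _ _ _ _ ()
    ; disjoint = λ _ _ _ _ _ _ _ ()
    }
    where
    inj : ∀ i j → h i ≡ h j → i ≡ j
    inj i j eq with i ≟ j
    ... | yes q = q
    ... | no ne = contradiction (subst (Adj G (h i)) (sym eq) (clique i j ne)) (adj-irr G)

  -- Generalised over a clique `h` complete to `S`: passing to a neighbourhood enlarges `h` and
  -- lowers the exponent k = t - j, and at k = 0 the clique itself is a forbidden subdivision.
  cliqueBound : ∀ t → ¬ KSubdivision t G → ∀ k j (h : Fin j → V) → j + k ≡ t → (∀ i i′ → i ≢ i′ → Adj G (h i) (h i′)) →
    ∀ m S → # S ≤ m → (∀ i v → v ∈ S → Adj G (h i) v) → cl S ≤ suc m ^ k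
  cliqueBound t none zero j h eq clique m S le common =
    contradiction (clique⇒subdivision j h clique) (subst (λ k → ¬ KSubdivision k G) (trans (sym eq) (+-identityʳ j)) none)
  cliqueBound t none (suc k) j h eq clique m S le common with empty-or-element S
  ... | inj₁ empty = ≤-trans (cl-empty S empty) (m^n>0 (suc m) (suc k))
  cliqueBound t none (suc k) j h eq clique zero S le common | inj₂ (v , v∈) = contradiction (≤-trans (≤-reflexive (#-remove S v∈)) le) λ ()
  cliqueBound t none (suc k) j h eq clique (suc m) S le common | inj₂ (v , v∈) = begin
    cl S                            ≤⟨ cl-rec S v v∈ ⟩
    cl (S ∖ ⁅ v ⁆) + cl (S ∩ N v)   ≤⟨ +-mono-≤
        (cliqueBound t none (suc k) j h eq clique m (S ∖ ⁅ v ⁆) less (λ i w w∈ → common i w (proj₁ w∈)))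
        (cliqueBound t none k (suc j) h′ (trans (sym (+-suc j k)) eq) clique′ m (S ∩ N v)
          (≤-trans (#-mono (S ∩ N v) (S ∖ ⁅ v ⁆) λ { w (w∈ , vw) → w∈ , λ { refl → adj-irr G vw } }) less)
          (λ { zero w (w∈ , vw) → vw ; (suc i) w (w∈ , vw) → common i w w∈ })) ⟩
    suc m ^ suc k + suc m ^ k                  ≡⟨ +-comm (suc m ^ suc k) (suc m ^ k) ⟩
    suc (suc m) * suc m ^ k                    ≤⟨ *-monoʳ-≤ (suc (suc m)) (^-monoˡ-≤ k (n≤1+n (suc m))) ⟩
    suc (suc m) ^ suc k             ∎
    where
    open ≤-Reasoning
    less : # (S ∖ ⁅ v ⁆) ≤ m
    less = ≤-pred (≤-trans (≤-reflexive (#-remove S v∈)) le)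
    h′ : Fin (suc j) → V
    h′ zero = v
    h′ (suc i) = h i
    clique′ : ∀ i i′ → i ≢ i′ → Adj G (h′ i) (h′ i′)
    clique′ zero zero ne = contradiction refl ne
    clique′ zero (suc i′) ne = adj-sym G (common i′ v v∈)
    clique′ (suc i) zero ne = common i v v∈
    clique′ (suc i) (suc i′) ne = clique i i′ (ne ∘ cong suc)

  bounded-clique : ∀ t → ¬ KSubdivision t G → ∀ m → Bounded m (suc m ^ t)
  bounded-clique t none m S le = cliqueBound t none t 0 (λ ()) refl (λ ()) m S le (λ ())

-- Subdivisions in nearly complete sets

abstract
  average-arith : ∀ s k b A → 0 < s → 2 * k ≤ s → s ≤ k + A → suc (2 * k * b) * A ≤ k * b * s → ⊥
  average-arith s k b A h₀ h₁ h₂ h₃ = n≮n (2 * (k * b * s)) (begin-strict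
    2 * (k * b * s)            <⟨ m<n+m _ h₀ ⟩
    s + 2 * (k * b * s)        ≡⟨ eq₁ s k b ⟩
    suc (2 * k * b) * s        ≤⟨ *-monoʳ-≤ (suc (2 * k * b)) half ⟩
    suc (2 * k * b) * (2 * A)  ≡⟨ eq₂ (suc (2 * k * b)) A ⟩
    2 * (suc (2 * k * b) * A)  ≤⟨ *-monoʳ-≤ 2 h₃ ⟩
    2 * (k * b * s)            ∎)
    where
    open ≤-Reasoning
    eq₁ : ∀ s k b → s + 2 * (k * b * s) ≡ suc (2 * k * b) * s
    eq₁ = solve-∀
    eq₂ : ∀ c A → c * (2 * A) ≡ 2 * (c * A)
    eq₂ = solve-∀
    half : s ≤ 2 * A
    half = +-cancelˡ-≤ s _ _ (begin
      s + s           ≡⟨ cong (s +_) (sym (+-identityʳ s)) ⟩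
      2 * s           ≤⟨ *-monoʳ-≤ 2 h₂ ⟩
      2 * (k + A)     ≡⟨ *-distribˡ-+ 2 k A ⟩
      2 * k + 2 * A   ≤⟨ +-monoˡ-≤ _ h₁ ⟩
      s + 2 * A       ∎)

  -- The hubs, the midpoints, and the vertices missed by either end of a gap each take at most a
  -- quarter of the set.
  room-arith : ∀ s t m b co → 4 * t ≤ s → 4 * m ≤ s → 4 * b ≤ s → s ≤ co + b + b → t + m ≤ co
  room-arith s t m b co h₁ h₂ h₃ h₄ = +-cancelʳ-≤ (b + b) _ _ (≤-trans (*-cancelˡ-≤ 4 (begin
      4 * (t + m + (b + b))               ≡⟨ eq₁ t m b ⟩
      4 * t + 4 * m + 4 * b + 4 * b       ≤⟨ +-mono-≤ (+-mono-≤ (+-mono-≤ h₁ h₂) h₃) h₃ ⟩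
      s + s + s + s                       ≡⟨ eq₂ s ⟩
      4 * s                               ∎)) (≤-trans h₄ (≤-reflexive (+-assoc co b b))))
    where
    open ≤-Reasoning
    eq₁ : ∀ t m b → 4 * (t + m + (b + b)) ≡ 4 * t + 4 * m + 4 * b + 4 * b
    eq₁ = solve-∀
    eq₂ : ∀ s → s + s + s + s ≡ 4 * s
    eq₂ = solve-∀

  few-arith : ∀ s t m b → 0 < s → m * s ≤ t * t * b → 4 * (t * t * b) ≤ s * s → 4 * m ≤ s
  few-arith s t m b h₀ h₁ h₂ = *-cancelʳ-≤ (4 * m) s s {{>-nonZero h₀}}
    (≤-trans (≤-reflexive (*-assoc 4 m s)) (≤-trans (*-monoʳ-≤ 4 h₁) h₂))

  grow-arith : ∀ s k b m c → c * s ≤ 2 * k * b → m * s ≤ k * k * b → (c + m) * s ≤ suc k * suc k * b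
  grow-arith s k b m c h₁ h₂ = begin
    (c + m) * s                ≡⟨ *-distribʳ-+ s c m ⟩
    c * s + m * s              ≤⟨ +-mono-≤ h₁ h₂ ⟩
    2 * k * b + k * k * b      ≤⟨ m≤m+n _ b ⟩
    2 * k * b + k * k * b + b  ≡⟨ eq k b ⟩
    suc k * suc k * b          ∎
    where
    open ≤-Reasoning
    eq : ∀ k b → 2 * k * b + k * k * b + b ≡ suc k * suc k * b
    eq = solve-∀

module _ {n : ℕ} (G : Graph n) where
  private
    V = Fin n

  nonAdj? : ∀ u v → Dec (¬ Adj G u v)
  nonAdj? u v = ¬? (T? (adj G u v))

  misses : ∀ {k} → (Fin k → V) → V → ℕ
  misses h v = sum λ i → ι (nonAdj? v (h i))

  gaps : ∀ k → (Fin k → V) → List (Fin k × Fin k)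
  gaps zero h = []
  gaps (suc k) h = map (λ j → zero , suc j) (filter (λ j → nonAdj? (h zero) (h (suc j))) (allFin k))
    ++ map (λ (i , j) → suc i , suc j) (gaps k (h ∘ suc))

  length-gaps : ∀ k (h : Fin (suc k) → V) → length (gaps (suc k) h) ≡ misses (h ∘ suc) (h zero) + length (gaps k (h ∘ suc))
  length-gaps k h = trans (length-++ (map (λ j → zero , suc j) (filter (λ j → nonAdj? (h zero) (h (suc j))) (allFin k))))
    (cong₂ _+_ (trans (length-map _ (filter (λ j → nonAdj? (h zero) (h (suc j))) (allFin k))) (length-filter-tabulate (λ j → nonAdj? (h zero) (h (suc j))) id))
               (length-map _ (gaps k (h ∘ suc))))

  ∈-gaps : ∀ k (h : Fin k → V) i j → i <ᶠ j → ¬ Adj G (h i) (h j) → (i , j) ∈ₗ gaps k h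
  ∈-gaps (suc k) h zero (suc j) _ ¬a =
    ∈-++⁺ˡ (∈-map⁺ _ (∈-filter⁺ (λ j → nonAdj? (h zero) (h (suc j))) (∈-allFin j) ¬a))
  ∈-gaps (suc k) h (suc i) (suc j) (s≤s i<j) ¬a =
    ∈-++⁺ʳ (map (λ j → zero , suc j) (filter (λ j → nonAdj? (h zero) (h (suc j))) (allFin k)))
      (∈-map⁺ (λ (i , j) → suc i , suc j) (∈-gaps k (h ∘ suc) i j i<j ¬a))

  module NearlyComplete (t b : ℕ) (S : VSet n) (nonempty : 0 < # S) (c₁ : 4 * t ≤ # S) (c₂ : 4 * b ≤ # S)
    (c₃ : 4 * (t * t * b) ≤ # S * # S) (dense : ∀ v → v ∈ S → # (S ∖ N G v) ≤ b) where

    misses-sum : ∀ {k} (h : Fin k → V) (A : VSet n) → A ⊆ S → (∀ i → h i ∈ S) → sum (λ v → ι (v ∈? A) * misses h v) ≤ k * b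
    misses-sum {k} h A A⊆S h∈ = begin
      sum (λ v → ι (v ∈? A) * misses h v)                     ≤⟨ sum-mono row ⟩
      sum (λ v → sum λ i → ι (v ∈? (S ∖ N G (h i))))          ≡⟨ ∑-comm (λ v i → ι (v ∈? (S ∖ N G (h i)))) ⟩
      sum (λ i → # (S ∖ N G (h i)))                           ≤⟨ sum-mono (λ i → dense (h i) (h∈ i)) ⟩
      sum {k} (λ _ → b)                                       ≡⟨ const k ⟩
      k * b                                                   ∎
      where
      open ≤-Reasoning
      row : ∀ v → ι (v ∈? A) * misses h v ≤ sum (λ i → ι (v ∈? (S ∖ N G (h i))))
      row v with v ∈? A
      ... | no _ = z≤n
      ... | yes v∈ = ≤-trans (≤-reflexive (+-identityʳ _))
              (sum-mono λ i → ι-mono (nonAdj? v (h i)) (v ∈? (S ∖ N G (h i))) λ ¬a → A⊆S v v∈ , ¬a ∘ adj-sym G)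
      const : ∀ k → sum {k} (λ _ → b) ≡ k * b
      const zero = refl
      const (suc k) = cong (b +_) (const k)

    -- The k hubs are missed at most kb times in total, and at least half of `S` lies outside them,
    -- so some vertex there misses at most 2kb / |S| of them.
    nextHub : ∀ {k} (h : Fin k → V) → 2 * k ≤ # S → (∀ i → h i ∈ S) →
      ∃ λ v → v ∈ S × v ∉ image h × misses h v * # S ≤ 2 * k * b
    nextHub {k} h room h∈ = decide (any? λ v → (v ∈? S) ×-dec ¬? (v ∈? image h) ×-dec (misses h v * # S ≤? 2 * k * b))
      where
      decide : Dec (∃ λ v → v ∈ S × v ∉ image h × misses h v * # S ≤ 2 * k * b) → ∃ λ v → v ∈ S × v ∉ image h × misses h v * # S ≤ 2 * k * b
      decide (yes q) = q
      decide (no none) = ⊥-elim (average-arith (# S) k b (# A) nonempty room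
          (≤-trans (#-⊎ S (image h) A cover) (+-monoˡ-≤ (# A) (image-≤ h))) total)
        where
        open ≤-Reasoning
        A : VSet n
        A = S ∖ image h
        cover : ∀ v → v ∈ S → v ∈ image h ⊎ v ∈ A
        cover v v∈ with v ∈? image h
        ... | yes q = inj₁ q
        ... | no ¬q = inj₂ (v∈ , ¬q)
        term : ∀ v → suc (2 * k * b) * ι (v ∈? A) ≤ # S * (ι (v ∈? A) * misses h v)
        term v with v ∈? A
        ... | no _ = ≤-trans (≤-reflexive (*-zeroʳ (suc (2 * k * b)))) z≤n
        ... | yes (v∈ , v∉) = ≤-trans (≤-reflexive (*-identityʳ _)) (≤-trans (≰⇒> λ le → none (v , v∈ , v∉ , le))
                (≤-reflexive (trans (*-comm (misses h v) (# S)) (cong (# S *_) (sym (+-identityʳ _))))))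
        total : suc (2 * k * b) * # A ≤ k * b * # S
        total = begin
          suc (2 * k * b) * # A                              ≡⟨ sym (sum-*ˡ (suc (2 * k * b)) (λ v → ι (v ∈? A))) ⟩
          sum (λ v → suc (2 * k * b) * ι (v ∈? A))           ≤⟨ sum-mono term ⟩
          sum (λ v → # S * (ι (v ∈? A) * misses h v))        ≡⟨ sum-*ˡ (# S) (λ v → ι (v ∈? A) * misses h v) ⟩
          # S * sum (λ v → ι (v ∈? A) * misses h v)          ≤⟨ *-monoʳ-≤ (# S) (misses-sum h A (λ _ → proj₁) h∈) ⟩
          # S * (k * b)                                      ≡⟨ *-comm (# S) (k * b) ⟩
          k * b * # S                                        ∎

    -- The bound k²b / |S| on the gaps is what the increments 2kb / |S| of the greedy choice add up
    -- to; at k = t it is at most |S| / 4.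
    HubSet : ℕ → Set
    HubSet k = ∃ λ (h : Fin k → V) → (∀ i → h i ∈ S) × (∀ i j → h i ≡ h j → i ≡ j) × length (gaps k h) * # S ≤ k * k * b

    hubs : ∀ k → k ≤ t → HubSet k
    hubs zero _ = (λ ()) , (λ ()) , (λ ()) , z≤n
    hubs (suc k) k<t = extend (hubs k (<⇒≤ k<t))
      where
      extend : HubSet k → HubSet (suc k)
      extend (h , h∈ , inj , few) = add (nextHub h (≤-trans (*-mono-≤ {2} {4} (s≤s (s≤s z≤n)) (<⇒≤ k<t)) c₁) h∈)
        where
        add : (∃ λ v → v ∈ S × v ∉ image h × misses h v * # S ≤ 2 * k * b) → HubSet (suc k)
        add (v , v∈ , v∉ , le) = g , (λ { zero → v∈ ; (suc i) → h∈ i }) , g-inj ,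
            subst (λ m → m * # S ≤ suc k * suc k * b) (sym (length-gaps k g)) (grow-arith (# S) k b (length (gaps k h)) (misses h v) le few)
          where
          g : Fin (suc k) → V
          g zero = v
          g (suc i) = h i
          g-inj : ∀ i j → g i ≡ g j → i ≡ j
          g-inj zero zero _ = refl
          g-inj zero (suc j) eq = contradiction (j , eq) v∉
          g-inj (suc i) zero eq = contradiction (i , sym eq) v∉
          g-inj (suc i) (suc j) eq = cong suc (inj i j eq)

    subdivision : KSubdivision t G
    subdivision = build (hubs t ≤-refl)
      where
      build : HubSet t → KSubdivision t G
      build (h , h∈ , inj , few) = record
        { branch = h
        ; branch-inj = inj
        ; inner = inner′
        ; isPath = path
        ; inner-notBranch = λ i j i<j v v∈ k → notHub i j i<j v v∈ k
        ; disjoint = λ i j i<j i′ j′ i′<j′ v v∈ v∈′ → disj i j i<j i′ j′ i′<j′ v v∈ v∈′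
        }
        where
        gap : List (Fin t × Fin t)
        gap = gaps t h
        hubList : List V
        hubList = map h (allFin t)
        common : Fin t × Fin t → VSet n
        common (i , j) = S ∩ N G (h i) ∩ N G (h j)
        common-size : ∀ e → # S ≤ # (common e) + b + b
        common-size (i , j) = ≤-trans (#-⊎ S (common (i , j) ∪ (S ∖ N G (h i))) (S ∖ N G (h j)) cover)
            (+-mono-≤ (≤-trans (#-⊎ (common (i , j) ∪ (S ∖ N G (h i))) (common (i , j)) (S ∖ N G (h i)) λ _ → id) (+-monoʳ-≤ _ (dense (h i) (h∈ i)))) (dense (h j) (h∈ j)))
          where
          cover : ∀ v → v ∈ S → v ∈ common (i , j) ∪ (S ∖ N G (h i)) ⊎ v ∈ S ∖ N G (h j)
          cover v v∈ with v ∈? N G (h i) | v ∈? N G (h j)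
          ... | yes a | yes a′ = inj₁ (inj₁ ((v∈ , a) , a′))
          ... | no ¬a | _ = inj₁ (inj₂ (v∈ , ¬a))
          ... | yes _ | no ¬a = inj₂ (v∈ , ¬a)
        mids : Transversal (length gap) (λ k → common (List.lookup gap k)) hubList
        mids = transversal (length gap) (λ k → common (List.lookup gap k)) hubList λ k →
          ≤-trans (+-monoˡ-≤ (length gap) (≤-reflexive (trans (length-map h (allFin t)) (length-tabulate {n = t} (λ x → x)))))
            (room-arith (# S) t (length gap) b (# (common (List.lookup gap k))) c₁ (few-arith (# S) t (length gap) b nonempty few c₃) c₂ (common-size (List.lookup gap k)))
        mid : ∀ {e} → e ∈ₗ gap → V
        mid e∈ = proj₁ mids (index e∈)
        mid-common : ∀ {e} (e∈ : e ∈ₗ gap) → mid e∈ ∈ common e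
        mid-common e∈ = subst (λ e → mid e∈ ∈ common e) (sym (lookup-index e∈)) (proj₁ (proj₂ mids) (index e∈))
        inner′ : (i j : Fin t) → i <ᶠ j → List V
        inner′ i j i<j with T? (adj G (h i) (h j))
        ... | yes _ = []
        ... | no ¬a = mid (∈-gaps t h i j i<j ¬a) ∷ []
        inner-mid : ∀ i j i<j v → v ∈ₗ inner′ i j i<j → ∃ λ (e∈ : (i , j) ∈ₗ gap) → v ≡ mid e∈
        inner-mid i j i<j v v∈ with T? (adj G (h i) (h j)) | v∈
        ... | no ¬a | here eq = ∈-gaps t h i j i<j ¬a , eq
        mid-≢ : ∀ {e} (e∈ : e ∈ₗ gap) k → mid e∈ ≢ h k
        mid-≢ e∈ k eq = proj₁ (proj₂ (proj₂ mids)) (index e∈) (subst (_∈ₗ hubList) (sym eq) (∈-map⁺ h (∈-allFin k)))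
        notHub : ∀ i j i<j v → v ∈ₗ inner′ i j i<j → ∀ k → v ≢ h k
        notHub i j i<j v v∈ k eq = let e∈ , eq′ = inner-mid i j i<j v v∈ in mid-≢ e∈ k (trans (sym eq′) eq)
        disj : ∀ i j i<j i′ j′ i′<j′ v → v ∈ₗ inner′ i j i<j → v ∈ₗ inner′ i′ j′ i′<j′ → i ≡ i′ × j ≡ j′
        disj i j i<j i′ j′ i′<j′ v v∈ v∈′ =
          let e∈ , eq = inner-mid i j i<j v v∈
              e∈′ , eq′ = inner-mid i′ j′ i′<j′ v v∈′
              same = trans (lookup-index e∈) (trans (cong (List.lookup gap) (proj₂ (proj₂ (proj₂ mids)) (trans (sym eq) eq′))) (sym (lookup-index e∈′)))
          in cong proj₁ same , cong proj₂ same
        h-≢ : ∀ i j → i <ᶠ j → h i ≢ h j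
        h-≢ i j i<j eq = n≮n _ (subst (λ k → toℕ i < toℕ k) (sym (inj i j eq)) i<j)
        path : ∀ i j (i<j : i <ᶠ j) → IsPath G (h i ∷ inner′ i j i<j ++ [ h j ])
        path i j i<j with T? (adj G (h i) (h j))
        ... | yes a = step _ _ [] a (single (h j)) , (h-≢ i j i<j ∷ []) ∷ [] ∷ []
        ... | no ¬a = step _ _ _ (proj₂ (proj₁ in-common)) (step _ _ [] (adj-sym G (proj₂ in-common)) (single (h j))) ,
              ((λ eq → mid-≢ e∈ i (sym eq)) ∷ h-≢ i j i<j ∷ []) ∷ (mid-≢ e∈ j ∷ []) ∷ [] ∷ []
          where
          e∈ : (i , j) ∈ₗ gap
          e∈ = ∈-gaps t h i j i<j ¬a
          in-common : mid e∈ ∈ common (i , j)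
          in-common = mid-common e∈

  peelable : ∀ t → ¬ KSubdivision t G → ∀ b S → 0 < # S → 4 * t ≤ # S → 4 * b ≤ # S → 4 * (t * t * b) ≤ # S * # S →
    ∃ λ v → v ∈ S × # (S ∩ N G v) + b ≤ # S
  peelable t none b S ne c₁ c₂ c₃ = decide (any? λ v → (v ∈? S) ×-dec (# (S ∩ N G v) + b ≤? # S))
    where
    decide : Dec (∃ λ v → v ∈ S × # (S ∩ N G v) + b ≤ # S) → ∃ λ v → v ∈ S × # (S ∩ N G v) + b ≤ # S
    decide (yes q) = q
    decide (no stuck) = contradiction (NearlyComplete.subdivision t b S ne c₁ c₂ c₃ dense) none
      where
      dense : ∀ v → v ∈ S → # (S ∖ N G v) ≤ b
      dense v v∈ = ≮⇒≥ λ lt → stuck (v , v∈ , ≤-trans (+-monoʳ-≤ _ (<⇒≤ lt))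
        (#-disjoint (S ∩ N G v) (S ∖ N G v) S (λ _ → proj₁) (λ _ → proj₁) λ w p q → proj₂ q (proj₂ p)))

-- The exponents and the final bound

2^-+ : ∀ a b → 2 ^ (a + b) ≡ 2 ^ a * 2 ^ b
2^-+ = ^-distribˡ-+-* 2

2^-mono : ∀ {a b} → a ≤ b → 2 ^ a ≤ 2 ^ b
2^-mono = ^-monoʳ-≤ 2

2^-dbl : ∀ a → 2 ^ a + 2 ^ a ≡ 2 ^ suc a
2^-dbl a = cong (2 ^ a +_) (sym (+-identityʳ (2 ^ a)))

suc-2^ : ∀ a → suc (2 ^ a) ≤ 2 ^ suc a
suc-2^ a = ≤-trans (+-monoˡ-≤ (2 ^ a) (m^n>0 2 a)) (≤-reflexive (2^-dbl a))

-- Set sizes and block lengths are powers of two below; rounding t up to such a power costs the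
-- factor two between 25 and 50.
dyadicCeiling : ∀ r → ∃ λ τ → suc r ≤ 2 ^ τ × 2 ^ τ ≤ 2 * suc r
dyadicCeiling zero = 0 , ≤-refl , s≤s z≤n
dyadicCeiling (suc r) with dyadicCeiling r
... | τ , lo , hi with suc (suc r) ≤? 2 ^ τ
... | yes le = τ , le , ≤-trans hi (*-monoʳ-≤ 2 (n≤1+n (suc r)))
... | no ¬le = suc τ , subst (λ x → suc (suc r) ≤ 2 * x) eq (≤-trans (s≤s (s≤s (m≤m+n r _))) (≤-reflexive (dbl r))) ,
      subst (λ x → 2 * x ≤ 2 * suc (suc r)) eq (*-monoʳ-≤ 2 (n≤1+n (suc r)))
  where
  eq : suc r ≡ 2 ^ τ
  eq = ≤-antisym lo (≤-pred (≰⇒> ¬le))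
  dbl : ∀ r → suc (suc (r + r)) ≡ 2 * suc r
  dbl = solve-∀

abstract
  -- At exponent ten this holds with room to spare, and from there on doubling the right side
  -- outweighs the growth of the quadratic.
  growth : ∀ k → 1 + (2 * (10 + k) + 5) * (16 * (10 + k) + 24) ≤ 11 * 2 ^ (10 + k)
  growth zero = ≤ᵇ⇒≤ _ _ _
  growth (suc k) = begin
    1 + (2 * (10 + suc k) + 5) * (16 * (10 + suc k) + 24)
      ≤⟨ m≤m+n _ (32 * (k * k) + 704 * k + 3801) ⟩
    1 + (2 * (10 + suc k) + 5) * (16 * (10 + suc k) + 24) + (32 * (k * k) + 704 * k + 3801)
      ≡⟨ eq₁ k ⟩
    2 * (1 + (2 * (10 + k) + 5) * (16 * (10 + k) + 24))
      ≤⟨ *-monoʳ-≤ 2 (growth k) ⟩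
    2 * (11 * 2 ^ (10 + k))
      ≡⟨ eq₂ (2 ^ (10 + k)) ⟩
    11 * (2 * 2 ^ (10 + k))
      ≡⟨⟩
    11 * 2 ^ (10 + suc k) ∎
    where
    open ≤-Reasoning
    eq₁ : ∀ k → 1 + (2 * (10 + suc k) + 5) * (16 * (10 + suc k) + 24) + (32 * (k * k) + 704 * k + 3801)
      ≡ 2 * (1 + (2 * (10 + k) + 5) * (16 * (10 + k) + 24))
    eq₁ = solve-∀
    eq₂ : ∀ x → 2 * (11 * x) ≡ 11 * (2 * x)
    eq₂ = solve-∀

  budget : ∀ X c r → 1 + c ≤ 11 * X → X ≤ 2 * suc r → 1 + (14 * X + c) ≤ 50 * suc r
  budget X c r h₁ h₂ = begin
    1 + (14 * X + c)      ≡⟨ eq₁ X c ⟩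
    14 * X + (1 + c)      ≤⟨ +-monoʳ-≤ (14 * X) h₁ ⟩
    14 * X + 11 * X       ≡⟨ eq₂ X ⟩
    25 * X                ≤⟨ *-monoʳ-≤ 25 h₂ ⟩
    25 * (2 * suc r)      ≡⟨ eq₃ r ⟩
    50 * suc r            ∎
    where
    open ≤-Reasoning
    eq₁ : ∀ X c → 1 + (14 * X + c) ≡ 14 * X + (1 + c)
    eq₁ = solve-∀
    eq₂ : ∀ X → 14 * X + 11 * X ≡ 25 * X
    eq₂ = solve-∀
    eq₃ : ∀ r → 25 * (2 * suc r) ≡ 50 * suc r
    eq₃ = solve-∀

  -- The reserve (4i + 10) · 2P kept at one level pays exactly for the next doubling, (2i + 3) · 2P,
  -- and the next reserve.
  level-arith : ∀ e i P R → e + (4 * i + 10) * (2 * P) ≤ R → (2 * i + 3) * (2 * P) + e + (4 * suc i + 10) * P ≤ R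
  level-arith e i P R h = ≤-trans (≤-reflexive (eq e i P)) h
    where
    eq : ∀ e i P → (2 * i + 3) * (2 * P) + e + (4 * suc i + 10) * P ≡ e + (4 * i + 10) * (2 * P)
    eq = solve-∀

  square-arith : ∀ t x b → t ≤ x → 4 * (t * t * b) ≤ 4 * (x * x * b)
  square-arith t x b h = *-monoʳ-≤ 4 (*-monoˡ-≤ b (*-mono-≤ h h))

  density-arith : ∀ r → 21 * (suc r * suc r) + 3 ≤ 32 * ((suc r * suc r) * (suc r * suc r))
  density-arith r = ≤-trans (m≤m+n _ (32 * (q * q) + 43 * q + 8)) (≤-reflexive (eq q))
    where
    q : ℕ
    q = r + r * suc r
    eq : ∀ q → 21 * suc q + 3 + (32 * (q * q) + 43 * q + 8) ≡ 32 * (suc q * suc q)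
    eq = solve-∀

  density-arith′ : ∀ m → m ≤ 2 * (32 * m)
  density-arith′ m = ≤-trans (m≤m+n m (63 * m)) (≤-reflexive (eq m))
    where
    eq : ∀ m → m + 63 * m ≡ 2 * (32 * m)
    eq = solve-∀

  total-arith : ∀ n M → 0 < n → 0 < M → 1 + n * M ≤ 2 * M * n
  total-arith n M h₁ h₂ = ≤-trans (+-monoˡ-≤ (n * M) (*-mono-≤ h₁ h₂)) (≤-reflexive (eq n M))
    where
    eq : ∀ n M → n * M + n * M ≡ 2 * M * n
    eq = solve-∀

module _ {n : ℕ} (G : Graph n) (t τ : ℕ) (none : ¬ KSubdivision t G) (t≤ : t ≤ 2 ^ τ) where

  bounded-mono : ∀ {k k′ M M′} → k′ ≤ k → M ≤ M′ → Bounded G k M → Bounded G k′ M′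
  bounded-mono hk hM bd S le = ≤-trans (bd S (≤-trans le hk)) hM

  four-hubs : ∀ k → 2 + τ ≤ k → 4 * t ≤ 2 ^ k
  four-hubs k le = ≤-trans (*-monoʳ-≤ 4 t≤) (≤-trans (≤-reflexive (sym (2^-+ 2 τ))) (2^-mono le))

  four-links : ∀ k β → 2 + (τ + τ + β) ≤ k + k → 4 * (t * t * 2 ^ β) ≤ 2 ^ k * 2 ^ k
  four-links k β le = begin
    4 * (t * t * 2 ^ β)           ≤⟨ square-arith t (2 ^ τ) (2 ^ β) t≤ ⟩
    4 * (2 ^ τ * 2 ^ τ * 2 ^ β)   ≡⟨ cong (λ x → 4 * (x * 2 ^ β)) (sym (2^-+ τ τ)) ⟩
    4 * (2 ^ (τ + τ) * 2 ^ β)     ≡⟨ cong (4 *_) (sym (2^-+ (τ + τ) β)) ⟩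
    4 * 2 ^ (τ + τ + β)           ≡⟨ sym (2^-+ 2 (τ + τ + β)) ⟩
    2 ^ (2 + (τ + τ + β))         ≤⟨ 2^-mono le ⟩
    2 ^ (k + k)                   ≡⟨ 2^-+ k k ⟩
    2 ^ k * 2 ^ k                 ∎
    where open ≤-Reasoning

  -- The upper half of the size range is filled by 2^m blocks of length 2^β, each costing a factor
  -- 2^β + 1 ≤ 2^(β+1).
  double : ∀ k β m e → 2 + τ ≤ k → 2 + β ≤ k → 2 + (τ + τ + β) ≤ k + k → m + β ≡ k →
    Bounded G (2 ^ k) (2 ^ e) → Bounded G (2 ^ suc k) (2 ^ (suc β * 2 ^ m + e))
  double k β m e h₁ h₂ h₃ eq bd = bounded-mono (≤-reflexive size≡) cost
    (peel* G (2 ^ m) (2 ^ k) (2 ^ β) (2 ^ e) (λ S lo _ → peelable G t none (2 ^ β) S (≤-<-trans z≤n lo)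
      (≤-trans (four-hubs k h₁) (<⇒≤ lo))
      (≤-trans (≤-trans (≤-reflexive (sym (2^-+ 2 β))) (2^-mono h₂)) (<⇒≤ lo))
      (≤-trans (four-links k β h₃) (*-mono-≤ (<⇒≤ lo) (<⇒≤ lo)))) bd)
    where
    size≡ : 2 ^ suc k ≡ 2 ^ k + 2 ^ m * 2 ^ β
    size≡ = trans (sym (2^-dbl k)) (cong (2 ^ k +_) (trans (cong (2 ^_) (sym eq)) (2^-+ m β)))
    cost : suc (2 ^ β) ^ (2 ^ m) * 2 ^ e ≤ 2 ^ (suc β * 2 ^ m + e)
    cost = ≤-trans (*-monoˡ-≤ (2 ^ e) (≤-trans (^-monoˡ-≤ (2 ^ m) (suc-2^ β)) (≤-reflexive (^-*-assoc 2 (suc β) (2 ^ m)))))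
      (≤-reflexive (sym (2^-+ (suc β * 2 ^ m) e)))

  -- From size 2^(τ+2+i) to the next, 2^(τ−i) blocks of length 4^(i+1) cost the factor 2^((2i+3) 2^(τ−i));
  -- the total over all remaining levels is (4i+10) 2^(τ−i).
  levels : ∀ i d → i + suc d ≡ τ → ∃ λ e → e + (4 * i + 10) * 2 ^ suc d ≤ 14 * 2 ^ τ × Bounded G (2 ^ (2 + (τ + i))) (2 ^ e)
  levels zero d refl = 2 ^ (2 + suc d) ,
    ≤-reflexive (trans (cong (_+ 10 * 2 ^ suc d) (2^-+ 2 (suc d))) (eq (2 ^ suc d))) ,
    bounded-mono (≤-reflexive (cong (λ x → 2 ^ (2 + x)) (+-identityʳ (suc d)))) ≤-refl (bounded-2^ G (2 ^ (2 + suc d)))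
    where
    eq : ∀ x → 4 * x + 10 * x ≡ 14 * x
    eq = solve-∀
  levels (suc i) d eq with levels i (suc d) (trans (+-suc i (suc d)) eq)
  ... | e , le , bd = (2 * i + 3) * 2 ^ suc (suc d) + e , level-arith e i (2 ^ suc d) _ le ,
        bounded-mono (≤-reflexive (cong (λ x → 2 ^ suc (suc x)) (+-suc τ i)))
          (≤-reflexive (cong (λ x → 2 ^ (x * 2 ^ suc (suc d) + e)) (β-eq i)))
          (double (2 + (τ + i)) (2 + (i + i)) (suc (suc d)) e (s≤s (s≤s (m≤m+n τ i)))
            (≤-trans (s≤s (s≤s (s≤s (s≤s (m≤m+n (i + i) d))))) (≤-reflexive (trans (h₂ i d) (cong (λ x → 2 + (x + i)) eq))))
            (≤-reflexive (h₃ τ i)) (trans (h₄ i d) (cong (λ x → 2 + (x + i)) eq)) bd)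
    where
    β-eq : ∀ i → suc (2 + (i + i)) ≡ 2 * i + 3
    β-eq = solve-∀
    h₂ : ∀ i d → 2 + (2 + (i + i + d)) ≡ 2 + (suc i + suc d + i)
    h₂ = solve-∀
    h₃ : ∀ τ i → 2 + (τ + τ + (2 + (i + i))) ≡ 2 + (τ + i) + (2 + (τ + i))
    h₃ = solve-∀
    h₄ : ∀ i d → suc (suc d) + (2 + (i + i)) ≡ 2 + (suc i + suc d + i)
    h₄ = solve-∀

  module _ (σ : ℕ) (τ≡ : τ ≡ suc σ) where

    start : Bounded G (2 ^ (2 * τ + 1)) (2 ^ (14 * 2 ^ τ))
    start with levels σ 0 (trans (+-comm σ 1) (sym τ≡))
    ... | e , le , bd = bounded-mono (≤-reflexive (cong (2 ^_) eq)) (2^-mono (≤-trans (m≤m+n e _) le)) bd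
      where
      eq : 2 * τ + 1 ≡ 2 + (τ + σ)
      eq rewrite τ≡ = eq′ σ
        where
        eq′ : ∀ σ → 2 * suc σ + 1 ≡ 2 + (suc σ + σ)
        eq′ = solve-∀

    -- From size 2^(2τ+1) on, the condition 4b ≤ |S| is the binding one, so each doubling uses four
    -- blocks of a quarter of the current size. The 2τ + 5 doublings lead to 2^(4τ+6), which is at
    -- least 64t⁴; each adds at most 4(4τ + 6) to the exponent.
    climb : ∀ j → j ≤ 2 * τ + 5 → Bounded G (2 ^ (2 * τ + 1 + j)) (2 ^ (14 * 2 ^ τ + j * (16 * τ + 24)))
    climb zero _ = bounded-mono (≤-reflexive (cong (2 ^_) (+-identityʳ (2 * τ + 1)))) (≤-reflexive (cong (2 ^_) (sym (+-identityʳ (14 * 2 ^ τ))))) start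
    climb (suc j) j<  = bounded-mono (≤-reflexive (cong (2 ^_) (+-suc (2 * τ + 1) j))) (2^-mono cost)
      (double k β 2 (14 * 2 ^ τ + j * (16 * τ + 24)) h₁ (≤-reflexive (sym k≡)) h₃ (sym k≡) (climb j (<⇒≤ j<)))
      where
      k β : ℕ
      k = 2 * τ + 1 + j
      β = 2 * σ + 1 + j
      k≡ : k ≡ 2 + β
      k≡ rewrite τ≡ = eq σ j
        where
        eq : ∀ σ j → 2 * suc σ + 1 + j ≡ 2 + (2 * σ + 1 + j)
        eq = solve-∀
      h₁ : 2 + τ ≤ k
      h₁ rewrite τ≡ = ≤-trans (m≤m+n _ (σ + j)) (≤-reflexive (eq σ j))
        where
        eq : ∀ σ j → 2 + suc σ + (σ + j) ≡ 2 * suc σ + 1 + j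
        eq = solve-∀
      h₃ : 2 + (τ + τ + β) ≤ k + k
      h₃ = ≤-trans (≤-trans (≤-reflexive (eq τ β)) (+-monoʳ-≤ (τ + τ) (≤-reflexive (sym k≡)))) (+-monoˡ-≤ k (≤-trans (≤-reflexive (eq′ τ)) (≤-trans (m≤m+n (2 * τ) 1) (m≤m+n (2 * τ + 1) j))))
        where
        eq : ∀ τ β → 2 + (τ + τ + β) ≡ τ + τ + (2 + β)
        eq = solve-∀
        eq′ : ∀ τ → τ + τ ≡ 2 * τ
        eq′ = solve-∀
      cost : suc β * 4 + (14 * 2 ^ τ + j * (16 * τ + 24)) ≤ 14 * 2 ^ τ + suc j * (16 * τ + 24)
      cost = ≤-trans (+-monoˡ-≤ (14 * 2 ^ τ + j * (16 * τ + 24)) each) (≤-reflexive (swap (16 * τ + 24) (14 * 2 ^ τ) (j * (16 * τ + 24))))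
        where
        swap : ∀ a b c → a + (b + c) ≡ b + (a + c)
        swap = solve-∀
        each : suc β * 4 ≤ 16 * τ + 24
        each = ≤-trans (*-monoˡ-≤ 4 (≤-trans (n≤1+n (suc β)) (≤-trans (≤-reflexive (sym k≡)) (+-monoʳ-≤ (2 * τ + 1) (<⇒≤ j<))))) (≤-reflexive (eq τ))
          where
          eq : ∀ τ → (2 * τ + 1 + (2 * τ + 5)) * 4 ≡ 16 * τ + 24
          eq = solve-∀

  bounded-large : ∀ κ → τ ≡ 10 + κ → ∃ λ e → e ≡ 14 * 2 ^ τ + (2 * τ + 5) * (16 * τ + 24) × Bounded G (2 ^ (4 * τ + 6)) (2 ^ e)
  bounded-large κ eq = _ , refl , bounded-mono (≤-reflexive (cong (2 ^_) (sum≡ τ))) ≤-refl (climb (9 + κ) eq (2 * τ + 5) ≤-refl)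
    where
    sum≡ : ∀ τ → 4 * τ + 6 ≡ 2 * τ + 1 + (2 * τ + 5)
    sum≡ = solve-∀

  -- The sets have at most 2^42 vertices, and a clique has fewer than t of them; the base is rounded
  -- up to 2^43.
  bounded-small : τ ≤ 9 → Bounded G (2 ^ (4 * τ + 6)) (2 ^ (43 * t))
  bounded-small le = bounded-mono ≤-refl
    (≤-trans (^-monoˡ-≤ t (≤-trans (suc-2^ (4 * τ + 6)) (2^-mono (s≤s (+-monoˡ-≤ 6 (*-monoʳ-≤ 4 le)))))) (≤-reflexive (^-*-assoc 2 43 t)))
    (bounded-clique G t none (2 ^ (4 * τ + 6)))

cliqueCount : ∀ {n} r → 0 < n → (G : Graph n) → ¬ KSubdivision (suc r) G → numCliques G ≤ 2 ^ (50 * suc r) * n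
cliqueCount {n} r n>0 G none = decide (dyadicCeiling r)
  where
  t l : ℕ
  t = suc r
  l = 32 * ((t * t) * (t * t))
  finish : ∀ τ e → t ≤ 2 ^ τ → 1 + e ≤ 50 * t → Bounded G (2 ^ (4 * τ + 6)) (2 ^ e) → numCliques G ≤ 2 ^ (50 * t) * n
  finish τ e t≤ e≤ bd = begin
    numCliques G          ≤⟨ numCliques≤cl G ⟩
    cl G full             ≤⟨ orderBound G (2 * l) (2 ^ e) low (bounded-mono G t τ none t≤ Δ≤ ≤-refl bd) n full (≤-reflexive #-full) ⟩
    -- Absorbing the summand 1 doubles the bound; this is why one unit of the exponent was kept in
    -- reserve.
    1 + n * 2 ^ e         ≤⟨ total-arith n (2 ^ e) n>0 (m^n>0 2 e) ⟩
    2 ^ (1 + e) * n       ≤⟨ *-monoˡ-≤ n (2^-mono e≤) ⟩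
    2 ^ (50 * t) * n      ∎
    where
    open ≤-Reasoning
    low : ∀ S → (∃ λ v → v ∈ S) → ∃ λ v → v ∈ S × # (S ∩ N G v) ≤ 2 * l
    low S some = let v , v∈ , deg = degenerate G r l (density-arith r) (density-arith′ ((t * t) * (t * t))) none S some in
      v , v∈ , ≤-trans (#-mono (S ∩ N G v) (nbr (net G S) v) λ w (w∈ , e) → e , v∈ , w∈) deg
    Δ≤ : 2 * l ≤ 2 ^ (4 * τ + 6)
    Δ≤ = begin
      2 * (32 * ((t * t) * (t * t)))                   ≤⟨ *-monoʳ-≤ 2 (*-monoʳ-≤ 32 (*-mono-≤ (*-mono-≤ t≤ t≤) (*-mono-≤ t≤ t≤))) ⟩
      2 * (32 * ((2 ^ τ * 2 ^ τ) * (2 ^ τ * 2 ^ τ)))   ≡⟨ eq (2 ^ τ) ⟩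
      (2 ^ τ) ^ 4 * 2 ^ 6                              ≡⟨ cong (_* 2 ^ 6) (^-*-assoc 2 τ 4) ⟩
      2 ^ (τ * 4) * 2 ^ 6                              ≡⟨ sym (2^-+ (τ * 4) 6) ⟩
      2 ^ (τ * 4 + 6)                                  ≡⟨ cong (λ x → 2 ^ (x + 6)) (*-comm τ 4) ⟩
      2 ^ (4 * τ + 6)                                  ∎
      where
      eq : ∀ x → 2 * (32 * ((x * x) * (x * x))) ≡ (x * (x * (x * (x * 1)))) * 64
      eq = solve-∀
  decide : (∃ λ τ → t ≤ 2 ^ τ × 2 ^ τ ≤ 2 * t) → numCliques G ≤ 2 ^ (50 * t) * n
  decide (τ , t≤ , ≤2t) = [ small , large ]′ (≤-<-connex τ 9)
    where
    small : τ ≤ 9 → numCliques G ≤ 2 ^ (50 * t) * n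
    small le = finish τ (43 * t) t≤ (≤-trans (+-monoˡ-≤ (43 * t) (s≤s (z≤n {r}))) (*-monoˡ-≤ t {44} {50} (≤ᵇ⇒≤ 44 50 _))) (bounded-small G t τ none t≤ le)
    large : 9 < τ → numCliques G ≤ 2 ^ (50 * t) * n
    large lt = big (bounded-large G t τ none t≤ (τ ∸ 10) κ≡)
      where
      κ≡ : τ ≡ 10 + (τ ∸ 10)
      κ≡ = sym (m+[n∸m]≡n lt)
      big : (∃ λ e → e ≡ 14 * 2 ^ τ + (2 * τ + 5) * (16 * τ + 24) × Bounded G (2 ^ (4 * τ + 6)) (2 ^ e)) → numCliques G ≤ 2 ^ (50 * t) * n
      big (e , refl , bd) = finish τ e t≤ (budget (2 ^ τ) _ r
        (subst (λ x → 1 + (2 * x + 5) * (16 * x + 24) ≤ 11 * 2 ^ x) (sym κ≡) (growth (τ ∸ 10))) ≤2t) bd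

theorem1 : (t n : ℕ) → .{{NonZero t}} → .{{NonZero n}} → (G : Graph n) →
    ¬ ContainsKSubdivision t G → numCliques G ≤ 2 ^ (50 * t) * n
theorem1 zero n G none = contradiction (clique⇒subdivision G 0 (λ ()) (λ ())) none
theorem1 (suc r) n G none = cliqueCount r (>-nonZero⁻¹ n) G none
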